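{- Let $m\ge 2$ and let $T$ be an $m$-uniform hypertree with $k$ edges and even diameter $d=2p$. Suppose $k\ge \dfrac{(4d^2-1)(m-1)+2}{4}$. Then: (i) $\lambda_1(T)\le \lambda_1(T_d(c_{p+1}=k-d))$, and equality holds only if $T=T_d(c_{p+1}=k-d)$; (ii) $\lambda_1(T)<\dfrac{m-1+\sqrt{(m-1)^2+4(k-d)(m-1)}}{2m-2}$.
   Context: A hypergraph has a finite vertex set and an edge set of non-empty subsets of the vertex set; it is $m$-uniform if all edges have cardinality $m$, and linear if two distinct edges share at most one vertex. The adjacency matrix of a linear $m$-uniform hypergraph $\mathcal{H}$ has $(i,j)$ entry $\frac{1}{m-1}$ if $i\ne j$ lie in a common edge, and $0$ otherwise; $\lambda_1(\mathcal{H})$ denotes its spectral radius. The degree of a vertex is the number of edges containing it; a vertex is pendant if its degree is one and non-pendant if its degree is larger. A loose path of length $d$, $P_L(d)=v_1e_1v_2e_2\dots v_de_dv_{d+1}$, is the $m$-uniform hypergraph with edges $e_1,\dots,e_d$ such that $e_{i-1}\cap e_i=\{v_i\}$ for $2\le i\le d$ (the $v_i$ distinct), non-consecutive edges are disjoint, and $v_1\in e_1$, $v_{d+1}\in e_d$ are pendant. A loose cycle of length $l\ge3$, $v_1e_1v_2e_2\dots v_le_lv_1$, is the $m$-uniform hypergraph with edges $e_1,\dots,e_l$ in which cyclically consecutive edges meet exactly in $v_i$ ($e_{i-1}\cap e_i=\{v_i\}$, indices mod $l$, the $v_i$ distinct) and non-consecutive edges are disjoint. A hypertree is a connected linear hypergraph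 containing no loose cycle in which every edge contains at most two non-pendant vertices. The diameter is the maximum distance between two vertices, distance being the minimum length (number of edges) of a path joining them. Attaching a pendant edge at a vertex $v$ means adding a new edge consisting of $v$ and $m-1$ new vertices. $T_d(c_2,\dots,c_d)$ is the hypertree obtained from $P_L(d)=v_1e_1v_2\dots v_de_dv_{d+1}$ by attaching $c_i$ pendant edges at $v_i$ for $i=2,\dots,d$; when only some of the $c_i$ are listed, the others are $0$. Equality of hypergraphs means isomorphism. -}

module Defs where

open import Algebra.Apartness.Bundles using (HeytingField; HeytingCommutativeRing)
open import Algebra.Bundles using (CommutativeRing)
import Algebra.Definitions.RawMonoid
import Algebra.Properties.Monoid.Sum
open import Data.Bool.Base using (Bool; T; _∧_; if_then_else_)
open import Data.Bool.Properties using (T-≡; T-∧)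
open import Data.Empty using (⊥-elim)
open import Data.Fin.Base as Fin using (Fin; zero; suc; toℕ; fromℕ; fromℕ<; inject₁; splitAt; remQuot; combine; _↑ˡ_; _↑ʳ_)
open import Data.Fin.Properties as Fin using (toℕ-injective; toℕ≤pred[n]; toℕ-fromℕ<; remQuot-combine; any?)
open import Data.Fin.Subset using (Subset; Nonempty; Empty; ∣_∣; _∈_; _∩_; ⁅_⁆; ⊥)
open import Data.Fin.Subset.Properties using (_∈?_; ∉⊥)
open import Data.Integer.Base as ℤ using (+_)
open import Data.List.Base using (List; lookup; concatMap; replicate; allFin)
open import Data.Nat.Base as ℕ using (ℕ; NonZero; NonTrivial; >-nonZero⁻¹)
import Data.Nat.Properties as ℕ
open import Data.Product.Base using (∃-syntax; Σ-syntax; _×_; _,_; proj₁; proj₂)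
open import Data.Rational.Unnormalised.Base using (ℚᵘ; _/_)
open import Data.Sum.Base using (_⊎_; inj₁; inj₂)
open import Data.Vec.Base as Vec using (tabulate; _++_)
open import Data.Vec.Properties using (lookup∘tabulate; lookup-++ˡ; lookup-++ʳ; []=⇒lookup; lookup⇒[]=; ++-injectiveˡ; ++-injectiveʳ)
open import Data.Vec.Functional using (Vector)
open import Function.Bundles using (_↔_; _⇔_; Inverse; Equivalence)
open import Function.Definitions using (Injective)
open import Level using (_⊔_) renaming (suc to lsuc)
open import Relation.Binary.Core using (Rel)
open import Relation.Binary.PropositionalEquality using (_≡_; _≢_; sym; trans; cong; subst)
open import Relation.Binary.Structures using (IsStrictPartialOrder)
open import Relation.Nullary using (¬_; Dec; does; ¬?; _×-dec_)
open import Relation.Nullary.Decidable using (⌊_⌋; toWitness; fromWitness)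

-- The reals, axiomatised constructively as a Cauchy-complete Archimedean
-- ordered field.  Classically this determines ℝ up to isomorphism.  No
-- decidability of the order is assumed, so that Bishop's Cauchy reals and
-- the Dedekind reals satisfy these axioms without the excluded middle.

record RealNumbers c ℓ₁ ℓ₂ : Set (lsuc (c ⊔ ℓ₁ ⊔ ℓ₂)) where
  infix 4 _<_ _≤_
  field
    heytingField : HeytingField c ℓ₁ ℓ₂

  open HeytingField heytingField public
    renaming (sym to ≈-sym; refl to ≈-refl; trans to ≈-trans; reflexive to ≈-reflexive)

  field
    _<_                  : Rel Carrier ℓ₂
    isStrictPartialOrder : IsStrictPartialOrder _≈_ _<_
    #⇒<⊎>                : ∀ {x y} → x # y → x < y ⊎ y < x
    <⇒#                  : ∀ {x y} → x < y → x # y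
    0<1                  : 0# < 1#
    +-monoˡ-<            : ∀ z {x y} → x < y → x + z < y + z
    *-pos                : ∀ {x y} → 0# < x → 0# < y → 0# < x * y

  open IsStrictPartialOrder isStrictPartialOrder public
    using (<-resp-≈; <-respˡ-≈; <-respʳ-≈)
    renaming (irrefl to <-irrefl; trans to <-trans; asym to <-asym)

  _≤_ : Rel Carrier ℓ₂
  x ≤ y = ¬ (y < x)

  realRing : CommutativeRing c ℓ₁
  realRing = HeytingCommutativeRing.commutativeRing heytingCommutativeRing

  open Algebra.Properties.Monoid.Sum (CommutativeRing.+-monoid realRing) public
    using (sum)

  fromℕ# : ℕ → Carrier
  fromℕ# n = Algebra.Definitions.RawMonoid._×_ (CommutativeRing.+-rawMonoid realRing) n 1#

  IsCauchy : (ℕ → Carrier) → Set (c ⊔ ℓ₂)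
  IsCauchy s = ∀ ε → 0# < ε →
    ∃[ N ] ∀ i j → N ℕ.≤ i → N ℕ.≤ j → s i < s j + ε

  _ConvergesTo_ : (ℕ → Carrier) → Carrier → Set (c ⊔ ℓ₂)
  s ConvergesTo l = ∀ ε → 0# < ε →
    ∃[ N ] ∀ i → N ℕ.≤ i → s i < l + ε × l < s i + ε

  field
    archimedean : ∀ x → ∃[ n ] x < fromℕ# n
    complete    : ∀ s → IsCauchy s → ∃[ l ] s ConvergesTo l

  fromℕ#-pos : ∀ n → 0# < fromℕ# (ℕ.suc n)
  fromℕ#-pos ℕ.zero    = <-respʳ-≈ (≈-sym (+-identityʳ 1#)) 0<1
  fromℕ#-pos (ℕ.suc n) = <-trans 0<1
    (<-respˡ-≈ (+-identityˡ 1#) (<-respʳ-≈ (+-comm _ _) (+-monoˡ-< 1# (fromℕ#-pos n))))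

  -- 1 / n, with the convention 1 / 0 = 0.
  recip : ℕ → Carrier
  recip ℕ.zero    = 0#
  recip (ℕ.suc n) = proj₁ (#⇒invertible (#-sym (<⇒# (fromℕ#-pos n))))

  recip-inverse : ∀ n → fromℕ# (ℕ.suc n) * recip (ℕ.suc n) ≈ 1#
  recip-inverse n = ≈-trans (*-cong (≈-sym x-0≈x) ≈-refl)
    (proj₂ (proj₂ (#⇒invertible (#-sym (<⇒# (fromℕ#-pos n))))))
    where
    x-0≈x : fromℕ# (ℕ.suc n) - 0# ≈ fromℕ# (ℕ.suc n)
    x-0≈x = ≈-trans (≈-sym (+-identityʳ _))
      (≈-trans (+-assoc _ _ _) (≈-trans (+-cong ≈-refl (-‿inverseˡ 0#)) (+-identityʳ _)))

  _IsSqrtOf_ : Carrier → Carrier → Set (ℓ₁ ⊔ ℓ₂)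
  s IsSqrtOf x = 0# ≤ s × s * s ≈ x

  Matrix : ℕ → Set c
  Matrix n = Fin n → Fin n → Carrier

  _·_ : ∀ {n} → Matrix n → Vector Carrier n → Vector Carrier n
  A · u = λ i → sum (λ j → A i j * u j)

  Complex : Set c
  Complex = Carrier × Carrier

  normSq : Complex → Carrier
  normSq (a , b) = a * a + b * b

  -- The complex number a + bi is an eigenvalue of the real matrix A, with
  -- eigenvector u + wi: compare real and imaginary parts in
  -- A (u + wi) = (a + bi) (u + wi).
  IsEigenvalue : ∀ {n} → Matrix n → Complex → Set (c ⊔ ℓ₁ ⊔ ℓ₂)
  IsEigenvalue {n} A (a , b) =
    Σ[ u ∈ Vector Carrier n ] Σ[ w ∈ Vector Carrier n ]
      (∃[ i ] (u i # 0# ⊎ w i # 0#)) ×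
      (∀ i → (A · u) i ≈ a * u i - b * w i × (A · w) i ≈ a * w i + b * u i)

  -- The maximum modulus of an eigenvalue, compared through squares of moduli.
  IsSpectralRadius : ∀ {n} → Matrix n → Carrier → Set (c ⊔ ℓ₁ ⊔ ℓ₂)
  IsSpectralRadius A ρ =
    0# ≤ ρ ×
    (∃[ z ] IsEigenvalue A z × normSq z ≈ ρ * ρ) ×
    (∀ z → IsEigenvalue A z → normSq z ≤ ρ * ρ)

record Hypergraph : Set where
  field
    order          : ℕ
    size           : ℕ
    edge           : Fin size → Subset order
    edge-nonempty  : ∀ e → Nonempty (edge e)
    edge-injective : Injective _≡_ _≡_ edge

open Hypergraph public

Vertex Edge : Hypergraph → Set
Vertex H = Fin (order H)
Edge   H = Fin (size H)

record _≅_ (G H : Hypergraph) : Set where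
  field
    vertices : Vertex G ↔ Vertex H
    edges    : Edge G ↔ Edge H
    incident : ∀ v e →
      v ∈ edge G e ⇔ Inverse.to vertices v ∈ edge H (Inverse.to edges e)

Uniform : ℕ → Hypergraph → Set
Uniform m H = ∀ e → ∣ edge H e ∣ ≡ m

Linear : Hypergraph → Set
Linear H = ∀ e f → e ≢ f → ∣ edge H e ∩ edge H f ∣ ℕ.≤ 1

degree : (H : Hypergraph) → Vertex H → ℕ
degree H v = ∣ tabulate (λ e → Vec.lookup (edge H e) v) ∣

nonPendant : (H : Hypergraph) → Subset (order H)
nonPendant H = tabulate (λ v → 1 ℕ.<ᵇ degree H v)

record Path (H : Hypergraph) (u v : Vertex H) (l : ℕ) : Set where
  field
    vertexAt           : Fin (ℕ.suc l) → Vertex H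
    edgeAt             : Fin l → Edge H
    vertexAt-injective : Injective _≡_ _≡_ vertexAt
    edgeAt-injective   : Injective _≡_ _≡_ edgeAt
    start              : vertexAt zero ≡ u
    end                : vertexAt (fromℕ l) ≡ v
    left∈              : ∀ i → vertexAt (inject₁ i) ∈ edge H (edgeAt i)
    right∈             : ∀ i → vertexAt (suc i) ∈ edge H (edgeAt i)

Connected : Hypergraph → Set
Connected H = ∀ u v → ∃[ l ] Path H u v l

IsDistance : (H : Hypergraph) → Vertex H → Vertex H → ℕ → Set
IsDistance H u v l = Path H u v l × (∀ l′ → Path H u v l′ → l ℕ.≤ l′)

IsDiameter : Hypergraph → ℕ → Set
IsDiameter H d =
  (∃[ u ] ∃[ v ] IsDistance H u v d) ×
  (∀ u v l → IsDistance H u v l → l ℕ.≤ d)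

cyclicPred : ∀ {l} → Fin l → Fin l
cyclicPred {ℕ.suc n} zero    = fromℕ n
cyclicPred {ℕ.suc n} (suc i) = inject₁ i

record LooseCycle (H : Hypergraph) (l : ℕ) : Set where
  field
    3≤l                : 3 ℕ.≤ l
    vertexAt           : Fin l → Vertex H
    edgeAt             : Fin l → Edge H
    vertexAt-injective : Injective _≡_ _≡_ vertexAt
    edgeAt-injective   : Injective _≡_ _≡_ edgeAt
    consecutive        : ∀ i →
      edge H (edgeAt (cyclicPred i)) ∩ edge H (edgeAt i) ≡ ⁅ vertexAt i ⁆
    nonConsecutive     : ∀ i j → i ≢ j → i ≢ cyclicPred j → j ≢ cyclicPred i →
      Empty (edge H (edgeAt i) ∩ edge H (edgeAt j))

record IsHypertree (H : Hypergraph) : Set where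
  field
    connected      : Connected H
    linear         : Linear H
    noLooseCycle   : ∀ l → ¬ LooseCycle H l
    ≤2-nonPendants : ∀ e → ∣ edge H e ∩ nonPendant H ∣ ℕ.≤ 2

Adjacent : (H : Hypergraph) → Vertex H → Vertex H → Set
Adjacent H i j = i ≢ j × (∃[ e ] i ∈ edge H e × j ∈ edge H e)

adjacent? : (H : Hypergraph) → ∀ i j → Dec (Adjacent H i j)
adjacent? H i j =
  ¬? (i Fin.≟ j) ×-dec any? (λ e → (i ∈? edge H e) ×-dec (j ∈? edge H e))

module _ {c ℓ₁ ℓ₂} (ℝ : RealNumbers c ℓ₁ ℓ₂) where
  open RealNumbers ℝ

  adjacencyMatrix : ℕ → (H : Hypergraph) → Matrix (order H)
  adjacencyMatrix m H i j = if does (adjacent? H i j) then recip (m ℕ.∸ 1) else 0#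

  -- The relation ρ = λ₁(H), for H an m-uniform hypergraph.
  IsLambda₁ : ℕ → Hypergraph → Carrier → Set (c ⊔ ℓ₁ ⊔ ℓ₂)
  IsLambda₁ m H ρ = IsSpectralRadius (adjacencyMatrix m H) ρ

∈-tabulate⁺ : ∀ {n} (f : Fin n → Bool) {x} → T (f x) → x ∈ tabulate f
∈-tabulate⁺ f {x} t = lookup⇒[]= x _
  (trans (lookup∘tabulate f x) (Equivalence.to T-≡ t))

∈-tabulate⁻ : ∀ {n} (f : Fin n → Bool) {x} → x ∈ tabulate f → T (f x)
∈-tabulate⁻ f {x} x∈ = Equivalence.from T-≡
  (trans (sym (lookup∘tabulate f x)) ([]=⇒lookup x∈))

-- With r = m - 1, the loose path of length d has vertices 0, …, d r, and
-- e_{i+1} is the block {i r, …, (i + 1) r}, so that v_{i+1} is i r.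

pathVertex : ∀ r d → Fin (ℕ.suc d) → Fin (ℕ.suc (d ℕ.* r))
pathVertex r d i = fromℕ< (ℕ.s≤s (ℕ.*-monoˡ-≤ r (toℕ≤pred[n] i)))

module _ (r d : ℕ) where
  inPathEdge : Fin d → Fin (ℕ.suc (d ℕ.* r)) → Bool
  inPathEdge i x = (toℕ i ℕ.* r ℕ.≤ᵇ toℕ x) ∧ (toℕ x ℕ.≤ᵇ ℕ.suc (toℕ i) ℕ.* r)

  pathEdge : Fin d → Subset (ℕ.suc (d ℕ.* r))
  pathEdge i = tabulate (inPathEdge i)

  left∈pathEdge : ∀ i → pathVertex r d (inject₁ i) ∈ pathEdge i
  left∈pathEdge i = ∈-tabulate⁺ (inPathEdge i) (Equivalence.from T-∧
    ( ℕ.≤⇒≤ᵇ (ℕ.≤-reflexive (sym eq))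
    , ℕ.≤⇒≤ᵇ (ℕ.≤-trans (ℕ.≤-reflexive eq) (ℕ.m≤n+m _ r))))
    where
    eq : toℕ (pathVertex r d (inject₁ i)) ≡ toℕ i ℕ.* r
    eq = trans (toℕ-fromℕ< _) (cong (ℕ._* r) (Fin.toℕ-inject₁ i))

  pathEdge-≤ : .{{_ : NonZero r}} → ∀ i j → pathEdge i ≡ pathEdge j → toℕ j ℕ.≤ toℕ i
  pathEdge-≤ i j eq = ℕ.*-cancelʳ-≤ (toℕ j) (toℕ i) r (ℕ.≤-trans
    (ℕ.≤ᵇ⇒≤ _ _ (proj₁ (Equivalence.to T-∧
      (∈-tabulate⁻ (inPathEdge j) (subst (pathVertex r d (inject₁ i) ∈_) eq (left∈pathEdge i))))))
    (ℕ.≤-reflexive (trans (toℕ-fromℕ< _) (cong (ℕ._* r) (Fin.toℕ-inject₁ i)))))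

loosePath : (r : ℕ) .{{_ : NonZero r}} → ℕ → Hypergraph
loosePath r d = record
  { order          = ℕ.suc (d ℕ.* r)
  ; size           = d
  ; edge           = pathEdge r d
  ; edge-nonempty  = λ i → _ , left∈pathEdge r d i
  ; edge-injective = λ {i} {j} eq → toℕ-injective
      (ℕ.≤-antisym (pathEdge-≤ r d j i (sym eq)) (pathEdge-≤ r d i j eq))
  }

-- For each j, attach a pendant edge at the vertex at j, its r new vertices
-- being those of the j-th block of length r.

module _ (r : ℕ) .{{_ : NonZero r}} (H : Hypergraph) {s : ℕ} (at : Fin s → Vertex H) where
  inBlock : Fin s → Fin (s ℕ.* r) → Bool
  inBlock j x = ⌊ proj₁ (remQuot {s} r x) Fin.≟ j ⌋

  block : Fin s → Subset (s ℕ.* r)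
  block j = tabulate (inBlock j)

  attachEdge : Edge H ⊎ Fin s → Subset (order H ℕ.+ s ℕ.* r)
  attachEdge (inj₁ e) = edge H e ++ ⊥
  attachEdge (inj₂ j) = ⁅ at j ⁆ ++ block j

  first : Fin s → Fin (s ℕ.* r)
  first j = combine j (fromℕ< {0} (>-nonZero⁻¹ r))

  first-quot : ∀ j → proj₁ (remQuot {s} r (first j)) ≡ j
  first-quot j = cong proj₁ (remQuot-combine {s} j _)

  first∈block : ∀ j → first j ∈ block j
  first∈block j = ∈-tabulate⁺ (inBlock j)
    (fromWitness (first-quot j))

  block-injective : ∀ i j → block i ≡ block j → i ≡ j
  block-injective i j eq = trans (sym (first-quot i))
    (toWitness (∈-tabulate⁻ (inBlock j) (subst (first i ∈_) eq (first∈block i))))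

  attachEdge-injective : Injective _≡_ _≡_ attachEdge
  attachEdge-injective {inj₁ e} {inj₁ f} eq =
    cong inj₁ (edge-injective H (++-injectiveˡ (edge H e) (edge H f) eq))
  attachEdge-injective {inj₁ e} {inj₂ j} eq = ⊥-elim (∉⊥
    (subst (first j ∈_) (sym (++-injectiveʳ (edge H e) ⁅ at j ⁆ eq)) (first∈block j)))
  attachEdge-injective {inj₂ i} {inj₁ f} eq = ⊥-elim (∉⊥
    (subst (first i ∈_) (++-injectiveʳ ⁅ at i ⁆ (edge H f) eq) (first∈block i)))
  attachEdge-injective {inj₂ i} {inj₂ j} eq =
    cong inj₂ (block-injective i j (++-injectiveʳ ⁅ at i ⁆ ⁅ at j ⁆ eq))

  attachEdge-nonempty : ∀ x → Nonempty (attachEdge x)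
  attachEdge-nonempty (inj₁ e) with edge-nonempty H e
  ... | v , v∈e = v ↑ˡ (s ℕ.* r) , lookup⇒[]= _ _
    (trans (lookup-++ˡ (edge H e) ⊥ v) ([]=⇒lookup v∈e))
  attachEdge-nonempty (inj₂ j) = order H ↑ʳ first j , lookup⇒[]= _ _
    (trans (lookup-++ʳ ⁅ at j ⁆ (block j) (first j)) ([]=⇒lookup (first∈block j)))

  attach : Hypergraph
  attach = record
    { order          = order H ℕ.+ s ℕ.* r
    ; size           = size H ℕ.+ s
    ; edge           = λ e → attachEdge (splitAt (size H) e)
    ; edge-nonempty  = λ e → attachEdge-nonempty (splitAt (size H) e)
    ; edge-injective = λ {e} {f} eq → trans (sym (Fin.join-splitAt (size H) s e))
        (trans (cong (Fin.join (size H) s)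
            (attachEdge-injective {splitAt (size H) e} {splitAt (size H) f} eq))
          (Fin.join-splitAt (size H) s f))
    }

instance
  pred-nonZero : ∀ {m} .{{_ : NonTrivial m}} → NonZero (m ℕ.∸ 1)
  pred-nonZero {ℕ.2+ m} = _

-- c₂, …, c_d are indexed by Fin (d ∸ 1), so j : Fin (d ∸ 1) stands for the
-- subscript j + 2.

interior : ∀ d → Fin (d ℕ.∸ 1) → Fin (ℕ.suc d)
interior (ℕ.suc d) j = suc (inject₁ j)

attachmentList : ∀ r d → (Fin (d ℕ.∸ 1) → ℕ) → List (Fin (ℕ.suc (d ℕ.* r)))
attachmentList r d c =
  concatMap (λ j → replicate (c j) (pathVertex r d (interior d j))) (allFin (d ℕ.∸ 1))

pendantTree : (m : ℕ) .{{_ : NonTrivial m}} (d : ℕ) → (Fin (d ℕ.∸ 1) → ℕ) → Hypergraph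
pendantTree m d c = attach r (loosePath r d) (lookup (attachmentList r d c))
  where
  r : ℕ
  r = m ℕ.∸ 1

-- The family with c_i = n and all other c_j = 0, where i is a subscript in
-- {2, …, d}.
onlyAt : ∀ {l} → ℕ → ℕ → Fin l → ℕ
onlyAt i n j = if does (toℕ j ℕ.+ 2 ℕ.≟ i) then n else 0

sizeBound : ℕ → ℕ → ℚᵘ
sizeBound m d =
  ((+ 4 ℤ.* + d ℤ.* + d ℤ.- + 1) ℤ.* (+ m ℤ.- + 1) ℤ.+ + 2) / 4

-- Write r = m - 1, κ = r λ and z = κ + 1 - r.  A hypertree has no closed
-- trail, so once it is rooted every other vertex lies in exactly one edge
-- leading to the root.  A positive vector x with A x ≤ λ x, strictly at some
-- vertex, shows that the spectral radius is less than λ, and on a rooted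
-- hypertree x may be given by the ratios x_w / x_a, where a is the vertex
-- nearest to the root in the edge above w.
--
-- If some vertex has degree at least d, root there and let the ratios depend
-- linearly on the numbers of edges beyond w and beyond the edge above w; if
-- all degrees are less than d, let all ratios be 2 / z.  This gives
-- λ₁(T) < λ as soon as z κ > r k, and also when z κ ≥ r (k - d + 2) and all
-- degrees are at most k - d + 1.  The first alternative yields (ii), where
-- κ² = r κ + r (k - d), and the hypothesis on k implies κ > r d.  The
-- second applies to the Perron root of T_d(c_{p+1} = k - d), which is
-- constructed as a limit together with its eigenvector.  In the remaining
-- case a vertex of degree at least k - d + 2 meets every edge off a
-- diametral path, so T = T_d(c_i = k - d) for some i, and λ₁ is largest for
-- i = p + 1 because the ratios along a path are concave.

module Submission where

open import Defs
open import Algebra.Bundles using (CommutativeRing; RawRing)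
import Algebra.Properties.AbelianGroup
import Algebra.Properties.Ring
import Algebra.Properties.Semiring.Mult
import Algebra.Properties.Semiring.Mult.TCOptimised
import Algebra.Properties.Semiring.Sum
open import Algebra.Solver.Ring.AlmostCommutativeRing using (fromCommutativeRing; _-Raw-AlmostCommutative⟶_)
open import Data.Bool.Base using (true; false; if_then_else_)
open import Data.Bool.Properties using (T-∧)
open import Data.Empty using (⊥; ⊥-elim)
open import Data.Fin.Base as Fin using (Fin; zero; suc; toℕ; fromℕ; fromℕ<; inject₁; splitAt; remQuot; combine; _↑ˡ_; _↑ʳ_)
open import Data.Fin.Permutation using (Permutation; _⟨$⟩ʳ_; ↔⇒≡)
open import Data.Fin.Permutation.Components using (transpose; transpose-inverse)
import Data.Fin.Properties as Fin
open import Data.Fin.Subset as Subset using (Subset; _∈_; _∩_; ∣_∣; ⁅_⁆; Empty)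
open import Data.Fin.Subset.Properties using (_∈?_; ∉⊥; x∈p∩q⁺; x∈p∩q⁻; x∈⁅x⁆; x∈⁅y⁆⇒x≡y)
open import Data.Integer.Base as ℤ using (ℤ; +_; -[1+_])
import Data.Integer.Properties as ℤ
import Data.Integer.Solver as ℤ
open import Data.List.Base as List using (List)
import Data.List.Properties as List
open import Data.Maybe.Base as Maybe using (Maybe; just; nothing)
import Data.Maybe.Properties as Maybe
open import Data.Nat.Base as ℕ using (ℕ; zero; suc; NonTrivial)
open import Data.Nat.Induction using (<-rec)
import Data.Nat.Properties as ℕ
open import Data.Nat.Tactic.RingSolver using (solve-∀)
open import Data.Product.Base using (_×_; _,_; proj₁; proj₂; ∃-syntax; Σ-syntax)
open import Data.Rational.Unnormalised.Base as ℚᵘ using (_/_; *≤*)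
open import Data.Sum.Base using (_⊎_; inj₁; inj₂; [_,_]′)
open import Data.Vec.Base as Vec using ([]; _∷_; _++_; here; there)
open import Data.Vec.Properties using (lookup∘tabulate; lookup-++ˡ; lookup-++ʳ; []=⇒lookup; lookup⇒[]=)
open import Function.Base using (_∘_; id)
open import Function.Bundles using (_↔_; Inverse; Equivalence; mk⇔; mk↔ₛ′)
open import Function.Definitions using (Injective)
open import Level using (Level; _⊔_)
open import Relation.Binary.Definitions using (tri<; tri≈; tri>)
open import Relation.Binary.PropositionalEquality as ≡ using (_≡_; _≢_)
import Relation.Binary.Reasoning.Setoid
open import Relation.Nullary using (¬_; Dec; yes; no; does; ¬?)
open import Relation.Nullary.Decidable using (⌊_⌋; toWitness; fromWitness; dec-true; dec-false)

-- Rooted hypergraphs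

-- The number z comes from a pendant edge: if an eigenvector has the value y at the new vertices and
-- x at the vertex where the edge hangs, then κ y = x + (r - 1) y, that is x = z y. A star with n
-- edges then has z κ = r n. This explains both thresholds: z κ > r k says that λ exceeds the
-- spectral radius of the star with k edges, and z κ ≥ r (k - d + 2) reflects the star with k - d +
-- 2 edges inside T_d(c_{p+1} = k - d).
--
-- The order of the reals is not decidable, so a largest eigenvalue cannot simply be chosen, nor can
-- two spectral radii be compared by cases. Strict bounds on a given λ₁ come from an identity that
-- writes the difference as a sum of nonnegative terms, one of them positive. Distinctions between
-- hypertrees are made on degrees and positions, hence on natural numbers, and the Perron root is
-- the zero of an explicit function with controlled slopes. Equality in (i) then costs nothing: a
-- hypertree is isomorphic to the extremal one or lies strictly below it.

record Rooted (H : Hypergraph) : Set where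
  field
    root           : Vertex H
    parent         : Vertex H → Maybe (Edge H)
    apex           : Edge H → Vertex H
    -- Any measure that decreases towards the root serves; it need not be the distance. For explicit
    -- hypergraphs the number of the vertex is used.
    depth          : Vertex H → ℕ
    parent-root    : parent root ≡ nothing
    parent≡nothing : ∀ {v} → parent v ≡ nothing → v ≡ root
    ∈⇒             : ∀ {v e} → v ∈ edge H e → apex e ≡ v ⊎ parent v ≡ just e
    apex∈          : ∀ e → apex e ∈ edge H e
    parent∈        : ∀ {v e} → parent v ≡ just e → v ∈ edge H e
    apex-depth     : ∀ {v e} → parent v ≡ just e → depth (apex e) ℕ.< depth v

  apex≢ : ∀ {v e} → parent v ≡ just e → apex e ≢ v
  apex≢ p eq = ℕ.<-irrefl (≡.cong depth eq) (apex-depth p)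

  -- Linearity follows from the rooting. Either one of the two vertices has both edges as its
  -- parent, or each is the apex of the parent edge of the other, which `depth` excludes.
  common-edge-unique : ∀ {u v e f} → u ≢ v → u ∈ edge H e → v ∈ edge H e →
    u ∈ edge H f → v ∈ edge H f → e ≡ f
  common-edge-unique {u} {v} {e} {f} u≢v u∈e v∈e u∈f v∈f = helper (∈⇒ u∈e) (∈⇒ v∈e) (∈⇒ u∈f) (∈⇒ v∈f)
    where
    same : ∀ {w} → parent w ≡ just e → parent w ≡ just f → e ≡ f
    same p q = Maybe.just-injective (≡.trans (≡.sym p) q)
    cyclic : ∀ {u v e f} → apex e ≡ u → parent v ≡ just e → apex f ≡ v → parent u ≡ just f → ⊥
    cyclic p q p′ q′ = ℕ.<-asym
      (≡.subst (λ w → depth w ℕ.< _) p (apex-depth q)) (≡.subst (λ w → depth w ℕ.< _) p′ (apex-depth q′))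
    helper : apex e ≡ u ⊎ parent u ≡ just e → apex e ≡ v ⊎ parent v ≡ just e →
      apex f ≡ u ⊎ parent u ≡ just f → apex f ≡ v ⊎ parent v ≡ just f → e ≡ f
    helper (inj₁ p) (inj₁ q) _        _         = ⊥-elim (u≢v (≡.trans (≡.sym p) q))
    helper _        _        (inj₁ p) (inj₁ q)  = ⊥-elim (u≢v (≡.trans (≡.sym p) q))
    helper _        (inj₂ p) _        (inj₂ q)  = same p q
    helper (inj₂ p) _        (inj₂ q) _         = same p q
    helper (inj₁ p) (inj₂ q) (inj₂ q′) (inj₁ p′) = ⊥-elim (cyclic p q p′ q′)
    helper (inj₂ q) (inj₁ p) (inj₁ p′) (inj₂ q′) = ⊥-elim (cyclic p q p′ q′)

  apex-adjacent : ∀ {v e} → parent v ≡ just e → Adjacent H (apex e) v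
  apex-adjacent p = apex≢ p , _ , apex∈ _ , parent∈ p

  adjacent-sym : ∀ {u v} → Adjacent H u v → Adjacent H v u
  adjacent-sym (u≢v , e , u∈e , v∈e) = u≢v ∘ ≡.sym , e , v∈e , u∈e

  module _ {ℓ} (P : Vertex H → Set ℓ) (step : ∀ {u v} → Adjacent H u v → P u → P v) where
    private
      up : ∀ n v → depth v ℕ.≤ n → P v → P root
      climb : ∀ n v e → parent v ≡ e → depth v ℕ.≤ n → P v → P root
      up n v = climb n v (parent v) ≡.refl
      climb n v nothing p _ Pv = ≡.subst P (parent≡nothing p) Pv
      climb zero v (just e) p v≤n Pv = ⊥-elim (ℕ.n≮0 (ℕ.<-≤-trans (apex-depth p) v≤n))
      climb (suc n) v (just e) p v≤n Pv = up n (apex e) (ℕ.s≤s⁻¹ (ℕ.<-≤-trans (apex-depth p) v≤n))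
        (step (adjacent-sym (apex-adjacent p)) Pv)

      down : ∀ n v → depth v ℕ.≤ n → P root → P v
      descend : ∀ n v e → parent v ≡ e → depth v ℕ.≤ n → P root → P v
      down n v = descend n v (parent v) ≡.refl
      descend n v nothing p _ Pr = ≡.subst P (≡.sym (parent≡nothing p)) Pr
      descend zero v (just e) p v≤n _ = ⊥-elim (ℕ.n≮0 (ℕ.<-≤-trans (apex-depth p) v≤n))
      descend (suc n) v (just e) p v≤n Pr = step (apex-adjacent p)
        (down n (apex e) (ℕ.s≤s⁻¹ (ℕ.<-≤-trans (apex-depth p) v≤n)) Pr)

    -- Connectedness as an induction principle: the property climbs from `u` to the root and
    -- descends from there to `v`.
    propagate : ∀ u v → P u → P v
    propagate u v = down _ v ℕ.≤-refl ∘ up _ u ℕ.≤-refl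

-- Closed trails

∣p∣≤0⇒p≡⊥ : ∀ {n} (p : Subset n) → ∣ p ∣ ℕ.≤ 0 → p ≡ Subset.⊥
∣p∣≤0⇒p≡⊥ []          _ = ≡.refl
∣p∣≤0⇒p≡⊥ (false ∷ p) q = ≡.cong (false ∷_) (∣p∣≤0⇒p≡⊥ p q)

∣p∣≤1⇒p≡⁅x⁆ : ∀ {n} {p : Subset n} {x} → x ∈ p → ∣ p ∣ ℕ.≤ 1 → p ≡ ⁅ x ⁆
∣p∣≤1⇒p≡⁅x⁆ {p = true ∷ p}  here       q = ≡.cong (true ∷_) (∣p∣≤0⇒p≡⊥ p (ℕ.s≤s⁻¹ q))
∣p∣≤1⇒p≡⁅x⁆ {p = false ∷ p} (there x∈) q = ≡.cong (false ∷_) (∣p∣≤1⇒p≡⁅x⁆ x∈ q)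
∣p∣≤1⇒p≡⁅x⁆ {p = true ∷ p} {suc x} (there x∈) q with ∣p∣≤1⇒p≡⁅x⁆ x∈ (ℕ.m≤n⇒m≤1+n (ℕ.s≤s⁻¹ q))
... | ≡.refl with ∣p∣≤0⇒p≡⊥ ⁅ x ⁆ (ℕ.s≤s⁻¹ q)
... | eq = ⊥-elim (∉⊥ (≡.subst (x ∈_) eq x∈))

module _ (H : Hypergraph) where

  -- Only successive vertices and successive edges have to differ, and nothing is required of the
  -- pair formed by the last and the first edge. This weak notion is easy to produce; minimal length
  -- supplies the rest.
  record ClosedTrail (l : ℕ) : Set where
    field
      vertex       : ℕ → Vertex H
      edgeOf       : ℕ → Edge H
      left∈        : ∀ {i} → i ℕ.< l → vertex i ∈ edge H (edgeOf i)
      right∈       : ∀ {i} → i ℕ.< l → vertex (suc i) ∈ edge H (edgeOf i)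
      vertex-turns : ∀ {i} → i ℕ.< l → vertex i ≢ vertex (suc i)
      edge-turns   : ∀ {i} → suc i ℕ.< l → edgeOf i ≢ edgeOf (suc i)
      closed       : vertex 0 ≡ vertex l

  module _ (linear : Linear H) (noLooseCycle : ∀ l → ¬ LooseCycle H l) where

    intersection : ∀ {e f v} → e ≢ f → v ∈ edge H e → v ∈ edge H f → edge H e ∩ edge H f ≡ ⁅ v ⁆
    intersection e≢f v∈e v∈f = ∣p∣≤1⇒p≡⁅x⁆ (x∈p∩q⁺ (v∈e , v∈f)) (linear _ _ e≢f)

    private
      module Minimal {l : ℕ} (tr : ClosedTrail (suc l))
                     (shortest : ∀ {n} → n ℕ.< suc l → 0 ℕ.< n → ¬ ClosedTrail n) where
        open ClosedTrail tr renaming (vertex to v; edgeOf to e)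

        distinct : ∀ i g → 0 ℕ.< g → i ℕ.+ g ℕ.< suc l → v i ≢ v (i ℕ.+ g)
        distinct i g 0<g j<l eq = shortest (ℕ.≤-<-trans (ℕ.m≤n+m g i) j<l) 0<g record
          { vertex = λ t → v (i ℕ.+ t)
          ; edgeOf = λ t → e (i ℕ.+ t)
          ; left∈ = λ t<g → left∈ (bound t<g)
          ; right∈ = λ {t} t<g → ≡.subst (λ k → v k ∈ edge H (e (i ℕ.+ t))) (≡.sym (ℕ.+-suc i t)) (right∈ (bound t<g))
          ; vertex-turns = λ {t} t<g → ≡.subst (λ k → v (i ℕ.+ t) ≢ v k) (≡.sym (ℕ.+-suc i t)) (vertex-turns (bound t<g))
          ; edge-turns = λ {t} t<g → ≡.subst (λ k → e (i ℕ.+ t) ≢ e k) (≡.sym (ℕ.+-suc i t))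
              (edge-turns (≡.subst (ℕ._< suc l) (ℕ.+-suc i t) (bound t<g)))
          ; closed = ≡.trans (≡.cong v (ℕ.+-identityʳ i)) eq
          }
          where
          bound : ∀ {t} → t ℕ.< g → i ℕ.+ t ℕ.< suc l
          bound t<g = ℕ.<-trans (ℕ.+-monoʳ-< i t<g) j<l

        -- The trail w e_i v_{i+1} … v_{i+g} e_{i+g} w.
        shortcut : ∀ i g w → 0 ℕ.< g → i ℕ.+ g ℕ.< suc l → suc g ℕ.< suc l →
          w ∈ edge H (e i) → w ∈ edge H (e (i ℕ.+ g)) → w ≢ v (suc i) → w ≢ v (i ℕ.+ g) → ⊥
        shortcut i g w 0<g j<l g<l w∈i w∈j w≢i w≢j = shortest g<l (ℕ.s≤s ℕ.z≤n) record
          { vertex = v′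
          ; edgeOf = λ t → e (i ℕ.+ t)
          ; left∈ = left
          ; right∈ = right
          ; vertex-turns = turns
          ; edge-turns = λ {t} t<g → ≡.subst (λ k → e (i ℕ.+ t) ≢ e k) (≡.sym (ℕ.+-suc i t))
              (edge-turns (≡.subst (ℕ._< suc l) (ℕ.+-suc i t) (bound (ℕ.s≤s⁻¹ t<g))))
          ; closed = ≡.sym last
          }
          where
          choose : ∀ {t} → Dec (t ≡ g) → Vertex H
          choose {t} (yes _) = w
          choose {t} (no _)  = v (i ℕ.+ suc t)
          v′ : ℕ → Vertex H
          v′ zero    = w
          v′ (suc t) = choose (t ℕ.≟ g)
          last : v′ (suc g) ≡ w
          last with g ℕ.≟ g
          ... | yes _  = ≡.refl
          ... | no g≢g = ⊥-elim (g≢g ≡.refl)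
          bound : ∀ {t} → t ℕ.≤ g → i ℕ.+ t ℕ.< suc l
          bound t≤g = ℕ.≤-<-trans (ℕ.+-monoʳ-≤ i t≤g) j<l
          left : ∀ {t} → t ℕ.< suc g → v′ t ∈ edge H (e (i ℕ.+ t))
          left {zero}  _   = ≡.subst (λ k → w ∈ edge H (e k)) (≡.sym (ℕ.+-identityʳ i)) w∈i
          left {suc t} t<g with t ℕ.≟ g
          ... | yes ≡.refl = ⊥-elim (ℕ.<-irrefl ≡.refl t<g)
          ... | no _       = left∈ (bound (ℕ.s≤s⁻¹ t<g))
          right : ∀ {t} → t ℕ.< suc g → v′ (suc t) ∈ edge H (e (i ℕ.+ t))
          right {t} t<g with t ℕ.≟ g
          ... | yes ≡.refl = w∈j
          ... | no _       = ≡.subst (λ k → v k ∈ edge H (e (i ℕ.+ t))) (≡.sym (ℕ.+-suc i t)) (right∈ (bound (ℕ.s≤s⁻¹ t<g)))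
          turns : ∀ {t} → t ℕ.< suc g → v′ t ≢ v′ (suc t)
          turns {zero} _ with 0 ℕ.≟ g
          ... | yes ≡.refl = ⊥-elim (ℕ.<-irrefl ≡.refl 0<g)
          ... | no _       = ≡.subst (λ k → w ≢ v k) (≡.sym (≡.trans (ℕ.+-suc i 0) (≡.cong suc (ℕ.+-identityʳ i)))) w≢i
          turns {suc t} t<g with t ℕ.≟ g | suc t ℕ.≟ g
          ... | yes ≡.refl | _          = ⊥-elim (ℕ.<-irrefl ≡.refl t<g)
          ... | no _       | yes ≡.refl = w≢j ∘ ≡.sym
          ... | no _       | no _       = ≡.subst (λ k → v (i ℕ.+ suc t) ≢ v k) (≡.sym (ℕ.+-suc i (suc t)))
            (vertex-turns (bound (ℕ.s≤s⁻¹ t<g)))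

        -- A common vertex `w` closes a shorter trail. If `w` is already an end of the stretch
        -- between the two edges, the edge on that side is dropped as well, since otherwise two
        -- successive vertices would coincide.
        disjoint : ∀ i g w → i ℕ.+ suc (suc g) ℕ.< suc l → suc (suc (suc g)) ℕ.< suc l →
          w ∈ edge H (e i) → w ∈ edge H (e (i ℕ.+ suc (suc g))) → ⊥
        disjoint i g w j<l g<l w∈i w∈j with w Fin.≟ v (suc i)
        ... | yes ≡.refl = shortcut (suc i) (suc g) w (ℕ.s≤s ℕ.z≤n) (≡.subst (ℕ._< suc l) i+ j<l) (ℕ.<-trans (ℕ.n<1+n _) g<l)
            (left∈ (ℕ.≤-<-trans (≡.subst (suc i ℕ.≤_) (≡.sym i+) (ℕ.m≤m+n (suc i) (suc g))) j<l))
            (≡.subst (λ k → w ∈ edge H (e k)) i+ w∈j)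
            (vertex-turns (ℕ.≤-<-trans (≡.subst (suc i ℕ.≤_) (≡.sym i+) (ℕ.m≤m+n (suc i) (suc g))) j<l))
            (distinct (suc i) (suc g) (ℕ.s≤s ℕ.z≤n) (≡.subst (ℕ._< suc l) i+ j<l))
          where
          i+ : i ℕ.+ suc (suc g) ≡ suc i ℕ.+ suc g
          i+ = ℕ.+-suc i (suc g)
        ... | no w≢i with w Fin.≟ v (i ℕ.+ suc (suc g))
        ... | yes ≡.refl = shortcut i (suc g) w (ℕ.s≤s ℕ.z≤n) j-1<l (ℕ.<-trans (ℕ.n<1+n _) g<l) w∈i
            (≡.subst (λ k → v k ∈ edge H (e (i ℕ.+ suc g))) (≡.sym (ℕ.+-suc i (suc g))) (right∈ j-1<l)) w≢i
            (λ eq → vertex-turns j-1<l (≡.trans (≡.sym eq) (≡.cong v (ℕ.+-suc i (suc g)))))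
          where
          j-1<l : i ℕ.+ suc g ℕ.< suc l
          j-1<l = ℕ.<-trans (ℕ.+-monoʳ-< i (ℕ.n<1+n _)) j<l
        ... | no w≢j = shortcut i (suc (suc g)) w (ℕ.s≤s ℕ.z≤n) j<l g<l w∈i w∈j w≢i w≢j

        -- A single edge would not turn at its vertex, and two distinct edges through the same two
        -- vertices contradict linearity.
        2≤l : 2 ℕ.≤ l
        2≤l = go l ≡.refl
          where
          go : ∀ n → l ≡ n → 2 ℕ.≤ n
          go zero eq = ⊥-elim (vertex-turns (ℕ.s≤s ℕ.z≤n) (≡.trans closed (≡.cong (v ∘ suc) eq)))
          go (suc zero) eq = ⊥-elim (vertex-turns (ℕ.s≤s ℕ.z≤n) (x∈⁅y⁆⇒x≡y _ (≡.subst (v 0 ∈_)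
              (intersection (edge-turns 1<) (right∈ (ℕ.s≤s ℕ.z≤n)) (left∈ 1<))
              (x∈p∩q⁺ (left∈ (ℕ.s≤s ℕ.z≤n) , ≡.subst (_∈ edge H (e 1)) (≡.sym (≡.trans closed (≡.cong (v ∘ suc) eq))) (right∈ 1<))))))
            where
            1< : 1 ℕ.< suc l
            1< = ≡.subst (λ k → 1 ℕ.< suc k) (≡.sym eq) ℕ.≤-refl
          go (suc (suc _)) _ = ℕ.s≤s (ℕ.s≤s ℕ.z≤n)

        -- If the last edge were the first, it would contain `v 1`, and the trail could start and
        -- end there without using `e 0` at the beginning.
        ends≢ : e 0 ≢ e l
        ends≢ = go l ≡.refl 2≤l
          where
          go : ∀ n → l ≡ n → 2 ℕ.≤ n → e 0 ≢ e n
          go (suc zero) _ (ℕ.s≤s ())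
          go (suc (suc l′)) l≡ _ eq = shortcut 1 (suc l′) (v 1) (ℕ.s≤s ℕ.z≤n) last< last< (left∈ 1<)
              (≡.subst (λ f → v 1 ∈ edge H f) eq (right∈ (ℕ.s≤s ℕ.z≤n)))
              (vertex-turns 1<) (distinct 1 (suc l′) (ℕ.s≤s ℕ.z≤n) last<)
            where
            1< : 1 ℕ.< suc l
            1< = ≡.subst (λ k → 1 ℕ.< suc k) (≡.sym l≡) (ℕ.s≤s (ℕ.s≤s ℕ.z≤n))
            last< : suc (suc l′) ℕ.< suc l
            last< = ≡.subst (λ k → suc (suc l′) ℕ.< suc k) (≡.sym l≡) ℕ.≤-refl

        -- A gap g+1 between two positions either joins neighbours, or spans
        -- the whole cycle, or leaves room for a shortcut.
        far-disjoint : ∀ i g w → i ℕ.+ suc g ℕ.< suc l → g ≢ 0 → ¬ (i ≡ 0 × suc g ≡ l) →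
          w ∈ edge H (e i) → w ∈ edge H (e (i ℕ.+ suc g)) → ⊥
        far-disjoint i zero w _ g≢0 = ⊥-elim (g≢0 ≡.refl)
        far-disjoint zero (suc g) w j<l _ ¬ends = disjoint 0 g w j<l
          (ℕ.s≤s (ℕ.≤∧≢⇒< (ℕ.s≤s⁻¹ j<l) (λ eq → ¬ends (≡.refl , eq))))
        far-disjoint (suc i) (suc g) w j<l _ _ = disjoint (suc i) g w j<l (ℕ.≤-<-trans (ℕ.s≤s (ℕ.m≤n+m (suc (suc g)) i)) j<l)

        edges-distinct : ∀ i g → i ℕ.+ suc g ℕ.< suc l → e i ≢ e (i ℕ.+ suc g)
        edges-distinct i zero j<l eq = edge-turns (≡.subst (ℕ._< suc l) i+1 j<l) (≡.trans eq (≡.cong e i+1))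
          where
          i+1 : i ℕ.+ 1 ≡ suc i
          i+1 = ≡.trans (ℕ.+-suc i 0) (≡.cong suc (ℕ.+-identityʳ i))
        edges-distinct i (suc g) j<l eq with i ℕ.≟ 0 | suc (suc g) ℕ.≟ l
        ... | yes ≡.refl | yes ≡.refl = ends≢ eq
        ... | no i≢0 | _ = far-disjoint i (suc g) (v i) j<l (λ ()) (i≢0 ∘ proj₁) v∈ (≡.subst (λ f → v i ∈ edge H f) eq v∈)
          where
          v∈ = left∈ (ℕ.≤-<-trans (ℕ.m≤m+n i _) j<l)
        ... | _ | no g≢ = far-disjoint i (suc g) (v i) j<l (λ ()) (g≢ ∘ proj₂) v∈ (≡.subst (λ f → v i ∈ edge H f) eq v∈)
          where
          v∈ = left∈ (ℕ.≤-<-trans (ℕ.m≤m+n i _) j<l)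

        gap : ∀ {i j} → i ℕ.< j → i ℕ.+ suc (j ℕ.∸ suc i) ≡ j
        gap {i} {j} i<j = ≡.trans (ℕ.+-suc i _) (ℕ.m+[n∸m]≡n i<j)

        injective : ∀ {A : Set} (f : ℕ → A) → (∀ i g → i ℕ.+ suc g ℕ.< suc l → f i ≢ f (i ℕ.+ suc g)) →
          ∀ {i j : Fin (suc l)} → f (toℕ i) ≡ f (toℕ j) → i ≡ j
        injective f f≢ {i} {j} eq with ℕ.<-cmp (toℕ i) (toℕ j)
        ... | tri≈ _ i≡j _ = Fin.toℕ-injective i≡j
        ... | tri< i<j _ _ = ⊥-elim (f≢ (toℕ i) _ (≡.subst (ℕ._< suc l) (≡.sym (gap i<j)) (Fin.toℕ<n j))
                               (≡.trans eq (≡.cong f (≡.sym (gap i<j)))))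
        ... | tri> _ _ j<i = ⊥-elim (f≢ (toℕ j) _ (≡.subst (ℕ._< suc l) (≡.sym (gap j<i)) (Fin.toℕ<n i))
                               (≡.trans (≡.sym eq) (≡.cong f (≡.sym (gap j<i)))))

        edge-injective′ : ∀ {i j : Fin (suc l)} → e (toℕ i) ≡ e (toℕ j) → i ≡ j
        edge-injective′ = injective e edges-distinct

        apart : ∀ {i j : Fin (suc l)} → toℕ i ℕ.< toℕ j → i ≢ cyclicPred j → j ≢ cyclicPred i →
          Empty (edge H (e (toℕ i)) ∩ edge H (e (toℕ j)))
        apart {i} {j} i<j i≢ j≢ (w , w∈) = far-disjoint (toℕ i) _ w
            (≡.subst (ℕ._< suc l) (≡.sym (gap i<j)) (Fin.toℕ<n j)) (next j i<j i≢) ends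
            (proj₁ (x∈p∩q⁻ _ _ w∈)) (≡.subst (λ k → w ∈ edge H (e k)) (≡.sym (gap i<j)) (proj₂ (x∈p∩q⁻ _ _ w∈)))
          where
          next : ∀ j → toℕ i ℕ.< toℕ j → i ≢ cyclicPred j → toℕ j ℕ.∸ suc (toℕ i) ≢ 0
          next (suc j) i<j i≢ eq = i≢ (Fin.toℕ-injective (≡.trans
            (ℕ.≤-antisym (ℕ.s≤s⁻¹ i<j) (ℕ.m∸n≡0⇒m≤n eq)) (≡.sym (Fin.toℕ-inject₁ j))))
          ends : ¬ (toℕ i ≡ 0 × suc (toℕ j ℕ.∸ suc (toℕ i)) ≡ l)
          ends (i≡0 , j≡l) = j≢ (≡.trans (Fin.toℕ-injective (≡.trans
              (≡.sym (gap i<j)) (≡.trans (≡.cong₂ ℕ._+_ i≡0 j≡l) (≡.sym (Fin.toℕ-fromℕ l)))))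
            (≡.cong cyclicPred (Fin.toℕ-injective {i = zero} (≡.sym i≡0))))

        looseCycle : LooseCycle H (suc l)
        looseCycle = record
          { 3≤l = ℕ.s≤s 2≤l
          ; vertexAt = v ∘ toℕ
          ; edgeAt = e ∘ toℕ
          ; vertexAt-injective = injective v (λ i g → distinct i (suc g) (ℕ.s≤s ℕ.z≤n))
          ; edgeAt-injective = edge-injective′
          ; consecutive = consecutive
          ; nonConsecutive = nonConsecutive
          }
          where
          consecutive : ∀ i → edge H (e (toℕ (cyclicPred i))) ∩ edge H (e (toℕ i)) ≡ ⁅ v (toℕ i) ⁆
          consecutive zero = intersection
            (λ eq → ends≢ (≡.trans (≡.sym eq) (≡.cong e (Fin.toℕ-fromℕ l))))
            (≡.subst₂ (λ w k → w ∈ edge H (e k)) (≡.sym closed) (≡.sym (Fin.toℕ-fromℕ l)) (right∈ ℕ.≤-refl))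
            (left∈ (ℕ.s≤s ℕ.z≤n))
          consecutive (suc i) = intersection
            (λ eq → edge-turns (ℕ.s≤s (Fin.toℕ<n i)) (≡.trans (≡.cong e (≡.sym (Fin.toℕ-inject₁ i))) eq))
            (≡.subst (λ k → v (suc (toℕ i)) ∈ edge H (e k)) (≡.sym (Fin.toℕ-inject₁ i))
              (right∈ (ℕ.m<n⇒m<1+n (Fin.toℕ<n i))))
            (left∈ (ℕ.s≤s (Fin.toℕ<n i)))
          nonConsecutive : ∀ i j → i ≢ j → i ≢ cyclicPred j → j ≢ cyclicPred i →
            Empty (edge H (e (toℕ i)) ∩ edge H (e (toℕ j)))
          nonConsecutive i j i≢j i≢ j≢ with ℕ.<-cmp (toℕ i) (toℕ j)
          ... | tri< i<j _ _ = apart i<j i≢ j≢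
          ... | tri≈ _ i≡j _ = ⊥-elim (i≢j (Fin.toℕ-injective i≡j))
          ... | tri> _ _ j<i = λ (w , w∈) → apart j<i j≢ i≢ (w , x∈p∩q⁺ (proj₂ (x∈p∩q⁻ _ _ w∈) , proj₁ (x∈p∩q⁻ _ _ w∈)))

    -- A shortest closed trail is a loose cycle, because every repetition and every intersection
    -- beyond the prescribed ones would allow a shorter closed trail.
    noClosedTrail : ∀ l → 0 ℕ.< l → ¬ ClosedTrail l
    noClosedTrail = <-rec (λ l → 0 ℕ.< l → ¬ ClosedTrail l) (λ where
      (suc l) shortest _ tr → noLooseCycle (suc l) (Minimal.looseCycle tr (λ n<l → shortest n<l)))

-- Trails and the rooting of hypertrees

module _ (H : Hypergraph) where
  -- The indices are the last vertex, the last edge and the length.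
  data Trail (u : Vertex H) : Vertex H → Maybe (Edge H) → ℕ → Set where
    []   : Trail u u nothing 0
    snoc : ∀ {v w l n} → Trail u v l n → (e : Edge H) → v ∈ edge H e → w ∈ edge H e →
           v ≢ w → l ≢ just e → Trail u w (just e) (suc n)

  -- The trail as functions of the position, which is the form of `ClosedTrail`. The field `last`
  -- links the index `l` to these functions, so that the turn at a newly added edge can be checked.
  record Walk (u v : Vertex H) (l : Maybe (Edge H)) (n : ℕ) : Set where
    field
      vertex       : ℕ → Vertex H
      edgeOf       : ℕ → Edge H
      left∈        : ∀ {i} → i ℕ.< n → vertex i ∈ edge H (edgeOf i)
      right∈       : ∀ {i} → i ℕ.< n → vertex (suc i) ∈ edge H (edgeOf i)
      vertex-turns : ∀ {i} → i ℕ.< n → vertex i ≢ vertex (suc i)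
      edge-turns   : ∀ {i} → suc i ℕ.< n → edgeOf i ≢ edgeOf (suc i)
      start        : vertex 0 ≡ u
      end          : vertex n ≡ v
      last         : ∀ {i} → suc i ≡ n → l ≡ just (edgeOf i)

  extend : ∀ {A : Set} → (ℕ → A) → ℕ → A → ℕ → A
  extend f n a i with i ℕ.<? n
  ... | yes _ = f i
  ... | no _  = a

  extend-< : ∀ {A : Set} (f : ℕ → A) n a {i} → i ℕ.< n → extend f n a i ≡ f i
  extend-< f n a {i} i<n with i ℕ.<? n
  ... | yes _  = ≡.refl
  ... | no i≮n = ⊥-elim (i≮n i<n)

  extend-≡ : ∀ {A : Set} (f : ℕ → A) n a → extend f n a n ≡ a
  extend-≡ f n a with n ℕ.<? n
  ... | yes n<n = ⊥-elim (ℕ.<-irrefl ≡.refl n<n)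
  ... | no _    = ≡.refl

  walk : ∀ {u v e n} → Trail u v (just e) n → Walk u v (just e) n
  walk (snoc {v = v} {w} {l} {n} tr e v∈ w∈ v≢w l≢e) = record
    { vertex = v′
    ; edgeOf = e′
    ; left∈ = λ i<n → steps i<n v∈ (prev .left∈)
    ; right∈ = λ i<n → steps′ i<n w∈ (prev .right∈)
    ; vertex-turns = turns
    ; edge-turns = e-turns
    ; start = ≡.trans (v′-≤ ℕ.z≤n) (prev .start)
    ; end = extend-≡ (prev .vertex) (suc n) w
    ; last = λ { ≡.refl → ≡.cong just (≡.sym (extend-≡ (prev .edgeOf) n e)) }
    }
    where
    open Walk
    -- The empty trail has no edge, so the edge about to be added serves as a default value of
    -- `edgeOf`.
    prefix : ∀ {u v l n} → Trail u v l n → Edge H → Walk u v l n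
    prefix {u} [] e = record
      { vertex = λ _ → u ; edgeOf = λ _ → e ; left∈ = λ () ; right∈ = λ () ; vertex-turns = λ ()
      ; edge-turns = λ () ; start = ≡.refl ; end = ≡.refl ; last = λ () }
    prefix tr@(snoc _ _ _ _ _ _) _ = walk tr
    prev : Walk _ v l n
    prev = prefix tr e
    v′ : ℕ → Vertex H
    v′ = extend (prev .vertex) (suc n) w
    e′ : ℕ → Edge H
    e′ = extend (prev .edgeOf) n e
    v′-≤ : ∀ {i} → i ℕ.≤ n → v′ i ≡ prev .vertex i
    v′-≤ i≤n = extend-< (prev .vertex) (suc n) w (ℕ.s≤s i≤n)
    case : ∀ {i} {P : ℕ → Set} → i ℕ.< suc n → (i ℕ.< n → P i) → P n → P i
    case {i} {P} i≤n p q with ℕ.m≤n⇒m<n∨m≡n (ℕ.s≤s⁻¹ i≤n)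
    ... | inj₁ i<n    = p i<n
    ... | inj₂ ≡.refl = q
    steps : ∀ {i} → i ℕ.< suc n → v ∈ edge H e → (i ℕ.< n → prev .vertex i ∈ edge H (prev .edgeOf i)) → v′ i ∈ edge H (e′ i)
    steps {i} i≤n p q = case {P = λ i → v′ i ∈ edge H (e′ i)} i≤n
      (λ i<n → ≡.subst₂ (λ v e → v ∈ edge H e) (≡.sym (v′-≤ (ℕ.<⇒≤ i<n))) (≡.sym (extend-< (prev .edgeOf) n e i<n)) (q i<n))
      (≡.subst₂ (λ v e → v ∈ edge H e) (≡.sym (≡.trans (v′-≤ ℕ.≤-refl) (prev .end))) (≡.sym (extend-≡ (prev .edgeOf) n e)) p)
    steps′ : ∀ {i} → i ℕ.< suc n → w ∈ edge H e → (i ℕ.< n → prev .vertex (suc i) ∈ edge H (prev .edgeOf i)) → v′ (suc i) ∈ edge H (e′ i)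
    steps′ {i} i≤n p q = case {P = λ i → v′ (suc i) ∈ edge H (e′ i)} i≤n
      (λ i<n → ≡.subst₂ (λ v e → v ∈ edge H e) (≡.sym (v′-≤ i<n)) (≡.sym (extend-< (prev .edgeOf) n e i<n)) (q i<n))
      (≡.subst₂ (λ v e → v ∈ edge H e) (≡.sym (extend-≡ (prev .vertex) (suc n) w)) (≡.sym (extend-≡ (prev .edgeOf) n e)) p)
    turns : ∀ {i} → i ℕ.< suc n → v′ i ≢ v′ (suc i)
    turns i≤n = case {P = λ i → v′ i ≢ v′ (suc i)} i≤n
      (λ i<n → ≡.subst₂ _≢_ (≡.sym (v′-≤ (ℕ.<⇒≤ i<n))) (≡.sym (v′-≤ i<n)) (prev .vertex-turns i<n))
      (≡.subst₂ _≢_ (≡.sym (≡.trans (v′-≤ ℕ.≤-refl) (prev .end))) (≡.sym (extend-≡ (prev .vertex) (suc n) w)) v≢w)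
    e-turns : ∀ {i} → suc i ℕ.< suc n → e′ i ≢ e′ (suc i)
    e-turns {i} i<n with ℕ.m≤n⇒m<n∨m≡n (ℕ.s≤s⁻¹ i<n)
    ... | inj₁ i+1<n = ≡.subst₂ _≢_ (≡.sym (extend-< (prev .edgeOf) n e (ℕ.s≤s⁻¹ i<n)))
      (≡.sym (extend-< (prev .edgeOf) n e i+1<n)) (prev .edge-turns i+1<n)
    ... | inj₂ ≡.refl = λ eq → l≢e (≡.trans (prev .last ≡.refl) (≡.cong just
      (≡.trans (≡.sym (extend-< (prev .edgeOf) n e ℕ.≤-refl)) (≡.trans eq (extend-≡ (prev .edgeOf) n e)))))

  -- Injectivity of a path prevents it from turning back. The last edge is described along the way
  -- because the next step has to avoid it.
  pathTrail : ∀ l (v : Fin (suc l) → Vertex H) (e : Fin l → Edge H) → Injective _≡_ _≡_ v → Injective _≡_ _≡_ e →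
    (∀ i → v (inject₁ i) ∈ edge H (e i)) → (∀ i → v (suc i) ∈ edge H (e i)) →
    ∃[ last ] Trail (v zero) (v (fromℕ l)) last l × (∀ i → suc (toℕ i) ≡ l → last ≡ just (e i))
  pathTrail zero v e _ _ _ _ = nothing , [] , λ ()
  pathTrail (suc l) v e v-inj e-inj left right with pathTrail l (v ∘ inject₁) (e ∘ inject₁)
    (Fin.inject₁-injective ∘ v-inj) (Fin.inject₁-injective ∘ e-inj) (left ∘ inject₁) (right ∘ inject₁)
  ... | last , tr , last≡ = just (e (fromℕ l)) ,
    snoc tr (e (fromℕ l)) (left (fromℕ l)) (right (fromℕ l)) (λ eq → inject₁≢suc (fromℕ l) (v-inj eq)) last≢ ,
    λ i eq → ≡.cong (just ∘ e) (Fin.toℕ-injective (≡.trans (Fin.toℕ-fromℕ l) (≡.sym (ℕ.suc-injective eq))))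
    where
    inject₁≢suc : ∀ {n} (i : Fin n) → inject₁ i ≢ suc i
    inject₁≢suc i eq = ℕ.1+n≢n (≡.trans (≡.sym (≡.cong toℕ eq)) (Fin.toℕ-inject₁ i))
    turn : ∀ k {last a b} (e : Fin (suc k) → Edge H) → Injective _≡_ _≡_ e → Trail a b last k →
      (∀ i → suc (toℕ i) ≡ k → last ≡ just (e (inject₁ i))) → last ≢ just (e (fromℕ k))
    turn zero    e _ [] _ ()
    turn (suc k) e inj _ last≡ eq = inject₁≢suc (fromℕ k) (inj (Maybe.just-injective
        (≡.trans (≡.sym (last≡ (fromℕ k) (≡.cong suc (Fin.toℕ-fromℕ k)))) eq)))
    last≢ : last ≢ just (e (fromℕ l))
    last≢ = turn l e e-inj tr last≡

  module Acyclic (noClosed : ∀ l → 0 ℕ.< l → ¬ ClosedTrail H l) where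
    noClosedTrail′ : ∀ {u e n} → ¬ Trail u u (just e) n
    noClosedTrail′ tr@(snoc {n = n} _ _ _ _ _ _) = noClosed (suc n) (ℕ.s≤s ℕ.z≤n) record
      { Walk w using (vertex; edgeOf; left∈; right∈; vertex-turns; edge-turns)
      ; closed = ≡.trans (Walk.start w) (≡.sym (Walk.end w)) }
      where
      w = walk tr

    -- The first trail followed backwards by the second is closed.
    join : ∀ {u v e n l n′} → Trail u v (just e) n → Trail u v l n′ → l ≢ just e → ⊥
    join tr [] _ = noClosedTrail′ tr
    join tr (snoc tr′ f x∈ v∈ x≢v l≢f) f≢e =
      join (snoc tr f v∈ x∈ (x≢v ∘ ≡.sym) (f≢e ∘ ≡.sym)) tr′ l≢f

    -- The last edges are compared. If they differ, or if they agree but are entered from different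
    -- vertices, the two trails combine to a closed one; otherwise the last step is removed from
    -- both.
    trail-unique : ∀ {u v l n l′ n′} → Trail u v l n → Trail u v l′ n′ → l ≡ l′ × n ≡ n′
    trail-unique [] [] = ≡.refl , ≡.refl
    trail-unique [] tr@(snoc _ _ _ _ _ _) = ⊥-elim (noClosedTrail′ tr)
    trail-unique tr@(snoc _ _ _ _ _ _) [] = ⊥-elim (noClosedTrail′ tr)
    trail-unique tr@(snoc {v = x} tr₁ e x∈ v∈ x≢v l≢e) tr′@(snoc {v = y} tr₂ f y∈ _ _ l′≢f) with e Fin.≟ f
    ... | no e≢f = ⊥-elim (join tr tr′ (λ eq → e≢f (≡.sym (Maybe.just-injective eq))))
    ... | yes ≡.refl with x Fin.≟ y
    ... | yes ≡.refl = ≡.refl , ≡.cong suc (proj₂ (trail-unique tr₁ tr₂))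
    ... | no x≢y = ⊥-elim (join (snoc tr₁ e x∈ y∈ x≢y l≢e) tr₂ l′≢f)

    module _ (connected : Connected H) (u : Vertex H) where
      private
        trail : ∀ v → ∃[ l ] ∃[ n ] Trail u v l n
        trail v with connected u v
        ... | n , path with pathTrail n vertexAt edgeAt vertexAt-injective edgeAt-injective left∈ right∈
          where open Path path
        ... | l , tr , _ = l , n , ≡.subst₂ (λ u v → Trail u v l n) (Path.start path) (Path.end path) tr

        parent : Vertex H → Maybe (Edge H)
        parent v = proj₁ (trail v)

        depth : Vertex H → ℕ
        depth v = proj₁ (proj₂ (trail v))

        trailTo : ∀ v → Trail u v (parent v) (depth v)
        trailTo v = proj₂ (proj₂ (trail v))

        unique : ∀ {v l n} → Trail u v l n → parent v ≡ l × depth v ≡ n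
        unique tr = trail-unique (trailTo _) tr

        -- The vertex by which trails from `u` enter `e`: it is `v` itself unless the trail to `v`
        -- ends with `e`, and then it is the vertex just before.
        apexFrom : ∀ {v l n} e → Trail u v l n → v ∈ edge H e → ∃[ a ] a ∈ edge H e × parent a ≢ just e
        apexFrom {v} e tr v∈ with parent v in eq
        ... | nothing = v , v∈ , λ p → case (≡.trans (≡.sym eq) p)
          where
          case : nothing ≢ just e
          case ()
        ... | just f with f Fin.≟ e
        ... | no f≢e = v , v∈ , λ p → f≢e (Maybe.just-injective (≡.trans (≡.sym eq) p))
        ... | yes ≡.refl with ≡.subst (λ l → Trail u v l (depth v)) eq (trailTo v)
        ... | tr′ = previous tr′
          where
          previous : ∀ {v n} → Trail u v (just e) n → ∃[ a ] a ∈ edge H e × parent a ≢ just e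
          previous (snoc {v = x} tr″ _ x∈ _ _ l≢) = x , x∈ , λ p → l≢ (≡.trans (≡.sym (proj₁ (unique tr″))) p)

        apex′ : ∀ e → ∃[ a ] a ∈ edge H e × parent a ≢ just e
        apex′ e = apexFrom e (trailTo (proj₁ (edge-nonempty H e))) (proj₂ (edge-nonempty H e))

        apex : Edge H → Vertex H
        apex e = proj₁ (apex′ e)

        -- Two different vertices of `e` that are both reached without `e` would be joined by `e` to
        -- a closed trail.
        apex-unique : ∀ {v e} → v ∈ edge H e → parent v ≢ just e → apex e ≡ v
        apex-unique {v} {e} v∈ p≢ with apex e Fin.≟ v
        ... | yes eq = eq
        ... | no a≢v = ⊥-elim (join (snoc (trailTo (apex e)) e (proj₁ (proj₂ (apex′ e))) v∈ a≢v (proj₂ (proj₂ (apex′ e))))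
                         (trailTo v) p≢)

        lastStep : ∀ {v e n} → Trail u v (just e) n → v ∈ edge H e × depth (apex e) ℕ.< n
        lastStep (snoc {n = n} tr e x∈ v∈ _ l≢) = v∈ , ℕ.s≤s (ℕ.≤-reflexive (≡.trans
          (≡.cong depth (apex-unique x∈ (λ p → l≢ (≡.trans (≡.sym (proj₁ (unique tr))) p)))) (proj₂ (unique tr))))

        fromNothing : ∀ {v n} → Trail u v nothing n → v ≡ u
        fromNothing [] = ≡.refl

      rooted : Rooted H
      rooted = record
        { root = u ; parent = parent ; apex = apex ; depth = depth
        ; parent-root = proj₁ (unique [])
        ; parent≡nothing = λ {v} p → fromNothing (≡.subst (λ l → Trail u v l (depth v)) p (trailTo v))
        ; ∈⇒ = ∈⇒
        ; apex∈ = λ e → proj₁ (proj₂ (apex′ e))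
        ; parent∈ = λ {v} p → proj₁ (lastStep (≡.subst (λ l → Trail u v l (depth v)) p (trailTo v)))
        ; apex-depth = λ {v} p → proj₂ (lastStep (≡.subst (λ l → Trail u v l (depth v)) p (trailTo v)))
        }
        where
        ∈⇒ : ∀ {v e} → v ∈ edge H e → apex e ≡ v ⊎ parent v ≡ just e
        ∈⇒ {v} {e} v∈ with Maybe.≡-dec Fin._≟_ (parent v) (just e)
        ... | yes p = inj₂ p
        ... | no p≢ = inj₁ (apex-unique v∈ p≢)

hypertree-rooted : ∀ {H} → IsHypertree H → ∀ v → Σ[ R ∈ Rooted H ] Rooted.root R ≡ v
hypertree-rooted {H} tree v = Acyclic.rooted H (noClosedTrail H linear noLooseCycle) connected v , ≡.refl
  where open IsHypertree tree

-- Loose paths with pendant edges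

module _ {m n} (p : Subset m) (q : Subset n) where
  ∈-++⁺ˡ : ∀ {x} → x ∈ p → x ↑ˡ n ∈ p ++ q
  ∈-++⁺ˡ {x} x∈ = lookup⇒[]= _ _ (≡.trans (lookup-++ˡ p q x) ([]=⇒lookup x∈))

  ∈-++⁻ˡ : ∀ {x} → x ↑ˡ n ∈ p ++ q → x ∈ p
  ∈-++⁻ˡ {x} x∈ = lookup⇒[]= _ _ (≡.trans (≡.sym (lookup-++ˡ p q x)) ([]=⇒lookup x∈))

  ∈-++⁺ʳ : ∀ {x} → x ∈ q → m ↑ʳ x ∈ p ++ q
  ∈-++⁺ʳ {x} x∈ = lookup⇒[]= _ _ (≡.trans (lookup-++ʳ p q x) ([]=⇒lookup x∈))

  ∈-++⁻ʳ : ∀ {x} → m ↑ʳ x ∈ p ++ q → x ∈ q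
  ∈-++⁻ʳ {x} x∈ = lookup⇒[]= _ _ (≡.trans (≡.sym (lookup-++ʳ p q x)) ([]=⇒lookup x∈))

module _ (r d : ℕ) where
  toℕ-pathVertex : ∀ i → toℕ (pathVertex r d i) ≡ toℕ i ℕ.* r
  toℕ-pathVertex i = Fin.toℕ-fromℕ< _

  toℕ-combine′ : ∀ {d} (j : Fin d) (q : Fin r) → toℕ (combine j q) ≡ toℕ j ℕ.* r ℕ.+ toℕ q
  toℕ-combine′ j q = ≡.trans (Fin.toℕ-combine j q) (≡.cong (ℕ._+ toℕ q) (ℕ.*-comm r (toℕ j)))

  pathEdge⁺ : ∀ j x → toℕ j ℕ.* r ℕ.≤ toℕ x → toℕ x ℕ.≤ suc (toℕ j) ℕ.* r → x ∈ pathEdge r d j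
  pathEdge⁺ j x p q = ∈-tabulate⁺ (inPathEdge r d j) (Equivalence.from T-∧ (ℕ.≤⇒≤ᵇ p , ℕ.≤⇒≤ᵇ q))

  pathEdge⁻ : ∀ j x → x ∈ pathEdge r d j → toℕ j ℕ.* r ℕ.≤ toℕ x × toℕ x ℕ.≤ suc (toℕ j) ℕ.* r
  pathEdge⁻ j x x∈ with Equivalence.to (T-∧ {toℕ j ℕ.* r ℕ.≤ᵇ toℕ x}) (∈-tabulate⁻ (inPathEdge r d j) x∈)
  ... | p , q = ℕ.≤ᵇ⇒≤ _ _ p , ℕ.≤ᵇ⇒≤ _ _ q

  block∈pathEdge : ∀ j q → suc (combine j q) ∈ pathEdge r d j
  block∈pathEdge j q = pathEdge⁺ j _
    (ℕ.≤-trans (ℕ.m≤m+n _ (toℕ q)) (ℕ.≤-trans (ℕ.≤-reflexive (≡.sym (toℕ-combine′ j q))) (ℕ.n≤1+n _)))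
    (ℕ.≤-trans (ℕ.≤-reflexive (≡.cong suc (toℕ-combine′ j q))) (ℕ.≤-trans (ℕ.≤-reflexive (≡.sym (ℕ.+-suc (toℕ j ℕ.* r) (toℕ q))))
      (ℕ.≤-trans (ℕ.+-monoʳ-≤ (toℕ j ℕ.* r) (Fin.toℕ<n q)) (ℕ.≤-reflexive (ℕ.+-comm (toℕ j ℕ.* r) r)))))

  -- Apart from its left end `j r`, the edge consists of the numbers `suc y` where `y` has quotient
  -- `j` by `r`; the two bounds on `x` force this quotient.
  pathEdge-cases : ∀ j x → x ∈ pathEdge r d j → pathVertex r d (inject₁ j) ≡ x ⊎ ∃[ q ] suc (combine j q) ≡ x
  pathEdge-cases j x x∈ with pathEdge⁻ j x x∈ | toℕ x ℕ.≟ toℕ j ℕ.* r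
  ... | _ | yes eq = inj₁ (Fin.toℕ-injective (≡.trans (toℕ-pathVertex (inject₁ j))
    (≡.trans (≡.cong (ℕ._* r) (Fin.toℕ-inject₁ j)) (≡.sym eq))))
  ... | lo , _ | no x≢ with x
  ... | zero = ⊥-elim (x≢ (≡.sym (ℕ.n≤0⇒n≡0 lo)))
  pathEdge-cases j x x∈ | lo , hi | no x≢ | suc y = inj₂ (proj₂ jq , ≡.cong suc
      (≡.trans (≡.cong (λ i → combine i (proj₂ jq)) (≡.sym j≡)) y≡))
    where
    jq : Fin d × Fin r
    jq = remQuot {d} r y
    y≡ : combine (proj₁ jq) (proj₂ jq) ≡ y
    y≡ = Fin.combine-remQuot {d} r y
    toℕ-y : toℕ y ≡ toℕ (proj₁ jq) ℕ.* r ℕ.+ toℕ (proj₂ jq)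
    toℕ-y = ≡.trans (≡.cong toℕ (≡.sym y≡)) (toℕ-combine′ (proj₁ jq) (proj₂ jq))
    lo′ : toℕ j ℕ.* r ℕ.≤ toℕ y
    lo′ = ℕ.s≤s⁻¹ (ℕ.≤∧≢⇒< lo (x≢ ∘ ≡.sym))
    j≡ : proj₁ jq ≡ j
    j≡ = Fin.toℕ-injective (ℕ.≤-antisym
      (ℕ.s≤s⁻¹ (ℕ.*-cancelʳ-< r (toℕ (proj₁ jq)) (suc (toℕ j))
        (ℕ.≤-<-trans (ℕ.≤-trans (ℕ.m≤m+n _ _) (ℕ.≤-reflexive (≡.sym toℕ-y))) hi)))
      (ℕ.s≤s⁻¹ (ℕ.*-cancelʳ-< r (toℕ j) (suc (toℕ (proj₁ jq)))
        (ℕ.≤-<-trans lo′ (ℕ.≤-<-trans (ℕ.≤-reflexive toℕ-y) (ℕ.<-≤-trans (ℕ.+-monoʳ-< (toℕ (proj₁ jq) ℕ.* r) (Fin.toℕ<n (proj₂ jq)))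
          (ℕ.≤-reflexive (ℕ.+-comm (toℕ (proj₁ jq) ℕ.* r) r))))))))

-- The loose path of length d with pendant edges attached, rooted at its first
-- vertex: every vertex but the root is one of the r new vertices of one edge.
module Pendants (r′ d : ℕ) {s : ℕ} (at : Fin s → Fin (suc (d ℕ.* suc r′))) where
  r : ℕ
  r = suc r′

  graph : Hypergraph
  graph = attach r (loosePath r d) at

  Slot : Set
  Slot = Fin d ⊎ Fin s

  start : Vertex graph
  start = zero ↑ˡ (s ℕ.* r)

  onPath : Fin (suc d) → Vertex graph
  onPath i = pathVertex r d i ↑ˡ (s ℕ.* r)

  child : Slot → Fin r → Vertex graph
  child (inj₁ j) q = suc (combine j q) ↑ˡ (s ℕ.* r)
  child (inj₂ j) q = suc (d ℕ.* r) ↑ʳ combine j q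

  apexOf : Slot → Vertex graph
  apexOf (inj₁ j) = onPath (inject₁ j)
  apexOf (inj₂ j) = at j ↑ˡ (s ℕ.* r)

  private
    decodeSum : Fin (suc (d ℕ.* r)) ⊎ Fin (s ℕ.* r) → Maybe (Slot × Fin r)
    decodeSum (inj₁ zero)    = nothing
    decodeSum (inj₁ (suc x)) = just (inj₁ (proj₁ (remQuot {d} r x)) , proj₂ (remQuot {d} r x))
    decodeSum (inj₂ y)       = just (inj₂ (proj₁ (remQuot {s} r y)) , proj₂ (remQuot {s} r y))

  decode : Vertex graph → Maybe (Slot × Fin r)
  decode v = decodeSum (splitAt (suc (d ℕ.* r)) v)

  decode-child : ∀ e q → decode (child e q) ≡ just (e , q)
  decode-child (inj₁ j) q = ≡.trans (≡.cong decodeSum (Fin.splitAt-↑ˡ (suc (d ℕ.* r)) (suc (combine j q)) (s ℕ.* r)))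
    (≡.cong (λ (j , q) → just (inj₁ j , q)) (Fin.remQuot-combine j q))
  decode-child (inj₂ j) q = ≡.trans (≡.cong decodeSum (Fin.splitAt-↑ʳ (suc (d ℕ.* r)) (s ℕ.* r) (combine j q)))
    (≡.cong (λ (j , q) → just (inj₂ j , q)) (Fin.remQuot-combine j q))

  data Node : Vertex graph → Set where
    isStart : Node start
    isChild : ∀ e q → Node (child e q)

  node : ∀ v → Node v
  node v = ≡.subst Node (Fin.join-splitAt (suc (d ℕ.* r)) (s ℕ.* r) v) (nodeSum (splitAt (suc (d ℕ.* r)) v))
    where
    nodeSum : ∀ x → Node (Fin.join (suc (d ℕ.* r)) (s ℕ.* r) x)
    nodeSum (inj₁ zero)    = isStart
    nodeSum (inj₁ (suc x)) = ≡.subst (λ x → Node (suc x ↑ˡ (s ℕ.* r))) (Fin.combine-remQuot {d} r x)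
      (isChild (inj₁ (proj₁ (remQuot {d} r x))) (proj₂ (remQuot {d} r x)))
    nodeSum (inj₂ y)       = ≡.subst (λ y → Node (suc (d ℕ.* r) ↑ʳ y)) (Fin.combine-remQuot {s} r y)
      (isChild (inj₂ (proj₁ (remQuot {s} r y))) (proj₂ (remQuot {s} r y)))

  edgeOf : Slot → Subset (order graph)
  edgeOf = attachEdge r (loosePath r d) at

  apex∈′ : ∀ x → apexOf x ∈ edgeOf x
  apex∈′ (inj₁ j) = ∈-++⁺ˡ (pathEdge r d j) Subset.⊥ (left∈pathEdge r d j)
  apex∈′ (inj₂ j) = ∈-++⁺ˡ ⁅ at j ⁆ (block r (loosePath r d) at j) (x∈⁅x⁆ (at j))

  child∈ : ∀ x q → child x q ∈ edgeOf x
  child∈ (inj₁ j) q = ∈-++⁺ˡ (pathEdge r d j) Subset.⊥ (block∈pathEdge r d j q)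
  child∈ (inj₂ j) q = ∈-++⁺ʳ ⁅ at j ⁆ (block r (loosePath r d) at j)
    (∈-tabulate⁺ (inBlock r (loosePath r d) at j) (fromWitness (≡.cong proj₁ (Fin.remQuot-combine {s} j q))))

  member : ∀ x v → v ∈ edgeOf x → apexOf x ≡ v ⊎ ∃[ q ] child x q ≡ v
  member x v v∈ = ≡.subst (λ v → v ∈ edgeOf x → apexOf x ≡ v ⊎ ∃[ q ] child x q ≡ v)
    (Fin.join-splitAt (suc (d ℕ.* r)) (s ℕ.* r) v) (memberSum x (splitAt (suc (d ℕ.* r)) v)) v∈
    where
    memberSum : ∀ x y → Fin.join (suc (d ℕ.* r)) (s ℕ.* r) y ∈ edgeOf x →
      apexOf x ≡ Fin.join (suc (d ℕ.* r)) (s ℕ.* r) y ⊎ ∃[ q ] child x q ≡ Fin.join (suc (d ℕ.* r)) (s ℕ.* r) y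
    memberSum (inj₁ j) (inj₁ y) p with pathEdge-cases r d j y (∈-++⁻ˡ (pathEdge r d j) Subset.⊥ p)
    ... | inj₁ eq       = inj₁ (≡.cong (_↑ˡ (s ℕ.* r)) eq)
    ... | inj₂ (q , eq) = inj₂ (q , ≡.cong (_↑ˡ (s ℕ.* r)) eq)
    memberSum (inj₁ j) (inj₂ y) p = ⊥-elim (∉⊥ (∈-++⁻ʳ (pathEdge r d j) Subset.⊥ p))
    memberSum (inj₂ j) (inj₁ y) p = inj₁ (≡.cong (_↑ˡ (s ℕ.* r))
      (≡.sym (x∈⁅y⁆⇒x≡y _ (∈-++⁻ˡ ⁅ at j ⁆ (block r (loosePath r d) at j) p))))
    memberSum (inj₂ j) (inj₂ y) p = inj₂ (proj₂ (remQuot {s} r y) , ≡.cong (suc (d ℕ.* r) ↑ʳ_)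
      (≡.trans (≡.cong (λ i → combine i (proj₂ (remQuot {s} r y))) (≡.sym quot≡)) (Fin.combine-remQuot {s} r y)))
      where
      quot≡ : proj₁ (remQuot {s} r y) ≡ j
      quot≡ = toWitness (∈-tabulate⁻ (inBlock r (loosePath r d) at j) (∈-++⁻ʳ ⁅ at j ⁆ (block r (loosePath r d) at j) p))

  parentOf : Vertex graph → Maybe (Edge graph)
  parentOf v = Maybe.map (Fin.join d s ∘ proj₁) (decode v)

  parent-child : ∀ x q → parentOf (child x q) ≡ just (Fin.join d s x)
  parent-child x q = ≡.cong (Maybe.map (Fin.join d s ∘ proj₁)) (decode-child x q)

  rooted : Rooted graph
  rooted = record
    -- Vertex numbers grow away from the start, as the path is numbered from left to right and the
    -- vertices of attached edges come after all path vertices; hence `toℕ` is a depth.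
    { root = start ; parent = parentOf ; apex = apexOf ∘ splitAt d ; depth = toℕ
    ; parent-root = ≡.refl
    ; parent≡nothing = λ {v} → noParent (node v)
    ; ∈⇒ = λ {v} {e} → incident e
    ; apex∈ = apex∈′ ∘ splitAt d
    ; parent∈ = λ {v} {e} → child⇒∈ (node v) e
    ; apex-depth = λ {v} → shallower (node v)
    }
    where
    noParent : ∀ {v} → Node v → parentOf v ≡ nothing → v ≡ start
    noParent isStart       _  = ≡.refl
    noParent (isChild x q) eq with () ← ≡.trans (≡.sym (parent-child x q)) eq
    incident : ∀ {v} e → v ∈ edge graph e → apexOf (splitAt d e) ≡ v ⊎ parentOf v ≡ just e
    incident {v} e v∈ with member (splitAt d e) v v∈
    ... | inj₁ p = inj₁ p
    ... | inj₂ (q , ≡.refl) = inj₂ (≡.trans (parent-child (splitAt d e) q) (≡.cong just (Fin.join-splitAt d s e)))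
    split : ∀ {x q e} → parentOf (child x q) ≡ just e → splitAt d e ≡ x
    split {x} {q} p = ≡.trans (≡.cong (splitAt d) (Maybe.just-injective (≡.trans (≡.sym p) (parent-child x q)))) (Fin.splitAt-join d s x)
    child⇒∈ : ∀ {v} → Node v → ∀ e → parentOf v ≡ just e → v ∈ edge graph e
    child⇒∈ isStart       e ()
    child⇒∈ (isChild x q) e p = ≡.subst (λ x′ → child x q ∈ edgeOf x′) (≡.sym (split {x} {q} p)) (child∈ x q)
    deeper : ∀ x q → toℕ (apexOf x) ℕ.< toℕ (child x q)
    deeper (inj₁ j) q = ≡.subst₂ ℕ._<_
      (≡.sym (≡.trans (Fin.toℕ-↑ˡ _ (s ℕ.* r)) (≡.trans (toℕ-pathVertex r d (inject₁ j)) (≡.cong (ℕ._* r) (Fin.toℕ-inject₁ j)))))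
      (≡.sym (≡.trans (Fin.toℕ-↑ˡ (suc (combine j q)) (s ℕ.* r)) (≡.cong suc (toℕ-combine′ r d j q))))
      (ℕ.s≤s (ℕ.m≤m+n _ (toℕ q)))
    deeper (inj₂ j) q = ≡.subst₂ ℕ._<_ (≡.sym (Fin.toℕ-↑ˡ (at j) (s ℕ.* r)))
      (≡.sym (Fin.toℕ-↑ʳ (suc (d ℕ.* r)) (combine j q))) (ℕ.<-≤-trans (Fin.toℕ<n (at j)) (ℕ.m≤m+n _ _))
    shallower : ∀ {v e} → Node v → parentOf v ≡ just e → toℕ (apexOf (splitAt d e)) ℕ.< toℕ v
    shallower isStart ()
    shallower (isChild x q) p = ≡.subst (λ x′ → toℕ (apexOf x′) ℕ.< toℕ (child x q)) (≡.sym (split {x} {q} p)) (deeper x q)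

  -- The right end of a path edge is the last of its `r` new vertices. The isomorphism and the
  -- eigenvector below both treat this index separately.
  onPath-suc : ∀ j → onPath (suc j) ≡ child (inj₁ j) (fromℕ r′)
  onPath-suc j = ≡.cong (_↑ˡ (s ℕ.* r)) (Fin.toℕ-injective (≡.trans (toℕ-pathVertex r d (suc j))
    (≡.sym (≡.trans (≡.cong suc (≡.trans (toℕ-combine′ r d j (fromℕ r′)) (≡.cong (toℕ j ℕ.* r ℕ.+_) (Fin.toℕ-fromℕ r′))))
      (≡.trans (≡.sym (ℕ.+-suc (toℕ j ℕ.* r) r′)) (ℕ.+-comm (toℕ j ℕ.* r) r))))))

-- Isomorphisms of rooted hypergraphs and enumerations of children

≅-sym : ∀ {G H} → G ≅ H → H ≅ G
≅-sym {G} {H} iso = record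
  { vertices = mk↔ₛ′ (Inverse.from vertices) (Inverse.to vertices) (Inverse.strictlyInverseʳ vertices) (Inverse.strictlyInverseˡ vertices)
  ; edges = mk↔ₛ′ (Inverse.from edges) (Inverse.to edges) (Inverse.strictlyInverseʳ edges) (Inverse.strictlyInverseˡ edges)
  ; incident = λ v e → mk⇔
      (λ p → Equivalence.from (incident _ _) (≡.subst₂ (λ v e → v ∈ edge H e)
        (≡.sym (Inverse.strictlyInverseˡ vertices v)) (≡.sym (Inverse.strictlyInverseˡ edges e)) p))
      (λ p → ≡.subst₂ (λ v e → v ∈ edge H e)
        (Inverse.strictlyInverseˡ vertices v) (Inverse.strictlyInverseˡ edges e) (Equivalence.to (incident _ _) p))
  }
  where open _≅_ iso

bijection : ∀ {A B : Set} (f : A → B) → (∀ {x y} → f x ≡ f y → x ≡ y) → (∀ y → ∃[ x ] f x ≡ y) → A ↔ B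
bijection f inj surj = mk↔ₛ′ f (proj₁ ∘ surj) (proj₂ ∘ surj) (λ x → inj (proj₂ (surj (f x))))

-- In a rooted hypergraph a vertex lies in its parent edge and in the edges of which it is the apex,
-- so incidence is determined by `parent` and `apex`.
rooted-≅ : ∀ {G H} (RG : Rooted G) (RH : Rooted H)
  (φ : Vertex G ↔ Vertex H) (ψ : Edge G ↔ Edge H) →
  (∀ e → Inverse.to φ (Rooted.apex RG e) ≡ Rooted.apex RH (Inverse.to ψ e)) →
  (∀ v → Rooted.parent RH (Inverse.to φ v) ≡ Maybe.map (Inverse.to ψ) (Rooted.parent RG v)) → G ≅ H
rooted-≅ {G} {H} RG RH φ ψ apex≡ parent≡ = record { vertices = φ ; edges = ψ ; incident = λ v e → mk⇔ (to v e) (from v e) }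
  where
  open Rooted
  f = Inverse.to φ
  g = Inverse.to ψ
  to : ∀ v e → v ∈ edge G e → f v ∈ edge H (g e)
  to v e v∈ with ∈⇒ RG v∈
  ... | inj₁ ≡.refl = ≡.subst (_∈ edge H (g e)) (≡.sym (apex≡ e)) (apex∈ RH (g e))
  ... | inj₂ p      = parent∈ RH (≡.trans (parent≡ v) (≡.cong (Maybe.map g) p))
  from : ∀ v e → f v ∈ edge H (g e) → v ∈ edge G e
  from v e v∈ with ∈⇒ RH v∈
  ... | inj₁ p = ≡.subst (_∈ edge G e) (≡.trans (≡.sym (Inverse.strictlyInverseʳ φ _))
      (≡.trans (≡.cong (Inverse.from φ) (≡.trans (apex≡ e) p)) (Inverse.strictlyInverseʳ φ v))) (apex∈ RG e)
  ... | inj₂ p with parent RG v in eq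
  ... | nothing with () ← ≡.trans (≡.sym p) (≡.trans (parent≡ v) (≡.cong (Maybe.map g) eq))
  ... | just e′ = parent∈ RG (≡.trans eq (≡.cong just e′≡e))
      where
      ge≡ : g e′ ≡ g e
      ge≡ = Maybe.just-injective (≡.trans (≡.sym (≡.trans (parent≡ v) (≡.cong (Maybe.map g) eq))) p)
      e′≡e : e′ ≡ e
      e′≡e = ≡.trans (≡.sym (Inverse.strictlyInverseʳ ψ e′)) (≡.trans (≡.cong (Inverse.from ψ) ge≡) (Inverse.strictlyInverseʳ ψ e))

record Enumeration {A : Set} (n : ℕ) (P : A → Set) : Set where
  field
    item      : Fin n → A
    injective : ∀ {i j} → item i ≡ item j → i ≡ j
    sound     : ∀ i → P (item i)
    exhaustive  : ∀ {x} → P x → ∃[ i ] item i ≡ x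

open Enumeration

enumerate : ∀ {n} (p : Subset n) → Enumeration ∣ p ∣ (_∈ p)
enumerate [] = record { item = λ () ; injective = λ { {()} } ; sound = λ () ; exhaustive = λ () }
enumerate (false ∷ p) = record
  { item = suc ∘ item E ; injective = injective E ∘ Fin.suc-injective ; sound = there ∘ sound E
  ; exhaustive = λ { (there x∈) → proj₁ (exhaustive E x∈) , ≡.cong suc (proj₂ (exhaustive E x∈)) } }
  where E = enumerate p
enumerate (true ∷ p) = record { item = it ; injective = inj ; sound = snd ; exhaustive = comp }
  where
  E = enumerate p
  it : Fin (suc ∣ p ∣) → Fin _
  it zero    = zero
  it (suc i) = suc (item E i)
  inj : ∀ {i j} → it i ≡ it j → i ≡ j
  inj {zero}  {zero}  _  = ≡.refl
  inj {suc i} {suc j} eq = ≡.cong suc (injective E (Fin.suc-injective eq))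
  snd : ∀ i → it i ∈ true ∷ p
  snd zero    = here
  snd (suc i) = there (sound E i)
  comp : ∀ {x} → x ∈ true ∷ p → ∃[ i ] it i ≡ x
  comp here       = zero , ≡.refl
  comp (there x∈) = suc (proj₁ (exhaustive E x∈)) , ≡.cong suc (proj₂ (exhaustive E x∈))

module _ {A : Set} {n : ℕ} {P : A → Set} (E : Enumeration n P) where
  placed : ∀ {x} → P x → (b : Fin n) → Σ[ E′ ∈ Enumeration n P ] item E′ b ≡ x
  placed {x} Px b with exhaustive E Px
  ... | a , ≡.refl = record
    { item = item E ∘ transpose a b
    ; injective = λ eq → ≡.trans (≡.sym (transpose-inverse b a)) (≡.trans (≡.cong (transpose b a) (injective E eq)) (transpose-inverse b a))
    ; sound = sound E ∘ transpose a b
    ; exhaustive = λ Py → transpose b a (proj₁ (exhaustive E Py)) ,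
        ≡.trans (≡.cong (item E) (transpose-inverse a b)) (proj₂ (exhaustive E Py))
    } , ≡.cong (item E) (transpose-b (b Fin.≟ a))
    where
    transpose-b : Dec (b ≡ a) → transpose a b b ≡ a
    transpose-b _ with b Fin.≟ a
    ... | yes eq = eq
    ... | no _ with b Fin.≟ b
    ... | yes _  = ≡.refl
    ... | no b≢b = ⊥-elim (b≢b ≡.refl)

  reindex : ∀ {Q : A → Set} → (∀ {x} → P x → Q x) → (∀ {x} → Q x → P x) → Enumeration n Q
  reindex f g = record { item = item E ; injective = injective E ; sound = f ∘ sound E ; exhaustive = exhaustive E ∘ g }

dropFirst : ∀ {A : Set} {n} {P : A → Set} (E : Enumeration (suc n) P) {x} → item E zero ≡ x →
  Enumeration n (λ y → P y × y ≢ x)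
dropFirst E {x} eq = record
  { item = item E ∘ suc
  ; injective = Fin.suc-injective ∘ injective E
  ; sound = λ i → sound E (suc i) , λ eq′ → case (injective E (≡.trans eq′ (≡.sym eq)))
  ; exhaustive = λ (Py , y≢x) → rest y≢x (exhaustive E Py)
  }
  where
  case : ∀ {n} {i : Fin n} → suc i ≢ zero
  case ()
  rest : ∀ {y} → y ≢ x → ∃[ i ] item E i ≡ y → ∃[ i ] item E (suc i) ≡ y
  rest y≢x (zero , p)  = ⊥-elim (y≢x (≡.trans (≡.sym p) eq))
  rest y≢x (suc i , p) = i , p

module _ {H : Hypergraph} (R : Rooted H) where
  open Rooted R

  parent≢apex : ∀ {e} → parent (apex e) ≢ just e
  parent≢apex p = apex≢ p ≡.refl

  children : ∀ {r} → Uniform (suc r) H → ∀ e → Enumeration r (λ v → parent v ≡ just e)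
  children {r} uniform e = reindex (dropFirst (proj₁ E′) (proj₂ E′))
    (λ (v∈ , v≢) → [ (λ p → ⊥-elim (v≢ (≡.sym p))) , (λ p → p) ]′ (∈⇒ v∈))
    (λ p → parent∈ p , λ { ≡.refl → parent≢apex p })
    where
    E′ = placed (≡.subst (λ n → Enumeration n (_∈ edge H e)) (uniform e) (enumerate (edge H e))) (apex∈ e) zero

-- Recognising a path with all pendant edges at one vertex

module _ {T : Hypergraph} (R : Rooted T) (r′ : ℕ) (uniform : Uniform (suc (suc r′)) T)
         (d : ℕ) (v : Fin (suc d) → Vertex T) (e : Fin d → Edge T) where
  open Rooted R

  module PendantShape (e-injective : ∀ {i j} → e i ≡ e j → i ≡ j)
                (root≡ : root ≡ v zero)
                (path-parent : ∀ j → parent (v (suc j)) ≡ just (e j))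
                (path-apex : ∀ j → apex (e j) ≡ v (inject₁ j))
                (i₀ : Fin (suc d))
                (off-path : ∀ f → (∀ j → e j ≢ f) → apex f ≡ v i₀) where
    private
      onPath? : ∀ f → Dec (∃[ j ] e j ≡ f)
      onPath? f = Fin.any? (λ j → e j Fin.≟ f)

      offPath : Subset (size T)
      offPath = Vec.tabulate (λ f → ⌊ ¬? (onPath? f) ⌋)

      others′ : Enumeration ∣ offPath ∣ (λ f → ∀ j → e j ≢ f)
      others′ = reindex (enumerate offPath)
        (λ f∈ j p → toWitness {a? = ¬? (onPath? _)} (∈-tabulate⁻ (λ f → ⌊ ¬? (onPath? f) ⌋) f∈) (j , p))
        (λ p → ∈-tabulate⁺ (λ f → ⌊ ¬? (onPath? f) ⌋) (fromWitness {a? = ¬? (onPath? _)} (λ (j , q) → p j q)))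

      module _ {s} (others : Enumeration s (λ f → ∀ j → e j ≢ f)) where
        slotEdge : Fin d ⊎ Fin s → Edge T
        slotEdge (inj₁ j) = e j
        slotEdge (inj₂ j) = item others j

        slotEdge-injective : ∀ {x y} → slotEdge x ≡ slotEdge y → x ≡ y
        slotEdge-injective {inj₁ i} {inj₁ j} eq = ≡.cong inj₁ (e-injective eq)
        slotEdge-injective {inj₁ i} {inj₂ j} eq = ⊥-elim (sound others j i eq)
        slotEdge-injective {inj₂ i} {inj₁ j} eq = ⊥-elim (sound others i j (≡.sym eq))
        slotEdge-injective {inj₂ i} {inj₂ j} eq = ≡.cong inj₂ (injective others eq)

        slotEdge-surjective : ∀ f → ∃[ x ] slotEdge x ≡ f
        slotEdge-surjective f with onPath? f
        ... | yes (j , p) = inj₁ j , p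
        ... | no ¬p = inj₂ (proj₁ c) , proj₂ c
          where c = exhaustive others (λ j p → ¬p (j , p))

        edgeBijection : Fin (d ℕ.+ s) ↔ Edge T
        edgeBijection = bijection (slotEdge ∘ splitAt d)
          (λ {x} {y} eq → ≡.trans (≡.sym (Fin.join-splitAt d s x)) (≡.trans (≡.cong (Fin.join d s) (slotEdge-injective {splitAt d x} {splitAt d y} eq)) (Fin.join-splitAt d s y)))
          (λ f → Fin.join d s (proj₁ (slotEdge-surjective f)) ,
            ≡.trans (≡.cong slotEdge (Fin.splitAt-join d s (proj₁ (slotEdge-surjective f)))) (proj₂ (slotEdge-surjective f)))

    module _ {s} (size≡ : d ℕ.+ s ≡ size T) (at : Fin s → Fin (suc (d ℕ.* suc r′)))
             (at≡ : ∀ j → at j ≡ pathVertex (suc r′) d i₀) where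
      open Pendants r′ d at using (graph; start; child; apexOf; onPath; decode; decode-child; parentOf; onPath-suc; Node; isStart; isChild; node)

      private
        others : Enumeration s (λ f → ∀ j → e j ≢ f)
        others = ≡.subst (λ n → Enumeration n (λ f → ∀ j → e j ≢ f))
          (ℕ.+-cancelˡ-≡ d _ _ (≡.trans (↔⇒≡ (edgeBijection others′)) (≡.sym size≡))) others′

        slot : Fin d ⊎ Fin s → Edge T
        slot = slotEdge others

        childrenOf : ∀ x → Enumeration (suc r′) (λ w → parent w ≡ just (slot x))
        childrenOf (inj₁ j) = proj₁ (placed (children R uniform (e j)) (path-parent j) (fromℕ r′))
        childrenOf (inj₂ j) = children R uniform (item others j)

        image : Maybe ((Fin d ⊎ Fin s) × Fin (suc r′)) → Vertex T
        image nothing        = root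
        image (just (x , q)) = item (childrenOf x) q

        φ : Vertex graph → Vertex T
        φ = image ∘ decode

        φ-child : ∀ x q → φ (child x q) ≡ item (childrenOf x) q
        φ-child x q = ≡.cong image (decode-child x q)

        parent-φ : ∀ x q → parent (φ (child x q)) ≡ just (slot x)
        parent-φ x q = ≡.trans (≡.cong parent (φ-child x q)) (sound (childrenOf x) q)

        root≢child : ∀ x q → root ≢ φ (child x q)
        root≢child x q eq = nothing≢just (≡.trans (≡.sym parent-root) (≡.trans (≡.cong parent eq) (parent-φ x q)))
          where
          nothing≢just : ∀ {A : Set} {a : A} → nothing ≢ just a
          nothing≢just ()

        φ-injective : ∀ {x y} → Node x → Node y → φ x ≡ φ y → x ≡ y
        φ-injective isStart isStart _ = ≡.refl
        φ-injective isStart (isChild x q) eq = ⊥-elim (root≢child x q eq)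
        φ-injective (isChild x q) isStart eq = ⊥-elim (root≢child x q (≡.sym eq))
        φ-injective (isChild x q) (isChild y q′) eq = same x y q q′ (slotEdge-injective others {x} {y}
            (Maybe.just-injective (≡.trans (≡.sym (parent-φ x q)) (≡.trans (≡.cong parent eq) (parent-φ y q′)))))
            (≡.trans (≡.sym (φ-child x q)) (≡.trans eq (φ-child y q′)))
          where
          same : ∀ x y q q′ → x ≡ y → item (childrenOf x) q ≡ item (childrenOf y) q′ → child x q ≡ child y q′
          same x x q q′ ≡.refl eq = ≡.cong (child x) (injective (childrenOf x) eq)

        φ-surjective : ∀ w p → parent w ≡ p → ∃[ x ] φ x ≡ w
        φ-surjective w nothing p = start , ≡.sym (parent≡nothing p)
        φ-surjective w (just f) p = inSlot (slotEdge-surjective others f)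
          where
          found : ∀ x → ∃[ q ] item (childrenOf x) q ≡ w → ∃[ x ] φ x ≡ w
          found x (q , eq) = child x q , ≡.trans (φ-child x q) eq
          inSlot : ∃[ x ] slot x ≡ f → ∃[ x ] φ x ≡ w
          inSlot (x , eq) = found x (exhaustive (childrenOf x) (≡.trans p (≡.cong just (≡.sym eq))))

        φ-onPath : ∀ i → φ (onPath i) ≡ v i
        φ-onPath zero    = root≡
        φ-onPath (suc j) = ≡.trans (≡.cong φ (onPath-suc j)) (≡.trans (φ-child (inj₁ j) (fromℕ r′))
          (proj₂ (placed (children R uniform (e j)) (path-parent j) (fromℕ r′))))

        φ-apex : ∀ x → φ (apexOf x) ≡ apex (slot x)
        φ-apex (inj₁ j) = ≡.trans (φ-onPath (inject₁ j)) (≡.sym (path-apex j))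
        φ-apex (inj₂ j) = ≡.trans (≡.cong (λ u → φ (u ↑ˡ (s ℕ.* suc r′))) (at≡ j))
          (≡.trans (φ-onPath i₀) (≡.sym (off-path (item others j) (sound others j))))

        φ-parent : ∀ {w} → Node w → parent (φ w) ≡ Maybe.map (slot ∘ splitAt d) (parentOf w)
        φ-parent isStart       = parent-root
        φ-parent (isChild x q) = ≡.trans (parent-φ x q) (≡.sym (≡.trans
          (≡.cong (Maybe.map (slot ∘ splitAt d)) (Pendants.parent-child r′ d at x q))
          (≡.cong (just ∘ slot) (Fin.splitAt-join d s x))))

      -- The attachment map is only assumed to be constant in value, because in `pendantTree` it
      -- looks up a list whose length is known by a proved equation. The isomorphism runs from
      -- `graph` to `T`, where `decode` gives each vertex its slot and index.
      shape-≅ : T ≅ graph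
      shape-≅ = ≅-sym (rooted-≅ (Pendants.rooted r′ d at) R
        (bijection φ (λ {x} {y} → φ-injective (node x) (node y)) (λ w → φ-surjective w (parent w) ≡.refl))
        (edgeBijection others) (φ-apex ∘ splitAt d) (λ w → φ-parent (node w)))

module _ {T : Hypergraph} (R : Rooted T) (d : ℕ) (v : Fin (suc d) → Vertex T) (e : Fin d → Edge T)
         (e-injective : ∀ {i j} → e i ≡ e j → i ≡ j) (v-injective : ∀ {i j} → v i ≡ v j → i ≡ j)
         (left∈ : ∀ i → v (inject₁ i) ∈ edge T (e i)) (right∈ : ∀ i → v (suc i) ∈ edge T (e i))
         (root≡ : Rooted.root R ≡ v zero) where
  open Rooted R

  private
    inject₁≢suc : ∀ {n} (i : Fin n) → inject₁ i ≢ suc i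
    inject₁≢suc i eq = ℕ.1+n≢n (≡.trans (≡.sym (≡.cong toℕ eq)) (Fin.toℕ-inject₁ i))

    nothing≢just : ∀ {f : Edge T} → nothing ≢ just f
    nothing≢just ()

    apex⇒parent : ∀ j → apex (e j) ≡ v (inject₁ j) → parent (v (suc j)) ≡ just (e j)
    apex⇒parent j p = [ (λ q → ⊥-elim (inject₁≢suc j (v-injective (≡.trans (≡.sym p) q)))) , id ]′ (∈⇒ (right∈ j))

  -- A path that starts at the root leads away from it. The induction carries the fact that the
  -- current first vertex has none of the remaining edges as its parent, so it must be the apex of
  -- the next one.
  path-apex : ∀ j → apex (e j) ≡ v (inject₁ j)
  path-apex = go d v e e-injective left∈ right∈ (λ i → inject₁≢suc i ∘ v-injective)
      (λ p → nothing≢just (≡.trans (≡.sym (≡.trans (≡.cong parent (≡.sym root≡)) parent-root)) p))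
    where
    go : ∀ n (v : Fin (suc n) → Vertex T) (e : Fin n → Edge T) → (∀ {i j} → e i ≡ e j → i ≡ j) →
      (∀ i → v (inject₁ i) ∈ edge T (e i)) → (∀ i → v (suc i) ∈ edge T (e i)) → (∀ i → v (inject₁ i) ≢ v (suc i)) →
      (∀ {j} → parent (v zero) ≢ just (e j)) → ∀ j → apex (e j) ≡ v (inject₁ j)
    go (suc n) v e inj left right v≢ p≢ zero = [ id , ⊥-elim ∘ p≢ ]′ (∈⇒ (left zero))
    go (suc n) v e inj left right v≢ p≢ (suc j) = go n (v ∘ suc) (e ∘ suc) (Fin.suc-injective ∘ inj)
      (left ∘ suc) (right ∘ suc) (v≢ ∘ suc) (λ p → ⊥-elim (Fin.0≢1+n (inj (Maybe.just-injective (≡.trans (≡.sym parent₁) p))))) j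
      where
      parent₁ : parent (v (suc zero)) ≡ just (e zero)
      parent₁ = [ (λ q → ⊥-elim (v≢ zero (≡.trans (≡.sym (go (suc n) v e inj left right v≢ p≢ zero)) q))) , id ]′ (∈⇒ (right zero))

  path-parent : ∀ j → parent (v (suc j)) ≡ just (e j)
  path-parent j = apex⇒parent j (path-apex j)

module _ {A B : Set} (c : B → ℕ) (g : B → A) where
  private
    F : B → List A
    F j = List.replicate (c j) (g j)

  concatMap-none : ∀ n (h : Fin n → B) → (∀ i → c (h i) ≡ 0) → List.concatMap F (List.tabulate h) ≡ List.[]
  concatMap-none zero    h p = ≡.refl
  concatMap-none (suc n) h p = ≡.trans
    (≡.cong (λ k → List.replicate k (g (h zero)) List.++ List.concatMap F (List.tabulate (h ∘ suc))) (p zero))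
    (concatMap-none n (h ∘ suc) (p ∘ suc))

  concatMap-single : ∀ n (h : Fin n → B) i₀ → (∀ i → i ≢ i₀ → c (h i) ≡ 0) → List.concatMap F (List.tabulate h) ≡ F (h i₀)
  concatMap-single (suc n) h zero p = ≡.trans
    (≡.cong (F (h zero) List.++_) (concatMap-none n (h ∘ suc) (λ i → p (suc i) (λ ())))) (List.++-identityʳ _)
  concatMap-single (suc n) h (suc i₀) p = ≡.trans
    (≡.cong (λ k → List.replicate k (g (h zero)) List.++ List.concatMap F (List.tabulate (h ∘ suc))) (p zero (λ ())))
    (concatMap-single n (h ∘ suc) i₀ (λ i i≢ → p (suc i) (i≢ ∘ Fin.suc-injective)))

lookup-constant : ∀ {A : Set} n (x : A) {xs} → xs ≡ List.replicate n x → ∀ j → List.lookup xs j ≡ x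
lookup-constant (suc n) x ≡.refl zero    = ≡.refl
lookup-constant (suc n) x ≡.refl (suc j) = lookup-constant n x ≡.refl j

module _ (r d n : ℕ) (i : Fin (suc d)) (1≤i : 1 ℕ.≤ toℕ i) (i<d : toℕ i ℕ.< d) where
  -- Positions on the path count from 0 and subscripts from 1, so position `i` is the vertex with
  -- subscript `i + 1`.
  attachments-single : attachmentList r d (onlyAt (toℕ i ℕ.+ 1) n) ≡ List.replicate n (pathVertex r d i)
  attachments-single = go d i 1≤i i<d
    where
    go : ∀ d (i : Fin (suc d)) → 1 ℕ.≤ toℕ i → toℕ i ℕ.< d →
      attachmentList r d (onlyAt (toℕ i ℕ.+ 1) n) ≡ List.replicate n (pathVertex r d i)
    go (suc d) (suc i) _ (ℕ.s≤s i<d) = ≡.trans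
      (concatMap-single c (λ j → pathVertex r (suc d) (interior (suc d) j)) d id j₀ other)
      (≡.cong₂ List.replicate c-j₀ (≡.cong (pathVertex r (suc d) ∘ suc) inject₁-j₀))
      where
      c : Fin d → ℕ
      c = onlyAt (suc (toℕ i) ℕ.+ 1) n
      j₀ : Fin d
      j₀ = Fin.fromℕ< i<d
      inject₁-j₀ : inject₁ j₀ ≡ i
      inject₁-j₀ = Fin.toℕ-injective (≡.trans (Fin.toℕ-inject₁ j₀) (Fin.toℕ-fromℕ< i<d))
      c-j₀ : c j₀ ≡ n
      c-j₀ = ≡.cong (if_then n else 0) (dec-true (toℕ j₀ ℕ.+ 2 ℕ.≟ suc (toℕ i) ℕ.+ 1)
        (≡.trans (≡.cong (ℕ._+ 2) (Fin.toℕ-fromℕ< i<d)) (ℕ.+-suc (toℕ i) 1)))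
      other : ∀ j → j ≢ j₀ → c j ≡ 0
      other j j≢ = ≡.cong (if_then n else 0) (dec-false (toℕ j ℕ.+ 2 ℕ.≟ suc (toℕ i) ℕ.+ 1)
        (λ eq → j≢ (Fin.toℕ-injective (≡.trans
          (ℕ.+-cancelʳ-≡ 2 (toℕ j) (toℕ i) (≡.trans eq (≡.sym (ℕ.+-suc (toℕ i) 1)))) (≡.sym (Fin.toℕ-fromℕ< i<d))))))

-- Consequences of the bound on the number of edges

-- Wherever `2 + d` occurs in these bounds, it is the diameter; the parameter itself is the diameter
-- minus 2.
2d-bound : ∀ d k → (2 ℕ.+ d) ℕ.* (2 ℕ.+ d) ℕ.< k → d ℕ.+ 2 ℕ.* suc d ℕ.< k
2d-bound d k d²<k = ℕ.≤-<-trans (ℕ.≤-trans (ℕ.m≤m+n _ (d ℕ.+ d ℕ.* d ℕ.+ 2)) (ℕ.≤-reflexive (eq d))) d²<k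
  where
  eq : ∀ d → d ℕ.+ 2 ℕ.* suc d ℕ.+ (d ℕ.+ d ℕ.* d ℕ.+ 2) ≡ (2 ℕ.+ d) ℕ.* (2 ℕ.+ d)
  eq = solve-∀

-- For a root of degree `2 + d + y` with `suc d + a` edges avoiding it. The hypothesis makes `a + y`
-- large compared with `d`, and the product on the right outweighs the left side.
product-bound : ∀ d a y → (2 ℕ.+ d) ℕ.* (2 ℕ.+ d) ℕ.< suc (2 ℕ.+ d ℕ.+ y ℕ.+ d) ℕ.+ a →
  suc d ℕ.+ a ℕ.< suc a ℕ.* (2 ℕ.+ y)
product-bound d a y d²<k = ℕ.+-cancelʳ-< (3 ℕ.+ d ℕ.+ d) (suc d ℕ.+ a) (suc a ℕ.* (2 ℕ.+ y)) (begin-strict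
  suc d ℕ.+ a ℕ.+ (3 ℕ.+ d ℕ.+ d)                                 ≤⟨ ℕ.m≤m+n _ (d ℕ.+ d ℕ.* d) ⟩
  suc d ℕ.+ a ℕ.+ (3 ℕ.+ d ℕ.+ d) ℕ.+ (d ℕ.+ d ℕ.* d)             ≡⟨ eq₁ d a ⟩
  (2 ℕ.+ d) ℕ.* (2 ℕ.+ d) ℕ.+ a                                   <⟨ ℕ.+-monoˡ-< a d²<k ⟩
  suc (2 ℕ.+ d ℕ.+ y ℕ.+ d) ℕ.+ a ℕ.+ a                           ≤⟨ ℕ.m≤m+n _ (2 ℕ.+ a ℕ.* y) ⟩
  suc (2 ℕ.+ d ℕ.+ y ℕ.+ d) ℕ.+ a ℕ.+ a ℕ.+ (2 ℕ.+ a ℕ.* y)       ≡⟨ eq₂ d a y ⟩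
  suc a ℕ.* (2 ℕ.+ y) ℕ.+ (3 ℕ.+ d ℕ.+ d)                         ∎)
  where
  open ℕ.≤-Reasoning
  eq₁ : ∀ d a → suc d ℕ.+ a ℕ.+ (3 ℕ.+ d ℕ.+ d) ℕ.+ (d ℕ.+ d ℕ.* d) ≡ (2 ℕ.+ d) ℕ.* (2 ℕ.+ d) ℕ.+ a
  eq₁ = solve-∀
  eq₂ : ∀ d a y → suc (2 ℕ.+ d ℕ.+ y ℕ.+ d) ℕ.+ a ℕ.+ a ℕ.+ (2 ℕ.+ a ℕ.* y) ≡ suc a ℕ.* (2 ℕ.+ y) ℕ.+ (3 ℕ.+ d ℕ.+ d)
  eq₂ = solve-∀

large⇒d²<k : ∀ r d k → 4 ℕ.* ((2 ℕ.+ d) ℕ.* (2 ℕ.+ d)) ℕ.* suc r ℕ.+ 2 ℕ.≤ 4 ℕ.* k ℕ.+ suc r →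
  (2 ℕ.+ d) ℕ.* (2 ℕ.+ d) ℕ.< k
large⇒d²<k r d k large = ℕ.*-cancelˡ-< 4 q k (ℕ.+-cancelʳ-< (suc r) (4 ℕ.* q) (4 ℕ.* k) (begin-strict
  4 ℕ.* q ℕ.+ suc r                     ≡⟨ ℕ.+-suc (4 ℕ.* q) r ⟩
  suc (4 ℕ.* q ℕ.+ r)                   ≤⟨ ℕ.s≤s (ℕ.+-monoʳ-≤ (4 ℕ.* q) (ℕ.m≤n*m r (4 ℕ.* q))) ⟩
  suc (4 ℕ.* q ℕ.+ 4 ℕ.* q ℕ.* r)       ≡⟨ ≡.cong suc (ℕ.*-suc (4 ℕ.* q) r) ⟨
  suc (4 ℕ.* q ℕ.* suc r)               <⟨ ℕ.n<1+n _ ⟩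
  suc (suc (4 ℕ.* q ℕ.* suc r))         ≡⟨ ℕ.+-comm 2 _ ⟩
  4 ℕ.* q ℕ.* suc r ℕ.+ 2               ≤⟨ large ⟩
  4 ℕ.* k ℕ.+ suc r                     ∎))
  where
  open ℕ.≤-Reasoning
  q : ℕ
  q = (2 ℕ.+ d) ℕ.* (2 ℕ.+ d)

-- Clearing the denominator and adding m - 1 to both sides gives an inequality between natural
-- numbers without subtraction.
sizeBound⇒large : ∀ r d k → sizeBound (suc (suc r)) d ℚᵘ.≤ + k / 1 →
  4 ℕ.* (d ℕ.* d) ℕ.* suc r ℕ.+ 2 ℕ.≤ 4 ℕ.* k ℕ.+ suc r
sizeBound⇒large r d k (*≤* p) = ℤ.drop‿+≤+ (≡.subst₂ ℤ._≤_ left right (ℤ.+-monoˡ-≤ (+ suc r) p))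
  where
  open ℤ.+-*-Solver
  left : ((+ 4 ℤ.* + d ℤ.* + d ℤ.- + 1) ℤ.* + suc r ℤ.+ + 2) ℤ.* + 1 ℤ.+ + suc r ≡ + (4 ℕ.* (d ℕ.* d) ℕ.* suc r ℕ.+ 2)
  left = ≡.trans (solve 2 (λ d r → ((con (+ 4) :* d :* d :- con (+ 1)) :* r :+ con (+ 2)) :* con (+ 1) :+ r := con (+ 4) :* (d :* d) :* r :+ con (+ 2)) ≡.refl (+ d) (+ suc r))
    (≡.cong (ℤ._+ + 2) (≡.trans (≡.cong (ℤ._* + suc r) (≡.trans (≡.cong (+ 4 ℤ.*_) (≡.sym (ℤ.pos-* d d))) (≡.sym (ℤ.pos-* 4 (d ℕ.* d)))))
      (≡.sym (ℤ.pos-* (4 ℕ.* (d ℕ.* d)) (suc r)))))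
  right : + k ℤ.* + 4 ℤ.+ + suc r ≡ + (4 ℕ.* k ℕ.+ suc r)
  right = ≡.cong (ℤ._+ + suc r) (≡.trans (≡.sym (ℤ.pos-* k 4)) (≡.cong +_ (ℕ.*-comm k 4)))

module _ (r d k : ℕ) (large : 4 ℕ.* ((2 ℕ.+ d) ℕ.* (2 ℕ.+ d)) ℕ.* suc r ℕ.+ 2 ℕ.≤ 4 ℕ.* k ℕ.+ suc r) where
  2d≤d² : 3 ℕ.+ (2 ℕ.+ d) ℕ.≤ k
  2d≤d² = ℕ.≤-trans (ℕ.≤-trans (ℕ.m≤m+n _ (3 ℕ.* d ℕ.+ d ℕ.* d)) (ℕ.≤-reflexive (eq d))) (large⇒d²<k r d k large)
    where
    eq : ∀ d → 3 ℕ.+ (2 ℕ.+ d) ℕ.+ (3 ℕ.* d ℕ.+ d ℕ.* d) ≡ suc ((2 ℕ.+ d) ℕ.* (2 ℕ.+ d))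
    eq = solve-∀

  d≤k : 2 ℕ.+ d ℕ.≤ k
  d≤k = ℕ.≤-trans (ℕ.m≤n+m _ 3) 2d≤d²

  3≤k∸d : 3 ℕ.≤ k ℕ.∸ (2 ℕ.+ d)
  3≤k∸d = ℕ.≤-trans (ℕ.≤-reflexive (≡.sym (ℕ.m+n∸n≡m 3 (2 ℕ.+ d)))) (ℕ.∸-monoˡ-≤ (2 ℕ.+ d) 2d≤d²)

-- Here the argument `suc (suc r)` means m ≥ 3, when the hypothesis on k even gives k ≥ 2 d². The
-- iteration for the Perron root then starts at 3.
6≤k∸d : ∀ r d k → 4 ℕ.* ((2 ℕ.+ d) ℕ.* (2 ℕ.+ d)) ℕ.* suc (suc r) ℕ.+ 2 ℕ.≤ 4 ℕ.* k ℕ.+ suc (suc r) →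
  6 ℕ.≤ k ℕ.∸ (2 ℕ.+ d)
6≤k∸d r d k large = ℕ.≤-trans (ℕ.≤-reflexive (≡.sym (ℕ.m+n∸n≡m 6 (2 ℕ.+ d)))) (ℕ.∸-monoˡ-≤ (2 ℕ.+ d)
    (ℕ.≤-trans (ℕ.≤-trans (ℕ.m≤m+n _ (7 ℕ.* d ℕ.+ 2 ℕ.* (d ℕ.* d))) (ℕ.≤-reflexive (eq₁ d))) 2q≤k))
  where
  q : ℕ
  q = (2 ℕ.+ d) ℕ.* (2 ℕ.+ d)
  eq₁ : ∀ d → 6 ℕ.+ (2 ℕ.+ d) ℕ.+ (7 ℕ.* d ℕ.+ 2 ℕ.* (d ℕ.* d)) ≡ 2 ℕ.* ((2 ℕ.+ d) ℕ.* (2 ℕ.+ d))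
  eq₁ = solve-∀
  eq₂ : ∀ q r → 4 ℕ.* (2 ℕ.* q) ℕ.+ (2 ℕ.+ 4 ℕ.* q ℕ.* r) ≡ 4 ℕ.* q ℕ.* suc (suc r) ℕ.+ 2
  eq₂ = solve-∀
  2q≤k : 2 ℕ.* q ℕ.≤ k
  2q≤k = ℕ.*-cancelˡ-≤ 4 (ℕ.+-cancelʳ-≤ (suc (suc r)) (4 ℕ.* (2 ℕ.* q)) (4 ℕ.* k)
    (ℕ.≤-trans (ℕ.+-monoʳ-≤ (4 ℕ.* (2 ℕ.* q)) (ℕ.+-monoʳ-≤ 2 (ℕ.m≤n*m r (4 ℕ.* q))))
      (ℕ.≤-trans (ℕ.≤-reflexive (eq₂ q r)) large)))

module _ {ℓ₀ ℓ₁ ℓ₂ : Level} (ℝ : RealNumbers ℓ₀ ℓ₁ ℓ₂) where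
  open RealNumbers ℝ hiding (zero)
  open CommutativeRing realRing using (semiring; ring; +-abelianGroup)

  private
    module M = Algebra.Properties.Semiring.Mult semiring
    module O = Algebra.Properties.Semiring.Mult.TCOptimised semiring
    module S = Algebra.Properties.Semiring.Sum semiring
    module RP = Algebra.Properties.Ring ring
    module AP = Algebra.Properties.AbelianGroup +-abelianGroup
    module ≈R = Relation.Binary.Reasoning.Setoid setoid

  -- Ordered field arithmetic

  -- Numerals in the form used for solver coefficients: with this multiple `lit 1` is `1#` itself,
  -- whereas `fromℕ# 1` is `1# + 0#`.
  lit : ℕ → Carrier
  lit n = n O.× 1#

  fromℤ : ℤ → Carrier
  fromℤ (+ n)   = lit n
  fromℤ -[1+ n ] = - lit (suc n)

  lit-+ : ∀ m n → lit (m ℕ.+ n) ≈ lit m + lit n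
  lit-+ m n = O.×-homo-+ 1# m n

  lit-* : ∀ m n → lit (m ℕ.* n) ≈ lit m * lit n
  lit-* m n = O.×1-homo-* m n

  fromℤ-neg : ∀ i → fromℤ (ℤ.- i) ≈ - fromℤ i
  fromℤ-neg (+ zero)  = ≈-sym RP.-0#≈0#
  fromℤ-neg (+ suc n) = ≈-refl
  fromℤ-neg -[1+ n ]   = ≈-sym (RP.-‿involutive _)

  fromℤ-⊖ : ∀ m n → fromℤ (m ℤ.⊖ n) ≈ lit m - lit n
  fromℤ-⊖ m n with ℕ.≤-total n m
  ... | inj₁ n≤m = begin
    fromℤ (m ℤ.⊖ n)                 ≡⟨ ≡.cong fromℤ (ℤ.⊖-≥ n≤m) ⟩
    lit (m ℕ.∸ n)                   ≈⟨ +-identityʳ _ ⟨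
    lit (m ℕ.∸ n) + 0#              ≈⟨ +-congˡ (-‿inverseʳ (lit n)) ⟨
    lit (m ℕ.∸ n) + (lit n - lit n) ≈⟨ +-assoc _ _ _ ⟨
    lit (m ℕ.∸ n) + lit n - lit n   ≈⟨ +-congʳ (lit-+ (m ℕ.∸ n) n) ⟨
    lit (m ℕ.∸ n ℕ.+ n) - lit n     ≡⟨ ≡.cong (λ k → lit k - lit n) (ℕ.m∸n+n≡m n≤m) ⟩
    lit m - lit n                   ∎
    where open ≈R
  ... | inj₂ m≤n = begin
    fromℤ (m ℤ.⊖ n)                   ≡⟨ ≡.cong fromℤ (ℤ.⊖-≤ m≤n) ⟩
    fromℤ (ℤ.- (+ (n ℕ.∸ m)))        ≈⟨ fromℤ-neg (+ (n ℕ.∸ m)) ⟩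
    - lit (n ℕ.∸ m)                   ≈⟨ +-identityˡ _ ⟨
    0# - lit (n ℕ.∸ m)                ≈⟨ +-congʳ (-‿inverseʳ (lit m)) ⟨
    lit m - lit m - lit (n ℕ.∸ m)     ≈⟨ +-assoc _ _ _ ⟩
    lit m + (- lit m - lit (n ℕ.∸ m)) ≈⟨ +-congˡ (AP.⁻¹-∙-comm _ _) ⟩
    lit m - (lit m + lit (n ℕ.∸ m))   ≈⟨ +-congˡ (-‿cong (lit-+ m (n ℕ.∸ m))) ⟨
    lit m - lit (m ℕ.+ (n ℕ.∸ m))     ≡⟨ ≡.cong (λ k → lit m - lit k) (ℕ.m+[n∸m]≡n m≤n) ⟩
    lit m - lit n                     ∎
    where open ≈R

  fromℤ-+ : ∀ i j → fromℤ (i ℤ.+ j) ≈ fromℤ i + fromℤ j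
  fromℤ-+ (+ m)   (+ n)   = lit-+ m n
  fromℤ-+ (+ m)   -[1+ n ] = fromℤ-⊖ m (suc n)
  fromℤ-+ -[1+ m ] (+ n)   = ≈-trans (fromℤ-⊖ n (suc m)) (+-comm _ _)
  fromℤ-+ -[1+ m ] -[1+ n ] = begin
    - lit (suc (suc (m ℕ.+ n)))   ≡⟨ ≡.cong (λ k → - lit (suc k)) (ℕ.+-suc m n) ⟨
    - lit (suc m ℕ.+ suc n)       ≈⟨ -‿cong (lit-+ (suc m) (suc n)) ⟩
    - (lit (suc m) + lit (suc n)) ≈⟨ AP.⁻¹-∙-comm _ _ ⟨
    - lit (suc m) - lit (suc n)   ∎
    where open ≈R

  fromℤ-* : ∀ i j → fromℤ (i ℤ.* j) ≈ fromℤ i * fromℤ j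
  fromℤ-* (+ m) (+ n) = ≈-trans (≈-reflexive (≡.cong fromℤ (≡.sym (ℤ.pos-* m n)))) (lit-* m n)
  fromℤ-* (+ m) -[1+ n ] = begin
    fromℤ (+ m ℤ.* -[1+ n ])        ≡⟨ ≡.cong fromℤ (ℤ.neg-distribʳ-* (+ m) (+ suc n)) ⟨
    fromℤ (ℤ.- (+ m ℤ.* (+ suc n))) ≈⟨ fromℤ-neg (+ m ℤ.* (+ suc n)) ⟩
    - fromℤ (+ m ℤ.* (+ suc n))    ≈⟨ -‿cong (fromℤ-* (+ m) (+ suc n)) ⟩
    - (lit m * lit (suc n))          ≈⟨ RP.-‿distribʳ-* _ _ ⟩
    lit m * - lit (suc n)            ∎
    where open ≈R
  fromℤ-* -[1+ m ] (+ n) = begin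
    fromℤ (-[1+ m ] ℤ.* (+ n))      ≡⟨ ≡.cong fromℤ (ℤ.neg-distribˡ-* (+ suc m) (+ n)) ⟨
    fromℤ (ℤ.- ((+ suc m) ℤ.* (+ n))) ≈⟨ fromℤ-neg ((+ suc m) ℤ.* (+ n)) ⟩
    - fromℤ ((+ suc m) ℤ.* (+ n))  ≈⟨ -‿cong (fromℤ-* (+ suc m) (+ n)) ⟩
    - (lit (suc m) * lit n)          ≈⟨ RP.-‿distribˡ-* _ _ ⟩
    - lit (suc m) * lit n            ∎
    where open ≈R
  fromℤ-* -[1+ m ] -[1+ n ] = begin
    lit (suc m ℕ.* suc n)             ≈⟨ lit-* (suc m) (suc n) ⟩
    lit (suc m) * lit (suc n)         ≈⟨ RP.-‿involutive _ ⟨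
    - - (lit (suc m) * lit (suc n))   ≈⟨ -‿cong (RP.-‿distribʳ-* _ _) ⟩
    - (lit (suc m) * - lit (suc n))   ≈⟨ RP.-‿distribˡ-* _ _ ⟩
    - lit (suc m) * - lit (suc n)     ∎
    where open ≈R

  ℤ-rawRing : RawRing _ _
  ℤ-rawRing = CommutativeRing.rawRing ℤ.+-*-commutativeRing

  fromℤ-morphism : ℤ-rawRing -Raw-AlmostCommutative⟶ fromCommutativeRing realRing
  fromℤ-morphism = record
    { ⟦_⟧ = fromℤ ; +-homo = fromℤ-+ ; *-homo = fromℤ-* ; -‿homo = fromℤ-neg
    ; 0-homo = ≈-refl ; 1-homo = ≈-refl }

  fromℤ-≟ : ∀ i j → Maybe (fromℤ i ≈ fromℤ j)
  fromℤ-≟ i j with i ℤ.≟ j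
  ... | yes i≡j = just (≈-reflexive (≡.cong fromℤ i≡j))
  ... | no _    = nothing

  open import Algebra.Solver.Ring ℤ-rawRing (fromCommutativeRing realRing) fromℤ-morphism fromℤ-≟
    using (Polynomial; con; _:+_; _:*_; _:-_; :-_; _:=_; solve)

  num : ∀ {n} → ℕ → Polynomial n
  num k = con (+ k)

  -- The substitute for deciding the order; it comes from cotransitivity of apartness, and the
  -- transitivity laws mixing `<` and `≤` rest on it.
  <-cotrans : ∀ {x y} → x < y → ∀ z → x < z ⊎ z < y
  <-cotrans x<y z with #-cotrans (<⇒# x<y) z
  ... | inj₁ x#z = [ inj₁ , (λ z<x → inj₂ (<-trans z<x x<y)) ]′ (#⇒<⊎> x#z)
  ... | inj₂ z#y = [ inj₂ , (λ y<z → inj₁ (<-trans x<y y<z)) ]′ (#⇒<⊎> z#y)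

  ≤-refl : ∀ {x} → x ≤ x
  ≤-refl = <-irrefl ≈-refl

  ≤-reflexive : ∀ {x y} → x ≈ y → x ≤ y
  ≤-reflexive x≈y = <-irrefl (≈-sym x≈y)

  <⇒≤ : ∀ {x y} → x < y → x ≤ y
  <⇒≤ x<y y<x = <-asym x<y y<x

  ≤-<-trans : ∀ {x y z} → x ≤ y → y < z → x < z
  ≤-<-trans {x} x≤y y<z = [ ⊥-elim ∘ x≤y , (λ p → p) ]′ (<-cotrans y<z x)

  <-≤-trans : ∀ {x y z} → x < y → y ≤ z → x < z
  <-≤-trans {z = z} x<y y≤z = [ (λ p → p) , ⊥-elim ∘ y≤z ]′ (<-cotrans x<y z)

  ≤-trans : ∀ {x y z} → x ≤ y → y ≤ z → x ≤ z
  ≤-trans x≤y y≤z z<x = y≤z (<-≤-trans z<x x≤y)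

  ≤-antisym : ∀ {x y} → x ≤ y → y ≤ x → x ≈ y
  ≤-antisym {x} {y} x≤y y≤x = proj₁ (tight x y) λ x#y → [ y≤x , x≤y ]′ (#⇒<⊎> x#y)

  ≤-resp : ∀ {x x′ y y′} → x ≈ x′ → y ≈ y′ → x ≤ y → x′ ≤ y′
  ≤-resp x≈ y≈ x≤y = x≤y ∘ <-respˡ-≈ (≈-sym y≈) ∘ <-respʳ-≈ (≈-sym x≈)

  <-resp : ∀ {x x′ y y′} → x ≈ x′ → y ≈ y′ → x < y → x′ < y′
  <-resp x≈ y≈ = <-respˡ-≈ x≈ ∘ <-respʳ-≈ y≈

  <⇒0<- : ∀ {x y} → x < y → 0# < y - x
  <⇒0<- {x} x<y = <-respˡ-≈ (-‿inverseʳ x) (+-monoˡ-< (- x) x<y)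

  0<-⇒< : ∀ {x y} → 0# < y - x → x < y
  0<-⇒< {x} {y} p = <-resp (+-identityˡ x)
    (solve 2 (λ x y → y :- x :+ x := y) ≈-refl x y) (+-monoˡ-< x p)

  ≤⇒0≤- : ∀ {x y} → x ≤ y → 0# ≤ y - x
  ≤⇒0≤- {x} {y} x≤y p = x≤y (<-resp (solve 2 (λ x y → y :- x :+ x := y) ≈-refl x y)
    (+-identityˡ x) (+-monoˡ-< x p))

  0≤-⇒≤ : ∀ {x y} → 0# ≤ y - x → x ≤ y
  0≤-⇒≤ {x} {y} p y<x = p (<-respʳ-≈ (-‿inverseʳ x) (+-monoˡ-< (- x) y<x))

  <-by : ∀ {x y} e → 0# < e → y - x ≈ e → x < y
  <-by e p eq = 0<-⇒< (<-respʳ-≈ (≈-sym eq) p)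

  ≤-by : ∀ {x y} e → 0# ≤ e → y - x ≈ e → x ≤ y
  ≤-by e p eq = 0≤-⇒≤ (≤-resp ≈-refl (≈-sym eq) p)

  neg-pos : ∀ {x} → x < 0# → 0# < - x
  neg-pos {x} p = <-respʳ-≈ (+-identityˡ _) (<⇒0<- p)

  +-pos-nonneg : ∀ {x y} → 0# < x → 0# ≤ y → 0# < x + y
  +-pos-nonneg {x} {y} p q =
    [ (λ -x<y → <-respʳ-≈ (solve 2 (λ x y → y :- (:- x) := x :+ y) ≈-refl x y) (<⇒0<- -x<y))
    , ⊥-elim ∘ q ]′
    (<-cotrans (<-by x p (solve 1 (λ x → num 0 :- (:- x) := x) ≈-refl x)) y)

  +-nonneg-pos : ∀ {x y} → 0# ≤ x → 0# < y → 0# < x + y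
  +-nonneg-pos p q = <-respʳ-≈ (+-comm _ _) (+-pos-nonneg q p)

  +-pos : ∀ {x y} → 0# < x → 0# < y → 0# < x + y
  +-pos p q = +-pos-nonneg p (<⇒≤ q)

  +-nonneg : ∀ {x y} → 0# ≤ x → 0# ≤ y → 0# ≤ x + y
  +-nonneg {x} {y} p q x+y<0 = q (<-respˡ-≈ (solve 2 (λ x y → x :+ y :- x := y) ≈-refl x y)
    (≤-<-trans (≤-by x p (solve 2 (λ x y → y :- (y :- x) := x) ≈-refl x (x + y))) x+y<0))

  +-mono-≤ : ∀ {x y u v} → x ≤ y → u ≤ v → x + u ≤ y + v
  +-mono-≤ {x} {y} {u} {v} p q = ≤-by _ (+-nonneg (≤⇒0≤- p) (≤⇒0≤- q))
    (solve 4 (λ x y u v → y :+ v :- (x :+ u) := (y :- x) :+ (v :- u)) ≈-refl x y u v)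

  x-0≈x : ∀ x → x - 0# ≈ x
  x-0≈x = solve 1 (λ x → x :- num 0 := x) ≈-refl

  invertible⇒#0 : ∀ x y → x * y ≈ 1# → x # 0#
  invertible⇒#0 x y eq = invertible⇒# (y , ≈-trans (*-comm _ _) eq′ , eq′)
    where
    eq′ : (x - 0#) * y ≈ 1#
    eq′ = ≈-trans (*-congʳ (x-0≈x x)) eq

  module _ (x : Carrier) (0<x : 0# < x) where
    inv : Carrier
    inv = proj₁ (#⇒invertible (#-sym (<⇒# 0<x)))

    inv-inverse : x * inv ≈ 1#
    inv-inverse = ≈-trans (*-congʳ (≈-sym (x-0≈x x)))
      (proj₂ (proj₂ (#⇒invertible (#-sym (<⇒# 0<x)))))

    *-inverse-pos : ∀ {y} → x * y ≈ 1# → 0# < y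
    *-inverse-pos {y} eq with #⇒<⊎> (invertible⇒#0 y x (≈-trans (*-comm _ _) eq))
    ... | inj₂ 0<y = 0<y
    ... | inj₁ y<0 = ⊥-elim (<-asym 0<1 (0<-⇒< (<-respʳ-≈
      (≈-trans (solve 2 (λ x y → x :* :- y := num 0 :- x :* y) ≈-refl x y)
        (+-congˡ (-‿cong eq))) (*-pos 0<x (neg-pos y<0)))))

    inv-pos : 0# < inv
    inv-pos = *-inverse-pos inv-inverse

    *-cancel-pos : ∀ {y} → 0# < x * y → 0# < y
    *-cancel-pos {y} p = <-respʳ-≈ (begin
      inv * (x * y) ≈⟨ solve 3 (λ i x y → i :* (x :* y) := (x :* i) :* y) ≈-refl inv x y ⟩
      x * inv * y   ≈⟨ *-congʳ inv-inverse ⟩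
      1# * y        ≈⟨ *-identityˡ y ⟩
      y             ∎) (*-pos inv-pos p)
      where open ≈R

    *-cancel-nonneg : ∀ {y} → 0# ≤ x * y → 0# ≤ y
    *-cancel-nonneg {y} p y<0 = p (0<-⇒< (<-respʳ-≈
      (solve 2 (λ x y → x :* :- y := num 0 :- x :* y) ≈-refl x y) (*-pos 0<x (neg-pos y<0))))

  #0-factor : ∀ x y → x * y # 0# → x # 0#
  #0-factor x y xy#0 with #⇒invertible xy#0
  ... | w , _ , eq = invertible⇒#0 x (y * w) (≈-trans
    (solve 3 (λ x y w → x :* (y :* w) := (x :* y :- num 0) :* w) ≈-refl x y w) eq)

  #0-resp : ∀ {x y} → x ≈ y → x # 0# → y # 0#
  #0-resp {x} {y} x≈y x#0 with #⇒invertible x#0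
  ... | t , _ , eq = invertible⇒#0 y t (≈-trans (*-congʳ (≈-trans (≈-sym x≈y) (≈-sym (x-0≈x x)))) eq)

  #⇒-#0 : ∀ {x y} → x # y → x - y # 0#
  #⇒-#0 {x} {y} x#y with #⇒invertible x#y
  ... | t , _ , eq = invertible⇒#0 (x - y) t eq

  -- The conclusion is a negation, so the product may be assumed negative. It is then invertible,
  -- hence so are both factors, and only now do their signs become decidable.
  *-nonneg : ∀ {x y} → 0# ≤ x → 0# ≤ y → 0# ≤ x * y
  *-nonneg {x} {y} p q xy<0 = <-asym xy<0 (*-pos
    ([ ⊥-elim ∘ p , (λ 0<x → 0<x) ]′ (#⇒<⊎> (#0-factor x y (<⇒# xy<0))))
    ([ ⊥-elim ∘ q , (λ 0<y → 0<y) ]′ (#⇒<⊎> (#0-factor y x (<⇒# (<-respˡ-≈ (*-comm x y) xy<0))))))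

  neg*neg : ∀ x y → - x * - y ≈ x * y
  neg*neg = solve 2 (λ x y → :- x :* :- y := x :* y) ≈-refl

  #0⇒sq-pos : ∀ {x} → x # 0# → 0# < x * x
  #0⇒sq-pos {x} x#0 with #⇒<⊎> x#0
  ... | inj₂ 0<x = *-pos 0<x 0<x
  ... | inj₁ x<0 = <-respʳ-≈ (neg*neg x x) (*-pos (neg-pos x<0) (neg-pos x<0))

  sq-nonneg : ∀ x → 0# ≤ x * x
  sq-nonneg x xx<0 = <-asym xx<0 (#0⇒sq-pos (#0-factor x x (<⇒# xx<0)))

  *-monoˡ-≤ : ∀ {x y z} → 0# ≤ z → x ≤ y → z * x ≤ z * y
  *-monoˡ-≤ {x} {y} {z} p q = ≤-by _ (*-nonneg p (≤⇒0≤- q))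
    (solve 3 (λ x y z → z :* y :- z :* x := z :* (y :- x)) ≈-refl x y z)

  *-monoˡ-< : ∀ {x y z} → 0# < z → x < y → z * x < z * y
  *-monoˡ-< {x} {y} {z} p q = <-by _ (*-pos p (<⇒0<- q))
    (solve 3 (λ x y z → z :* y :- z :* x := z :* (y :- x)) ≈-refl x y z)

  *-cancelˡ-< : ∀ {x y z} → 0# < z → z * x < z * y → x < y
  *-cancelˡ-< {x} {y} {z} p q = 0<-⇒< (*-cancel-pos z p (<-respʳ-≈
    (solve 3 (λ x y z → z :* y :- z :* x := z :* (y :- x)) ≈-refl x y z) (<⇒0<- q)))

  *-cancelˡ-≤ : ∀ {x y z} → 0# < z → z * x ≤ z * y → x ≤ y
  *-cancelˡ-≤ {x} {y} {z} p q = 0≤-⇒≤ (*-cancel-nonneg z p (≤-resp ≈-refl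
    (solve 3 (λ x y z → z :* y :- z :* x := z :* (y :- x)) ≈-refl x y z) (≤⇒0≤- q)))

  sq-cancel-≤ : ∀ {x y} → 0# ≤ y → x * x ≤ y * y → x ≤ y
  sq-cancel-≤ {x} {y} 0≤y p y<x = p (<-by _ (*-pos (<⇒0<- y<x) (+-pos-nonneg (≤-<-trans 0≤y y<x) 0≤y))
    (solve 2 (λ x y → x :* x :- y :* y := (x :- y) :* (x :+ y)) ≈-refl x y))

  sq-cancel-< : ∀ {x y} → 0# ≤ x → 0# < y → x * x < y * y → x < y
  sq-cancel-< {x} {y} 0≤x 0<y p = 0<-⇒< (*-cancel-pos (y + x) (+-pos-nonneg 0<y 0≤x) (<-respʳ-≈
    (solve 2 (λ x y → y :* y :- x :* x := (y :+ x) :* (y :- x)) ≈-refl x y) (<⇒0<- p)))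

  fromℕ#≈lit : ∀ n → fromℕ# n ≈ lit n
  fromℕ#≈lit n = O.×ᵤ≈× n 1#

  fromℕ#-+ : ∀ m n → fromℕ# (m ℕ.+ n) ≈ fromℕ# m + fromℕ# n
  fromℕ#-+ m n = M.×-homo-+ 1# m n

  fromℕ#-* : ∀ m n → fromℕ# (m ℕ.* n) ≈ fromℕ# m * fromℕ# n
  fromℕ#-* m n = M.×1-homo-* m n

  fromℕ#-nonneg : ∀ n → 0# ≤ fromℕ# n
  fromℕ#-nonneg zero    = ≤-refl
  fromℕ#-nonneg (suc n) = <⇒≤ (fromℕ#-pos n)

  fromℕ#-mono-≤ : ∀ {m n} → m ℕ.≤ n → fromℕ# m ≤ fromℕ# n
  fromℕ#-mono-≤ {m} {n} m≤n = ≤-by _ (fromℕ#-nonneg (n ℕ.∸ m)) (begin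
    fromℕ# n - fromℕ# m                         ≡⟨ ≡.cong (λ k → fromℕ# k - fromℕ# m) (ℕ.m+[n∸m]≡n m≤n) ⟨
    fromℕ# (m ℕ.+ (n ℕ.∸ m)) - fromℕ# m         ≈⟨ +-congʳ (fromℕ#-+ m _) ⟩
    fromℕ# m + fromℕ# (n ℕ.∸ m) - fromℕ# m      ≈⟨ solve 2 (λ x y → x :+ y :- x := y) ≈-refl _ _ ⟩
    fromℕ# (n ℕ.∸ m)                            ∎)
    where open ≈R

  fromℕ#-mono-< : ∀ {m n} → m ℕ.< n → fromℕ# m < fromℕ# n
  fromℕ#-mono-< {m} m<n = <-≤-trans (<-by 1# 0<1
    (solve 1 (λ x → num 1 :+ x :- x := num 1) ≈-refl _)) (fromℕ#-mono-≤ m<n)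

  lit-pos : ∀ n → 0# < lit (suc n)
  lit-pos n = <-respʳ-≈ (fromℕ#≈lit (suc n)) (fromℕ#-pos n)

  lit-nonneg : ∀ n → 0# ≤ lit n
  lit-nonneg n = ≤-resp ≈-refl (fromℕ#≈lit n) (fromℕ#-nonneg n)

  -- Finite sums

  opaque
    ∑ : ∀ {n} → (Fin n → Carrier) → Carrier
    ∑ = sum

    ∑≈sum : ∀ {n} (f : Fin n → Carrier) → ∑ f ≈ sum f
    ∑≈sum f = ≈-refl

    ∑-zero : ∀ (f : Fin 0 → Carrier) → ∑ f ≈ 0#
    ∑-zero f = ≈-refl

    ∑-suc : ∀ {n} (f : Fin (suc n) → Carrier) → ∑ f ≈ f zero + ∑ (f ∘ suc)
    ∑-suc f = ≈-refl

    ∑-comm : ∀ {m n} (f : Fin m → Fin n → Carrier) → ∑ (λ i → ∑ (f i)) ≈ ∑ (λ j → ∑ (λ i → f i j))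
    ∑-comm = S.∑-comm

    ∑-permute : ∀ {m n} (f : Fin n → Carrier) (π : Permutation m n) → ∑ f ≈ ∑ (f ∘ (π ⟨$⟩ʳ_))
    ∑-permute = S.sum-permute

    ∑-cong : ∀ {n} {f g : Fin n → Carrier} → (∀ i → f i ≈ g i) → ∑ f ≈ ∑ g
    ∑-cong = S.sum-cong-≋

    ∑-+ : ∀ {n} (f g : Fin n → Carrier) → ∑ (λ i → f i + g i) ≈ ∑ f + ∑ g
    ∑-+ = S.∑-distrib-+

    ∑-*ˡ : ∀ {n} x (f : Fin n → Carrier) → ∑ (λ i → x * f i) ≈ x * ∑ f
    ∑-*ˡ x f = ≈-sym (S.*-distribˡ-sum x f)

    ∑-*ʳ : ∀ {n} x (f : Fin n → Carrier) → ∑ (λ i → f i * x) ≈ ∑ f * x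
    ∑-*ʳ x f = ≈-sym (S.*-distribʳ-sum x f)

    ∑-0 : ∀ {n} {f : Fin n → Carrier} → (∀ i → f i ≈ 0#) → ∑ f ≈ 0#
    ∑-0 {n} p = ≈-trans (∑-cong p) (S.sum-replicate-zero n)

    ∑-− : ∀ {n} (f g : Fin n → Carrier) → ∑ (λ i → f i - g i) ≈ ∑ f - ∑ g
    ∑-− f g = begin
      ∑ (λ i → f i - g i)            ≈⟨ ∑-+ f (λ i → - g i) ⟩
      ∑ f + ∑ (λ i → - g i)        ≈⟨ +-congˡ (∑-cong λ i → solve 1 (λ x → :- x := :- num 1 :* x) ≈-refl (g i)) ⟩
      ∑ f + ∑ (λ i → - 1# * g i)   ≈⟨ +-congˡ (∑-*ˡ (- 1#) g) ⟩
      ∑ f + - 1# * ∑ g             ≈⟨ solve 2 (λ x y → x :+ :- num 1 :* y := x :- y) ≈-refl _ _ ⟩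
      ∑ f - ∑ g                    ∎
      where open ≈R

    ∑-const : ∀ n x → ∑ {n} (λ _ → x) ≈ fromℕ# n * x
    ∑-const zero    x = solve 1 (λ x → num 0 := num 0 :* x) ≈-refl x
    ∑-const (suc n) x = ≈-trans (+-congˡ (∑-const n x))
      (solve 2 (λ x y → x :+ y :* x := (num 1 :+ y) :* x) ≈-refl x (fromℕ# n))

    ∑-nonneg : ∀ {n} {f : Fin n → Carrier} → (∀ i → 0# ≤ f i) → 0# ≤ ∑ f
    ∑-nonneg {zero}  p = ≤-refl
    ∑-nonneg {suc n} p = +-nonneg (p zero) (∑-nonneg (p ∘ suc))

    ∑-mono-≤ : ∀ {n} {f g : Fin n → Carrier} → (∀ i → f i ≤ g i) → ∑ f ≤ ∑ g
    ∑-mono-≤ {zero}  p = ≤-refl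
    ∑-mono-≤ {suc n} p = +-mono-≤ (p zero) (∑-mono-≤ (p ∘ suc))

    term≤∑ : ∀ {n} {f : Fin n → Carrier} → (∀ i → 0# ≤ f i) → ∀ i → f i ≤ ∑ f
    term≤∑ p zero    = ≤-resp (+-identityʳ _) ≈-refl (+-mono-≤ ≤-refl (∑-nonneg (p ∘ suc)))
    term≤∑ p (suc i) = ≤-resp (+-identityˡ _) ≈-refl (+-mono-≤ (p zero) (term≤∑ (p ∘ suc) i))

    ∑-pos : ∀ {n} {f : Fin n → Carrier} → (∀ i → 0# ≤ f i) → ∀ i → 0# < f i → 0# < ∑ f
    ∑-pos p i q = <-≤-trans q (term≤∑ p i)

    ∑-single : ∀ {n} (f : Fin n → Carrier) j → (∀ i → i ≢ j → f i ≈ 0#) → ∑ f ≈ f j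
    ∑-single {suc n} f zero    p = ≈-trans (+-congˡ (∑-0 λ i → p (suc i) λ ())) (+-identityʳ _)
    ∑-single {suc n} f (suc j) p = ≈-trans (+-cong (p zero λ ())
      (∑-single (f ∘ suc) j λ i i≢j → p (suc i) (i≢j ∘ Fin.suc-injective))) (+-identityˡ _)

  -- Iverson brackets, by which counting arguments become identities between sums of reals.
  ⟦_⟧ : ∀ {p} {P : Set p} → Dec P → Carrier
  ⟦ P? ⟧ = if does P? then 1# else 0#

  ⟦⟧-yes : ∀ {p} {P : Set p} (P? : Dec P) → P → ⟦ P? ⟧ ≈ 1#
  ⟦⟧-yes (yes _) _ = ≈-refl
  ⟦⟧-yes (no ¬p) p = ⊥-elim (¬p p)

  ⟦⟧-no : ∀ {p} {P : Set p} (P? : Dec P) → ¬ P → ⟦ P? ⟧ ≈ 0#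
  ⟦⟧-no (no _)  _  = ≈-refl
  ⟦⟧-no (yes p) ¬p = ⊥-elim (¬p p)

  ⟦⟧-cong : ∀ {p q} {P : Set p} {Q : Set q} (P? : Dec P) (Q? : Dec Q) →
    (P → Q) → (Q → P) → ⟦ P? ⟧ ≈ ⟦ Q? ⟧
  ⟦⟧-cong (yes p) Q? f g = ≈-sym (⟦⟧-yes Q? (f p))
  ⟦⟧-cong (no ¬p) Q? f g = ≈-sym (⟦⟧-no Q? (¬p ∘ g))

  ⟦⟧*-cong : ∀ {p} {P : Set p} (P? : Dec P) {x y} → (P → x ≈ y) → ⟦ P? ⟧ * x ≈ ⟦ P? ⟧ * y
  ⟦⟧*-cong (yes p) eq = *-congˡ (eq p)
  ⟦⟧*-cong (no _)  eq = ≈-trans (zeroˡ _) (≈-sym (zeroˡ _))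

  ⟦⟧*-mono : ∀ {p} {P : Set p} (P? : Dec P) {x y} → (P → x ≤ y) → ⟦ P? ⟧ * x ≤ ⟦ P? ⟧ * y
  ⟦⟧*-mono (yes p) q = *-monoˡ-≤ (<⇒≤ 0<1) (q p)
  ⟦⟧*-mono (no _)  q = ≤-reflexive (≈-trans (zeroˡ _) (≈-sym (zeroˡ _)))

  ⟦⟧*-nonneg : ∀ {p} {P : Set p} (P? : Dec P) {x} → (P → 0# ≤ x) → 0# ≤ ⟦ P? ⟧ * x
  ⟦⟧*-nonneg P? q = ≤-resp (zeroʳ _) ≈-refl (⟦⟧*-mono P? q)

  ∑-unique : ∀ {n} {p} {P : Fin n → Set p} (P? : ∀ i → Dec (P i)) (f : Fin n → Carrier) j →
    P j → (∀ i → P i → i ≡ j) → ∑ (λ i → ⟦ P? i ⟧ * f i) ≈ f j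
  ∑-unique P? f j Pj uniq = ≈-trans (∑-single _ j (λ i i≢j → ≈-trans (*-congʳ (⟦⟧-no (P? i) (i≢j ∘ uniq i))) (zeroˡ _)))
    (≈-trans (*-congʳ (⟦⟧-yes (P? j) Pj)) (*-identityˡ _))

  -- Adjacency in rooted hypergraphs

  0*-cong : ∀ {x} y → x ≈ 0# → x * y ≈ 0#
  0*-cong y p = ≈-trans (*-congʳ p) (zeroˡ y)

  1*-cong : ∀ {x} y → x ≈ 1# → x * y ≈ y
  1*-cong y p = ≈-trans (*-congʳ p) (*-identityˡ y)

  module _ {H : Hypergraph} (R : Rooted H) where
    open Rooted R

    _≟ₘ_ : (x y : Maybe (Edge H)) → Dec (x ≡ y)
    _≟ₘ_ = Maybe.≡-dec Fin._≟_

    incidence : Vertex H → Edge H → Carrier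
    incidence v e = ⟦ v ∈? edge H e ⟧

    edgeSum : (Vertex H → Carrier) → Edge H → Carrier
    edgeSum x e = ∑ (λ u → incidence u e * x u)

    childSum : (Vertex H → Carrier) → Edge H → Carrier
    childSum x e = ∑ (λ u → ⟦ parent u ≟ₘ just e ⟧ * x u)

    apexSum : (Edge H → Carrier) → Vertex H → Carrier
    apexSum g v = ∑ (λ e → ⟦ apex e Fin.≟ v ⟧ * g e)

    incidence-split : ∀ v e → incidence v e ≈ ⟦ apex e Fin.≟ v ⟧ + ⟦ parent v ≟ₘ just e ⟧
    incidence-split v e with apex e Fin.≟ v | parent v ≟ₘ just e
    ... | yes p | yes q = ⊥-elim (apex≢ q p)
    ... | yes p | no _  = ≈-trans (⟦⟧-yes (v ∈? edge H e) (≡.subst (_∈ edge H e) p (apex∈ e))) (≈-sym (+-identityʳ _))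
    ... | no _  | yes q = ≈-trans (⟦⟧-yes (v ∈? edge H e) (parent∈ q)) (≈-sym (+-identityˡ _))
    ... | no ¬p | no ¬q = ≈-trans (⟦⟧-no (v ∈? edge H e) ([ ¬p , ¬q ]′ ∘ ∈⇒)) (≈-sym (+-identityˡ _))

    edgeSum-split : ∀ x e → edgeSum x e ≈ x (apex e) + childSum x e
    edgeSum-split x e = begin
      edgeSum x e ≈⟨ ∑-cong (λ u → ≈-trans (*-congʳ (incidence-split u e)) (distribʳ _ _ _)) ⟩
      ∑ (λ u → ⟦ apex e Fin.≟ u ⟧ * x u + ⟦ parent u ≟ₘ just e ⟧ * x u) ≈⟨ ∑-+ (λ u → ⟦ apex e Fin.≟ u ⟧ * x u) (λ u → ⟦ parent u ≟ₘ just e ⟧ * x u) ⟩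
      ∑ (λ u → ⟦ apex e Fin.≟ u ⟧ * x u) + childSum x e
        ≈⟨ +-congʳ (∑-unique (apex e Fin.≟_) x (apex e) ≡.refl (λ _ → ≡.sym)) ⟩
      x (apex e) + childSum x e ∎
      where open ≈R

    -- The adjacency operator without the factor 1 / (m - 1); its eigenvalues are the numbers κ = r
    -- λ.
    neighbourSum : (Vertex H → Carrier) → Vertex H → Carrier
    neighbourSum x v = ∑ (λ u → ⟦ adjacent? H v u ⟧ * x u)

    -- Two distinct vertices have at most one common edge, so the number of their common edges is 0
    -- or 1 and equals the indicator of adjacency.
    adjacent-incidence : ∀ v u → ⟦ adjacent? H v u ⟧ ≈
      ∑ (λ e → incidence v e * (incidence u e * ⟦ ¬? (v Fin.≟ u) ⟧))
    adjacent-incidence v u = helper (adjacent? H v u)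
      where
      F : Edge H → Carrier
      F e = incidence v e * (incidence u e * ⟦ ¬? (v Fin.≟ u) ⟧)
      F≈0 : ∀ e → ¬ (v ≢ u × v ∈ edge H e × u ∈ edge H e) → F e ≈ 0#
      F≈0 e ¬p with v ∈? edge H e | u ∈? edge H e | v Fin.≟ u
      ... | no _   | _      | _      = zeroˡ _
      ... | yes _  | no _   | _      = ≈-trans (*-congˡ (zeroˡ _)) (zeroʳ _)
      ... | yes _  | yes _  | yes _  = ≈-trans (*-congˡ (zeroʳ _)) (zeroʳ _)
      ... | yes v∈ | yes u∈ | no v≢u = ⊥-elim (¬p (v≢u , v∈ , u∈))
      helper : (a? : Dec (Adjacent H v u)) → ⟦ a? ⟧ ≈ ∑ F
      helper (no ¬a) = ≈-sym (∑-0 (λ e → F≈0 e λ (v≢u , v∈ , u∈) → ¬a (v≢u , e , v∈ , u∈)))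
      helper (yes (v≢u , e , v∈ , u∈)) = ≈-sym (≈-trans
        (∑-single F e (λ f f≢e → F≈0 f λ (_ , v∈f , u∈f) → f≢e (common-edge-unique v≢u v∈f u∈f v∈ u∈)))
        (≈-trans (1*-cong _ (⟦⟧-yes (v ∈? edge H e) v∈)) (≈-trans (1*-cong _ (⟦⟧-yes (u ∈? edge H e) u∈))
          (⟦⟧-yes (¬? (v Fin.≟ u)) v≢u))))

    neighbourSum-edges : ∀ x v → neighbourSum x v ≈ ∑ (λ e → incidence v e * (edgeSum x e - x v))
    neighbourSum-edges x v = begin
      neighbourSum x v
        ≈⟨ ∑-cong (λ u → ≈-trans (*-congʳ (adjacent-incidence v u)) (≈-sym (∑-*ʳ (x u) (λ e → incidence v e * (incidence u e * ⟦ ¬? (v Fin.≟ u) ⟧))))) ⟩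
      ∑ (λ u → ∑ (λ e → incidence v e * (incidence u e * ⟦ ¬? (v Fin.≟ u) ⟧) * x u))
        ≈⟨ ∑-comm (λ u e → incidence v e * (incidence u e * ⟦ ¬? (v Fin.≟ u) ⟧) * x u) ⟩
      ∑ (λ e → ∑ (λ u → incidence v e * (incidence u e * ⟦ ¬? (v Fin.≟ u) ⟧) * x u))
        ≈⟨ ∑-cong (λ e → ≈-trans (∑-cong (λ u → *-assoc _ _ _))
             (≈-trans (∑-*ˡ (incidence v e) (λ u → incidence u e * ⟦ ¬? (v Fin.≟ u) ⟧ * x u)) (⟦⟧*-cong (v ∈? edge H e) (others e)))) ⟩
      ∑ (λ e → incidence v e * (edgeSum x e - x v)) ∎
      where
      open ≈R
      others : ∀ e → v ∈ edge H e →
        ∑ (λ u → incidence u e * ⟦ ¬? (v Fin.≟ u) ⟧ * x u) ≈ edgeSum x e - x v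
      others e v∈ = begin
        ∑ (λ u → incidence u e * ⟦ ¬? (v Fin.≟ u) ⟧ * x u)
          ≈⟨ ∑-cong (λ u → pointwise u (v Fin.≟ u)) ⟩
        ∑ (λ u → incidence u e * x u - ⟦ v Fin.≟ u ⟧ * x v)
          ≈⟨ ∑-− (λ u → incidence u e * x u) (λ u → ⟦ v Fin.≟ u ⟧ * x v) ⟩
        edgeSum x e - ∑ (λ u → ⟦ v Fin.≟ u ⟧ * x v)
          ≈⟨ +-congˡ (-‿cong (∑-unique (v Fin.≟_) (λ _ → x v) v ≡.refl (λ _ → ≡.sym))) ⟩
        edgeSum x e - x v ∎
        where
        pointwise : ∀ u (v≟u : Dec (v ≡ u)) →
          incidence u e * ⟦ ¬? v≟u ⟧ * x u ≈ incidence u e * x u - ⟦ v≟u ⟧ * x v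
        pointwise u (yes ≡.refl) = ≈-trans (solve 2 (λ i x → i :* num 0 :* x := num 1 :* x :- num 1 :* x) ≈-refl _ (x v))
          (+-congʳ (*-congʳ (≈-sym (⟦⟧-yes (v ∈? edge H e) v∈))))
        pointwise u (no _) = solve 3 (λ i x y → i :* num 1 :* x := i :* x :- num 0 :* y) ≈-refl _ (x u) (x v)

    -- The value of `g` at the parent edge, or 0 at the root; written as a sum, it is the second
    -- half of a sum over incident edges.
    aboveSum : (Edge H → Carrier) → Vertex H → Carrier
    aboveSum g v = ∑ (λ e → ⟦ parent v ≟ₘ just e ⟧ * g e)

    incidence-∑ : ∀ g v → ∑ (λ e → incidence v e * g e) ≈ apexSum g v + aboveSum g v
    incidence-∑ g v = ≈-trans
      (∑-cong (λ e → ≈-trans (*-congʳ (incidence-split v e)) (distribʳ _ _ _)))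
      (∑-+ (λ e → ⟦ apex e Fin.≟ v ⟧ * g e) (λ e → ⟦ parent v ≟ₘ just e ⟧ * g e))

    aboveSum-root : ∀ g {v} → parent v ≡ nothing → aboveSum g v ≈ 0#
    aboveSum-root g {v} p = ∑-0 (λ e → 0*-cong (g e) (⟦⟧-no (parent v ≟ₘ just e) (λ q → case (≡.trans (≡.sym p) q))))
      where
      case : ∀ {e : Edge H} → nothing ≢ just e
      case ()

    aboveSum-just : ∀ g {v e} → parent v ≡ just e → aboveSum g v ≈ g e
    aboveSum-just g {v} {e} p = ∑-unique (λ f → parent v ≟ₘ just f) g e p
      (λ f q → Maybe.just-injective (≡.trans (≡.sym q) p))

    neighbourSum-rooted : ∀ x v → neighbourSum x v ≈
      apexSum (λ e → edgeSum x e - x v) v + aboveSum (λ e → edgeSum x e - x v) v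
    neighbourSum-rooted x v = ≈-trans (neighbourSum-edges x v) (incidence-∑ (λ e → edgeSum x e - x v) v)

    adjacency-neighbourSum : ∀ m x v → (adjacencyMatrix ℝ m H · x) v ≈ recip (m ℕ.∸ 1) * neighbourSum x v
    adjacency-neighbourSum m x v = ≈-trans (≈-sym (∑≈sum (λ u → adjacencyMatrix ℝ m H v u * x u))) (≈-trans (∑-cong (λ u → pointwise u (adjacent? H v u)))
      (∑-*ˡ (recip (m ℕ.∸ 1)) (λ u → ⟦ adjacent? H v u ⟧ * x u)))
      where
      pointwise : ∀ u (a? : Dec (Adjacent H v u)) →
        (if does a? then recip (m ℕ.∸ 1) else 0#) * x u ≈ recip (m ℕ.∸ 1) * (⟦ a? ⟧ * x u)
      pointwise u (yes _) = solve 2 (λ ρ x → ρ :* x := ρ :* (num 1 :* x)) ≈-refl _ (x u)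
      pointwise u (no _)  = solve 2 (λ ρ x → num 0 :* x := ρ :* (num 0 :* x)) ≈-refl _ (x u)

  -- Comparison of the spectral radius with a positive vector

  module _ {H : Hypergraph} (R : Rooted H) where
    open Rooted R
    private
      V : Set
      V = Vertex H

      B : V → V → Carrier
      B v u = ⟦ adjacent? H v u ⟧

      B-sym : ∀ v u → B v u ≈ B u v
      B-sym v u = ⟦⟧-cong (adjacent? H v u) (adjacent? H u v) adjacent-sym adjacent-sym

      N : (V → Carrier) → V → Carrier
      N x v = ∑ (λ u → B v u * x u)

    neighbourSum-selfAdjoint : ∀ x y → ∑ (λ v → y v * N x v) ≈ ∑ (λ v → x v * N y v)
    neighbourSum-selfAdjoint x y = begin
      ∑ (λ v → y v * N x v)                   ≈⟨ ∑-cong (λ v → ≈-sym (∑-*ˡ (y v) (λ u → B v u * x u))) ⟩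
      ∑ (λ v → ∑ (λ u → y v * (B v u * x u))) ≈⟨ ∑-comm (λ v u → y v * (B v u * x u)) ⟩
      ∑ (λ u → ∑ (λ v → y v * (B v u * x u))) ≈⟨ ∑-cong (λ u → ∑-cong (λ v → ≈-trans
        (*-congˡ (*-congʳ (B-sym v u)))
        (solve 3 (λ y b x → y :* (b :* x) := x :* (b :* y)) ≈-refl (y v) (B u v) (x u)))) ⟩
      ∑ (λ u → ∑ (λ v → x u * (B u v * y v))) ≈⟨ ∑-cong (λ u → ∑-*ˡ (x u) (λ v → B u v * y v)) ⟩
      ∑ (λ u → x u * N y u) ∎
      where open ≈R

    module _ (x : V → Carrier) (κ : Carrier) (x>0 : ∀ v → 0# < x v)
             (sub : ∀ v → neighbourSum R x v ≤ κ * x v)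
             (v₀ : V) (strict : neighbourSum R x v₀ < κ * x v₀) where

      module _ (α ε : Carrier) (ε²≈1 : ε * ε ≈ 1#) (u : V → Carrier)
               (eigen : ∀ v → neighbourSum R u v ≈ α * u v) where
        private
          y w slack : V → Carrier
          y v = inv (x v) (x>0 v)
          w v = u v * y v
          slack v = κ * x v - N x v

          w*x : ∀ v → w v * x v ≈ u v
          w*x v = ≈-trans (solve 3 (λ u y x → u :* y :* x := u :* (x :* y)) ≈-refl (u v) (y v) (x v))
            (≈-trans (*-congˡ (inv-inverse (x v) (x>0 v))) (*-identityʳ _))

          vertexTerm : V → Carrier
          vertexTerm v = w v * w v * (x v * slack v)

          edgeTerm : V → V → Carrier
          edgeTerm i j = B i j * (x i * x j * ((w i - ε * w j) * (w i - ε * w j)))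

          -- With u = w x, the quantity 2 (κ - ε α) times the squared norm of u becomes a sum of
          -- nonnegative terms: the vertex terms carry the slack κ x - N x, and the edge terms the
          -- squares of w_i - ε w_j. The choices ε = 1 and ε = -1 bound the eigenvalue α from above
          -- and from below.
          energy : Carrier
          energy = (∑ vertexTerm + ∑ vertexTerm) + ∑ (λ i → ∑ (edgeTerm i))

          vertexTerm-nonneg : ∀ v → 0# ≤ vertexTerm v
          vertexTerm-nonneg v = *-nonneg (sq-nonneg _) (*-nonneg (<⇒≤ (x>0 v)) (≤⇒0≤- (sub v)))

          edgeTerm-nonneg : ∀ i j → 0# ≤ edgeTerm i j
          edgeTerm-nonneg i j = ⟦⟧*-nonneg (adjacent? H i j)
            (λ _ → *-nonneg (<⇒≤ (*-pos (x>0 i) (x>0 j))) (sq-nonneg _))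

          normSum : Carrier
          normSum = ∑ (λ v → u v * u v)

          edges-energy : ∑ (λ i → ∑ (edgeTerm i)) ≈
            (∑ (λ i → w i * w i * (x i * N x i)) + ∑ (λ i → w i * w i * (x i * N x i)))
              - lit 2 * ε * (α * normSum)
          edges-energy = begin
            ∑ (λ i → ∑ (edgeTerm i)) ≈⟨ ∑-cong (λ i → ∑-cong (λ j → expand i j)) ⟩
            ∑ (λ i → ∑ (λ j → P i j + Q i j - C i j)) ≈⟨ ∑-cong (λ i → ≈-trans (∑-− (λ j → P i j + Q i j) (C i)) (+-congʳ (∑-+ (P i) (Q i)))) ⟩
            ∑ (λ i → ∑ (P i) + ∑ (Q i) - ∑ (C i)) ≈⟨ ≈-trans (∑-− (λ i → ∑ (P i) + ∑ (Q i)) (λ i → ∑ (C i))) (+-congʳ (∑-+ (λ i → ∑ (P i)) (λ i → ∑ (Q i)))) ⟩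
            ∑ (λ i → ∑ (P i)) + ∑ (λ i → ∑ (Q i)) - ∑ (λ i → ∑ (C i))
              ≈⟨ +-cong (+-cong sumP sumQ) (-‿cong sumC) ⟩
            (∑ (λ i → w i * w i * (x i * N x i)) + ∑ (λ i → w i * w i * (x i * N x i)))
              - lit 2 * ε * (α * normSum) ∎
            where
            open ≈R
            P Q C : V → V → Carrier
            P i j = w i * w i * x i * (B i j * x j)
            Q i j = w j * w j * x j * (B j i * x i)
            C i j = lit 2 * ε * u i * (B i j * u j)
            expand : ∀ i j → edgeTerm i j ≈ P i j + Q i j - C i j
            expand i j = ≈-trans
              (solve 6 (λ b xi xj wi wj e →
                 b :* (xi :* xj :* ((wi :- e :* wj) :* (wi :- e :* wj))) :=
                 wi :* wi :* xi :* (b :* xj) :+ e :* e :* (wj :* wj :* xj :* (b :* xi))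
                   :- num 2 :* e :* (wi :* xi) :* (b :* (wj :* xj)))
                 ≈-refl (B i j) (x i) (x j) (w i) (w j) ε)
              (+-cong (+-congˡ (≈-trans (1*-cong _ ε²≈1) (*-congˡ (*-congʳ (B-sym i j)))))
                (-‿cong (*-cong (*-congˡ (w*x i)) (*-congˡ (w*x j)))))
            sumP : ∑ (λ i → ∑ (P i)) ≈ ∑ (λ i → w i * w i * (x i * N x i))
            sumP = ∑-cong (λ i → ≈-trans (∑-*ˡ (w i * w i * x i) (λ j → B i j * x j)) (*-assoc _ _ _))
            sumQ : ∑ (λ i → ∑ (Q i)) ≈ ∑ (λ i → w i * w i * (x i * N x i))
            sumQ = ≈-trans (∑-comm Q) sumP
            sumC : ∑ (λ i → ∑ (C i)) ≈ lit 2 * ε * (α * normSum)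
            sumC = ≈-trans (∑-cong (λ i → ≈-trans (∑-*ˡ (lit 2 * ε * u i) (λ j → B i j * u j))
                (≈-trans (*-congˡ (eigen i))
                  (solve 3 (λ t u a → t :* u :* (a :* u) := t :* a :* (u :* u)) ≈-refl (lit 2 * ε) (u i) α))))
              (≈-trans (∑-*ˡ (lit 2 * ε * α) (λ i → u i * u i)) (*-assoc _ _ _))

          vertices-energy : ∑ vertexTerm ≈ κ * normSum - ∑ (λ i → w i * w i * (x i * N x i))
          vertices-energy = begin
            ∑ vertexTerm ≈⟨ ∑-cong (λ i → solve 4 (λ w x k n → w :* w :* (x :* (k :* x :- n)) :=
                              k :* ((w :* x) :* (w :* x)) :- w :* w :* (x :* n)) ≈-refl (w i) (x i) κ (N x i)) ⟩
            ∑ (λ i → κ * (w i * x i * (w i * x i)) - w i * w i * (x i * N x i))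
              ≈⟨ ∑-− (λ i → κ * (w i * x i * (w i * x i))) (λ i → w i * w i * (x i * N x i)) ⟩
            ∑ (λ i → κ * (w i * x i * (w i * x i))) - ∑ (λ i → w i * w i * (x i * N x i))
              ≈⟨ +-congʳ (≈-trans (∑-cong (λ i → *-congˡ (*-cong (w*x i) (w*x i)))) (∑-*ˡ κ (λ i → u i * u i))) ⟩
            κ * normSum - ∑ (λ i → w i * w i * (x i * N x i)) ∎
            where open ≈R

          energy≈ : energy ≈ lit 2 * normSum * (κ - ε * α)
          energy≈ = ≈-trans (+-cong (+-cong vertices-energy vertices-energy) edges-energy)
            (solve 5 (λ k s p e a → (k :* s :- p) :+ (k :* s :- p) :+ ((p :+ p) :- num 2 :* e :* (a :* s))
                := num 2 :* s :* (k :- e :* a)) ≈-refl κ normSum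
              (∑ (λ i → w i * w i * (x i * N x i))) ε α)

          edge-pos : ∀ {i j} → Adjacent H i j → (w i - ε * w j) # 0# → 0# < energy
          edge-pos {i} {j} a p = +-nonneg-pos
            (+-nonneg (∑-nonneg vertexTerm-nonneg) (∑-nonneg vertexTerm-nonneg))
            (∑-pos (λ i → ∑-nonneg (edgeTerm-nonneg i)) i (∑-pos (edgeTerm-nonneg i) j
              (<-respʳ-≈ (≈-sym (1*-cong _ (⟦⟧-yes (adjacent? H i j) a)))
                (*-pos (*-pos (x>0 i) (x>0 j)) (#0⇒sq-pos p)))))

          vertex-pos : w v₀ # 0# → 0# < energy
          vertex-pos p = +-pos-nonneg (+-pos q q) (∑-nonneg (λ i → ∑-nonneg (edgeTerm-nonneg i)))
            where
            q : 0# < ∑ vertexTerm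
            q = ∑-pos vertexTerm-nonneg v₀ (*-pos (#0⇒sq-pos p) (*-pos (x>0 v₀) (<⇒0<- strict)))

          -- A nonzero `w i` is compared with `ε * w j`: either they are apart, and the edge term is
          -- positive, or `w j` is nonzero as well. Carried to `v₀`, where the slack is positive,
          -- this makes the energy positive without deciding where u vanishes.
          step : ∀ {i j} → Adjacent H i j → 0# < energy ⊎ w i # 0# → 0# < energy ⊎ w j # 0#
          step a (inj₁ p) = inj₁ p
          step {i} {j} a (inj₂ p) = [ inj₁ ∘ edge-pos a ∘ #⇒-#0
                                    , (λ q → inj₂ (#0-factor (w j) ε (#0-resp (*-comm _ _) q))) ]′
                                    (#-cotrans p (ε * w j))

        eigenvalue-< : (∃[ i ] u i # 0#) → ε * α < κ
        eigenvalue-< (i , ui#0) = 0<-⇒< (*-cancel-pos (lit 2 * normSum) (*-pos (lit-pos 1) normSum>0)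
          (<-respʳ-≈ energy≈ energy>0))
          where
          normSum>0 : 0# < normSum
          normSum>0 = ∑-pos (λ v → sq-nonneg (u v)) i (#0⇒sq-pos ui#0)
          wi#0 : w i # 0#
          wi#0 = #0-factor (w i) (x i) (#0-resp (≈-sym (w*x i)) ui#0)
          energy>0 : 0# < energy
          energy>0 = [ (λ p → p) , vertex-pos ]′
            (propagate (λ v → 0# < energy ⊎ w v # 0#) step i v₀ (inj₂ wi#0))

      module _ (m : ℕ) (r : ℕ) (m∸1≡suc-r : m ℕ.∸ 1 ≡ suc r) where
        private
          ρ : Carrier
          ρ = recip (m ℕ.∸ 1)

          r# : Carrier
          r# = fromℕ# (suc r)

          r#*ρ : r# * ρ ≈ 1#
          r#*ρ = ≈-trans (*-congˡ (≈-reflexive (≡.cong recip m∸1≡suc-r))) (recip-inverse r)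

          A : Matrix (order H)
          A = adjacencyMatrix ℝ m H

          A≈ : ∀ u v → (A · u) v ≈ ρ * neighbourSum R u v
          A≈ = adjacency-neighbourSum R m

          realPart-< : ∀ a (u : V → Carrier) → (∀ v → (A · u) v ≈ a * u v) → (∃[ i ] u i # 0#) →
            (a < ρ * κ) × (- a < ρ * κ)
          realPart-< a u eq ∃#0 =
            scale (*-identityˡ _) (eigenvalue-< (r# * a) 1# (*-identityˡ 1#) u eigen ∃#0) ,
            scale (solve 2 (λ r a → :- num 1 :* (r :* a) := r :* :- a) ≈-refl r# a)
              (eigenvalue-< (r# * a) (- 1#) (solve 0 (:- num 1 :* :- num 1 := num 1) ≈-refl) u eigen ∃#0)
            where
            eigen : ∀ v → neighbourSum R u v ≈ r# * a * u v
            eigen v = begin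
              neighbourSum R u v                ≈⟨ 1*-cong _ r#*ρ ⟨
              r# * ρ * neighbourSum R u v       ≈⟨ *-assoc _ _ _ ⟩
              r# * (ρ * neighbourSum R u v)     ≈⟨ *-congˡ (≈-trans (≈-sym (A≈ u v)) (eq v)) ⟩
              r# * (a * u v)                    ≈⟨ *-assoc _ _ _ ⟨
              r# * a * u v                      ∎
              where open ≈R
            scale : ∀ {b c} → c ≈ r# * b → c < κ → b < ρ * κ
            scale {b} {c} c≈ c<κ = *-cancelˡ-< (fromℕ#-pos r) (<-resp c≈
              (≈-sym (≈-trans (≈-sym (*-assoc _ _ _)) (1*-cong κ r#*ρ))) c<κ)

          module _ (a b : Carrier) (u w : V → Carrier)
                   (equ : ∀ i → (A · u) i ≈ a * u i - b * w i)
                   (eqw : ∀ i → (A · w) i ≈ a * w i + b * u i)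
                   (∃#0 : ∃[ i ] (u i # 0# ⊎ w i # 0#)) where
            norm : Carrier
            norm = ∑ (λ i → u i * u i) + ∑ (λ i → w i * w i)

            norm>0 : 0# < norm
            norm>0 = helper ∃#0
              where
              helper : (∃[ i ] (u i # 0# ⊎ w i # 0#)) → 0# < norm
              helper (i , inj₁ p) = +-pos-nonneg (∑-pos (λ i → sq-nonneg (u i)) i (#0⇒sq-pos p)) (∑-nonneg (λ i → sq-nonneg (w i)))
              helper (i , inj₂ p) = +-nonneg-pos (∑-nonneg (λ i → sq-nonneg (u i))) (∑-pos (λ i → sq-nonneg (w i)) i (#0⇒sq-pos p))

            pairing : ∀ (x y : V → Carrier) → ∑ (λ i → y i * (A · x) i) ≈ ρ * ∑ (λ i → y i * N x i)
            pairing x y = ≈-trans (∑-cong (λ i → ≈-trans (*-congˡ (A≈ x i))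
              (solve 3 (λ y r n → y :* (r :* n) := r :* (y :* n)) ≈-refl (y i) ρ (N x i)))) (∑-*ˡ ρ (λ i → y i * N x i))

            -- Pairing the image of the imaginary part with the real part and conversely gives equal
            -- numbers, as the matrix is symmetric; their difference is `b` times the norm. Hence
            -- eigenvalues are real.
            b*norm≈0 : b * norm ≈ 0#
            b*norm≈0 = begin
              b * norm
                ≈⟨ ≈-trans (distribˡ _ _ _) (+-cong (≈-sym (∑-*ˡ b (λ i → u i * u i))) (≈-sym (∑-*ˡ b (λ i → w i * w i)))) ⟩
              ∑ (λ i → b * (u i * u i)) + ∑ (λ i → b * (w i * w i))
                ≈⟨ ∑-+ (λ i → b * (u i * u i)) (λ i → b * (w i * w i)) ⟨
              ∑ (λ i → b * (u i * u i) + b * (w i * w i))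
                ≈⟨ ∑-cong (λ i → ≈-trans (solve 4 (λ a b u w → b :* (u :* u) :+ b :* (w :* w)
                     := u :* (a :* w :+ b :* u) :- w :* (a :* u :- b :* w)) ≈-refl a b (u i) (w i))
                     (+-cong (*-congˡ (≈-sym (eqw i))) (-‿cong (*-congˡ (≈-sym (equ i)))))) ⟩
              ∑ (λ i → u i * (A · w) i - w i * (A · u) i)
                ≈⟨ ∑-− (λ i → u i * (A · w) i) (λ i → w i * (A · u) i) ⟩
              ∑ (λ i → u i * (A · w) i) - ∑ (λ i → w i * (A · u) i)
                ≈⟨ +-cong (pairing w u) (-‿cong (pairing u w)) ⟩
              ρ * ∑ (λ i → u i * N w i) - ρ * ∑ (λ i → w i * N u i)
                ≈⟨ +-congʳ (*-congˡ (neighbourSum-selfAdjoint w u)) ⟩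
              ρ * ∑ (λ i → w i * N u i) - ρ * ∑ (λ i → w i * N u i)
                ≈⟨ -‿inverseʳ _ ⟩
              0# ∎
              where open ≈R

            b≈0 : b ≈ 0#
            b≈0 = begin
              b                                 ≈⟨ *-identityʳ b ⟨
              b * 1#                            ≈⟨ *-congˡ (inv-inverse norm norm>0) ⟨
              b * (norm * inv norm norm>0)      ≈⟨ *-assoc _ _ _ ⟨
              b * norm * inv norm norm>0        ≈⟨ 0*-cong _ b*norm≈0 ⟩
              0#                                ∎
              where open ≈R

            modulus-< : (a < ρ * κ) × (- a < ρ * κ)
            modulus-< = helper ∃#0
              where
              helper : (∃[ i ] (u i # 0# ⊎ w i # 0#)) → (a < ρ * κ) × (- a < ρ * κ)
              helper (i , inj₁ p) = realPart-< a u (λ v → ≈-trans (equ v) (≈-trans (+-congˡ (-‿cong (0*-cong (w v) b≈0)))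
                    (solve 1 (λ x → x :- num 0 := x) ≈-refl _))) (i , p)
              helper (i , inj₂ p) = realPart-< a w (λ v → ≈-trans (eqw v) (≈-trans (+-congˡ (0*-cong (u v) b≈0))
                    (+-identityʳ _))) (i , p)

        -- The eigenvalue attaining `lam` is a real number a with both a and -a below `ρ * κ`, so
        -- its square is below that of `ρ * κ`. Here `ρ` is 1 / r, not r.
        spectralRadius-< : ∀ lam → IsLambda₁ ℝ m H lam → lam < ρ * κ
        spectralRadius-< lam (0≤lam , ((a , b) , (u , w , ∃#0 , eqs) , normSq≈) , _) =
          sq-cancel-< 0≤lam ρκ>0 (<-respˡ-≈ (≈-trans a²≈ normSq≈) (<-by _ (*-pos (<⇒0<- a<) (<⇒0<- -a<))
            (solve 2 (λ k a → k :* k :- a :* a := (k :- a) :* (k :- :- a)) ≈-refl (ρ * κ) a)))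
          where
          equ : ∀ i → (A · u) i ≈ a * u i - b * w i
          equ = proj₁ ∘ eqs
          eqw : ∀ i → (A · w) i ≈ a * w i + b * u i
          eqw = proj₂ ∘ eqs
          a< : a < ρ * κ
          a< = proj₁ (modulus-< a b u w equ eqw ∃#0)
          -a< : - a < ρ * κ
          -a< = proj₂ (modulus-< a b u w equ eqw ∃#0)
          a²≈ : a * a ≈ normSq (a , b)
          a²≈ = ≈-trans (solve 1 (λ a → a :* a := a :* a :+ num 0 :* num 0) ≈-refl a)
            (+-congˡ (*-cong (≈-sym b≈) (≈-sym b≈)))
            where
            b≈ : b ≈ 0#
            b≈ = b≈0 a b u w equ eqw ∃#0
          ρκ>0 : 0# < ρ * κ
          ρκ>0 = *-cancel-pos (lit 2) (lit-pos 1) (<-respʳ-≈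
            (solve 2 (λ k a → (k :- a) :+ (k :- :- a) := num 2 :* k) ≈-refl (ρ * κ) a)
            (+-pos (<⇒0<- a<) (<⇒0<- -a<)))

  -- Test vectors given by ratios on a rooted hypergraph

  bounded : ∀ {n} (f : Fin n → ℕ) → ∃[ b ] ∀ i → f i ℕ.< b
  bounded {zero}  f = 0 , λ ()
  bounded {suc n} f with bounded (f ∘ suc)
  ... | b , f<b = suc (f zero) ℕ.⊔ b , λ
    { zero → ℕ.m≤m⊔n (suc (f zero)) b ; (suc i) → ℕ.≤-trans (f<b i) (ℕ.m≤n⊔m (suc (f zero)) b) }

  module _ {H : Hypergraph} (R : Rooted H) where
    open Rooted R

    childSum-cong : ∀ {f g} e → (∀ v → parent v ≡ just e → f v ≈ g v) → childSum R f e ≈ childSum R g e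
    childSum-cong e p = ∑-cong (λ v → ⟦⟧*-cong (_≟ₘ_ R (parent v) (just e)) (p v))

    apexSum-cong : ∀ {f g} v → (∀ e → apex e ≡ v → f e ≈ g e) → apexSum R f v ≈ apexSum R g v
    apexSum-cong v p = ∑-cong (λ e → ⟦⟧*-cong (apex e Fin.≟ v) (p e))

    apexSum-mono : ∀ {f g} v → (∀ e → apex e ≡ v → f e ≤ g e) → apexSum R f v ≤ apexSum R g v
    apexSum-mono v p = ∑-mono-≤ (λ e → ⟦⟧*-mono (apex e Fin.≟ v) (p e))

    childSum-nonneg : ∀ {f} e → (∀ v → parent v ≡ just e → 0# ≤ f v) → 0# ≤ childSum R f e
    childSum-nonneg e p = ∑-nonneg (λ v → ⟦⟧*-nonneg (_≟ₘ_ R (parent v) (just e)) (p v))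

    apexSum-nonneg : ∀ {f} v → (∀ e → apex e ≡ v → 0# ≤ f e) → 0# ≤ apexSum R f v
    apexSum-nonneg v p = ∑-nonneg (λ e → ⟦⟧*-nonneg (apex e Fin.≟ v) (p e))

    childSum-+ : ∀ f g e → childSum R (λ v → f v + g v) e ≈ childSum R f e + childSum R g e
    childSum-+ f g e = ≈-trans (∑-cong (λ v → distribˡ _ _ _))
      (∑-+ (λ v → ⟦ _≟ₘ_ R (parent v) (just e) ⟧ * f v) (λ v → ⟦ _≟ₘ_ R (parent v) (just e) ⟧ * g v))

    apexSum-+ : ∀ f g v → apexSum R (λ e → f e + g e) v ≈ apexSum R f v + apexSum R g v
    apexSum-+ f g v = ≈-trans (∑-cong (λ e → distribˡ _ _ _))
      (∑-+ (λ e → ⟦ apex e Fin.≟ v ⟧ * f e) (λ e → ⟦ apex e Fin.≟ v ⟧ * g e))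

    childSum-* : ∀ a f e → childSum R (λ v → f v * a) e ≈ childSum R f e * a
    childSum-* a f e = ≈-trans (∑-cong (λ v → ≈-sym (*-assoc _ _ _)))
      (∑-*ʳ a (λ v → ⟦ _≟ₘ_ R (parent v) (just e) ⟧ * f v))

    apexSum-* : ∀ a f v → apexSum R (λ e → f e * a) v ≈ apexSum R f v * a
    apexSum-* a f v = ≈-trans (∑-cong (λ e → ≈-sym (*-assoc _ _ _)))
      (∑-*ʳ a (λ e → ⟦ apex e Fin.≟ v ⟧ * f e))

    module _ (t : Vertex H → Carrier) where
      private
        productAt : ℕ → Vertex H → Maybe (Edge H) → Carrier
        productAt n       v nothing  = 1#
        productAt zero    v (just e) = 1#
        productAt (suc n) v (just e) = t v * productAt n (apex e) (parent (apex e))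

        stable : ∀ n n′ v e → parent v ≡ e → depth v ℕ.≤ n → depth v ℕ.≤ n′ →
          productAt n v e ≡ productAt n′ v e
        stable n n′ v nothing p _ _ = ≡.refl
        stable zero n′ v (just e) p v≤ _ = ⊥-elim (ℕ.n≮0 (ℕ.<-≤-trans (apex-depth p) v≤))
        stable (suc n) zero v (just e) p _ v≤ = ⊥-elim (ℕ.n≮0 (ℕ.<-≤-trans (apex-depth p) v≤))
        stable (suc n) (suc n′) v (just e) p v≤ v≤′ = ≡.cong (t v *_)
          (stable n n′ (apex e) (parent (apex e)) ≡.refl (ℕ.s≤s⁻¹ (ℕ.<-≤-trans (apex-depth p) v≤))
            (ℕ.s≤s⁻¹ (ℕ.<-≤-trans (apex-depth p) v≤′)))

      -- The vector with value 1 at the root whose ratio between a vertex and the apex of its parent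
      -- edge is `t`.
      pathProduct : Vertex H → Carrier
      pathProduct v = productAt (depth v) v (parent v)

      pathProduct-just : ∀ {v e} → parent v ≡ just e → pathProduct v ≡ t v * pathProduct (apex e)
      pathProduct-just {v} {e} p = ≡.trans (≡.cong (productAt (depth v) v) p)
        (≡.trans (stable (depth v) (suc (depth v)) v (just e) p ℕ.≤-refl (ℕ.n≤1+n _))
          (≡.cong (t v *_) (stable (depth v) (depth (apex e)) (apex e) (parent (apex e)) ≡.refl
            (ℕ.<⇒≤ (apex-depth p)) ℕ.≤-refl)))

      pathProduct-pos : (∀ v → 0# < t v) → ∀ v → 0# < pathProduct v
      pathProduct-pos t>0 v = go (depth v) v (parent v)
        where
        go : ∀ n v e → 0# < productAt n v e
        go n       v nothing  = 0<1
        go zero    v (just e) = 0<1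
        go (suc n) v (just e) = *-pos (t>0 v) (go n (apex e) (parent (apex e)))

      module _ (t>0 : ∀ v → 0# < t v) (κ : Carrier)
               (ratio : ∀ {v e} → parent v ≡ just e →
                 1# + childSum R t e ≤ t v * (κ + 1# - apexSum R (childSum R t) v))
               (ratio-root : apexSum R (childSum R t) root < κ) where
        private
          x : Vertex H → Carrier
          x = pathProduct

          σ : Edge H → Carrier
          σ = childSum R t

          edgeSum-product : ∀ e → edgeSum R x e ≈ x (apex e) + σ e * x (apex e)
          edgeSum-product e = ≈-trans (edgeSum-split R x e) (+-congˡ (≈-trans
            (childSum-cong e (λ v p → ≈-reflexive (pathProduct-just p))) (childSum-* (x (apex e)) t e)))

          belowSum : ∀ v → apexSum R (λ e → edgeSum R x e - x v) v ≈ apexSum R σ v * x v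
          belowSum v = ≈-trans (apexSum-cong v below) (apexSum-* (x v) σ v)
            where
            below : ∀ e → apex e ≡ v → edgeSum R x e - x v ≈ σ e * x v
            below e ≡.refl = ≈-trans (+-congʳ (edgeSum-product e))
              (solve 2 (λ x y → x :+ y :- x := y) ≈-refl (x v) (σ e * x v))

        -- Let `v` have parent edge e with apex a, let σ be the sum of the ratios in e, and τ the
        -- sum of all ratios two levels below the edges at v. The neighbours below v contribute τ
        -- x_v and those in e contribute x_a + σ x_a - x_v. Division by x_a turns N x ≤ κ x into 1 +
        -- σ ≤ t (κ + 1 - τ); at the root only τ < κ remains.
        ratio-test : ∀ m r → m ℕ.∸ 1 ≡ suc r → ∀ lam → IsLambda₁ ℝ m H lam → lam < recip (m ℕ.∸ 1) * κ
        ratio-test = spectralRadius-< R x κ (pathProduct-pos t>0) (λ v → sub v (parent v) ≡.refl) root strict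
          where
          sub : ∀ v e → parent v ≡ e → neighbourSum R x v ≤ κ * x v
          root-value : ∀ {v} → parent v ≡ nothing → neighbourSum R x v ≈ apexSum R σ v * x v
          root-value {v} p = ≈-trans (neighbourSum-rooted R x v) (≈-trans
            (+-cong (belowSum v) (aboveSum-root R (λ e → edgeSum R x e - x v) p)) (+-identityʳ _))
          strict : neighbourSum R x root < κ * x root
          strict = <-resp (≈-sym (≈-trans (root-value parent-root) (*-comm _ _))) (*-comm _ _)
            (*-monoˡ-< (pathProduct-pos t>0 root) ratio-root)
          sub v nothing p = ≡.subst (λ v → neighbourSum R x v ≤ κ * x v) (≡.sym (parent≡nothing p)) (<⇒≤ strict)
          sub v (just e) p = ≤-by (x (apex e) * (t v * (κ + 1# - apexSum R σ v) - (1# + σ e)))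
            (*-nonneg (<⇒≤ (pathProduct-pos t>0 (apex e))) (≤⇒0≤- (ratio p)))
            (≈-trans (+-cong (*-congˡ (≈-reflexive (pathProduct-just p))) (-‿cong value))
              (solve 5 (λ k t a s τ →
                k :* (t :* a) :- (τ :* (t :* a) :+ (a :+ s :* a :- t :* a))
                  := a :* (t :* (k :+ num 1 :- τ) :- (num 1 :+ s)))
                ≈-refl κ (t v) (x (apex e)) (σ e) (apexSum R σ v)))
            where
            value : neighbourSum R x v ≈ apexSum R σ v * (t v * x (apex e)) +
              (x (apex e) + σ e * x (apex e) - t v * x (apex e))
            value = ≈-trans (neighbourSum-rooted R x v) (+-cong
              (≈-trans (belowSum v) (*-congˡ (≈-reflexive (pathProduct-just p))))
              (≈-trans (aboveSum-just R (λ e → edgeSum R x e - x v) p)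
                (+-cong (edgeSum-product e) (-‿cong (≈-reflexive (pathProduct-just p))))))

  -- Bounds by the degree of a root

  card-∑ : ∀ {n} (p : Subset n) → fromℕ# ∣ p ∣ ≈ ∑ (λ i → ⟦ i ∈? p ⟧)
  card-∑ []          = ≈-sym (∑-zero _)
  card-∑ (true ∷ p)  = ≈-sym (≈-trans (∑-suc (λ i → ⟦ i ∈? true ∷ p ⟧)) (+-congˡ (≈-sym (card-∑ p))))
  card-∑ (false ∷ p) = ≈-sym (≈-trans (∑-suc (λ i → ⟦ i ∈? false ∷ p ⟧)) (≈-trans (+-identityˡ _) (≈-sym (card-∑ p))))

  degree-∑ : ∀ H v → fromℕ# (degree H v) ≈ ∑ (λ e → ⟦ v ∈? edge H e ⟧)
  degree-∑ H v = ≈-trans (card-∑ (Vec.tabulate star)) (∑-cong (λ e → ⟦⟧-cong (e ∈? Vec.tabulate star) (v ∈? edge H e)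
      (λ p → lookup⇒[]= v _ (≡.trans (≡.sym (lookup∘tabulate star e)) ([]=⇒lookup p)))
      (λ p → lookup⇒[]= e _ (≡.trans (lookup∘tabulate star e) ([]=⇒lookup p)))))
    where
    star = λ e → Vec.lookup (edge H e) v

  module _ {H : Hypergraph} (R : Rooted H) where
    open Rooted R

    childDegree : Vertex H → Carrier
    childDegree = apexSum R (λ _ → 1#)

    degree-root : fromℕ# (degree H root) ≈ childDegree root
    degree-root = begin
      fromℕ# (degree H root)               ≈⟨ degree-∑ H root ⟩
      ∑ (λ e → incidence R root e)         ≈⟨ ∑-cong (λ e → *-identityʳ _) ⟨
      ∑ (λ e → incidence R root e * 1#)    ≈⟨ incidence-∑ R (λ _ → 1#) root ⟩
      childDegree root + aboveSum R (λ _ → 1#) root ≈⟨ +-congˡ (aboveSum-root R (λ _ → 1#) parent-root) ⟩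
      childDegree root + 0#                ≈⟨ +-identityʳ _ ⟩
      childDegree root ∎
      where open ≈R

    degree-child : ∀ {v e} → parent v ≡ just e → fromℕ# (degree H v) ≈ childDegree v + 1#
    degree-child {v} p = begin
      fromℕ# (degree H v)               ≈⟨ degree-∑ H v ⟩
      ∑ (λ e → incidence R v e)         ≈⟨ ∑-cong (λ e → *-identityʳ _) ⟨
      ∑ (λ e → incidence R v e * 1#)    ≈⟨ incidence-∑ R (λ _ → 1#) v ⟩
      childDegree v + aboveSum R (λ _ → 1#) v ≈⟨ +-congˡ (aboveSum-just R (λ _ → 1#) p) ⟩
      childDegree v + 1# ∎
      where open ≈R

    childCount : ∀ {r} → Uniform (suc r) H → ∀ e → childSum R (λ _ → 1#) e ≈ fromℕ# r
    childCount {r} uniform e = begin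
      childSum R (λ _ → 1#) e            ≈⟨ solve 1 (λ x → x := num 1 :+ x :- num 1) ≈-refl _ ⟩
      1# + childSum R (λ _ → 1#) e - 1#  ≈⟨ +-congʳ (edgeSum-split R (λ _ → 1#) e) ⟨
      edgeSum R (λ _ → 1#) e - 1#        ≈⟨ +-congʳ (∑-cong (λ v → *-identityʳ _)) ⟩
      ∑ (λ v → ⟦ v ∈? edge H e ⟧) - 1#   ≈⟨ +-congʳ (card-∑ (edge H e)) ⟨
      fromℕ# ∣ edge H e ∣ - 1#           ≡⟨ ≡.cong (λ k → fromℕ# k - 1#) (uniform e) ⟩
      1# + fromℕ# r - 1#                 ≈⟨ solve 1 (λ x → num 1 :+ x :- num 1 := x) ≈-refl _ ⟩
      fromℕ# r                           ∎
      where open ≈R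

    private
      branchAt : ℕ → Vertex H → Carrier
      branchAt zero    v = 0#
      branchAt (suc n) v = apexSum R (λ e → 1# + childSum R (branchAt n) e) v

      branchAt-nonneg : ∀ n v → 0# ≤ branchAt n v
      branchAt-nonneg zero    v = ≤-refl
      branchAt-nonneg (suc n) v = apexSum-nonneg R v (λ e _ →
        +-nonneg (<⇒≤ 0<1) (childSum-nonneg R e (λ u _ → branchAt-nonneg n u)))

      branchAt-stable : ∀ b → (∀ v → depth v ℕ.< b) → ∀ n v → b ℕ.≤ depth v ℕ.+ n →
        branchAt n v ≈ branchAt (suc n) v
      branchAt-stable b bound zero v b≤ =
        ⊥-elim (ℕ.<⇒≱ (bound v) (≡.subst (b ℕ.≤_) (ℕ.+-identityʳ _) b≤))
      branchAt-stable b bound (suc n) v b≤ = apexSum-cong R v (λ { e ≡.refl → +-congˡ (childSum-cong R e (λ u p →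
        branchAt-stable b bound n u (ℕ.≤-trans b≤ (≡.subst (ℕ._≤ depth u ℕ.+ n)
          (≡.sym (ℕ.+-suc (depth v) n)) (ℕ.+-monoˡ-≤ n (apex-depth p)))))) })

    opaque
      -- The number of edges below a vertex.
      branch : Vertex H → Carrier
      branch = branchAt (proj₁ (bounded depth))

      branch-nonneg : ∀ v → 0# ≤ branch v
      branch-nonneg = branchAt-nonneg (proj₁ (bounded depth))

      branch-eq : ∀ v → branch v ≈ apexSum R (λ e → 1# + childSum R branch e) v
      branch-eq v = branchAt-stable _ (proj₂ (bounded depth)) _ v (ℕ.m≤n+m _ (depth v))

    -- Summing branch-eq over all vertices counts every edge once, and every
    -- vertex but the root once.
    branch-root : branch root ≈ fromℕ# (size H)
    branch-root = begin
      branch root ≈⟨ solve 2 (λ b k → b := (k :+ b) :- k) ≈-refl (branch root) total ⟩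
      (total + branch root) - total ≈⟨ +-congʳ (+-congʳ total≈) ⟩
      (fromℕ# (size H) + (total - branch root)) + branch root - total
        ≈⟨ solve 3 (λ k t b → k :+ (t :- b) :+ b :- t := k) ≈-refl (fromℕ# (size H)) total (branch root) ⟩
      fromℕ# (size H) ∎
      where
      open ≈R
      total : Carrier
      total = ∑ branch
      below : Edge H → Carrier
      below e = 1# + childSum R branch e
      parents : ∀ v p → parent v ≡ p → ∑ (λ e → ⟦ _≟ₘ_ R (parent v) (just e) ⟧ * branch v) ≈
        branch v - ⟦ root Fin.≟ v ⟧ * branch v
      parents v nothing p = ≈-trans (aboveSum-root R (λ _ → branch v) p)
        (≈-sym (≈-trans (+-congˡ (-‿cong (1*-cong _ (⟦⟧-yes (root Fin.≟ v) (≡.sym (parent≡nothing p)))))) (-‿inverseʳ _)))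
      parents v (just e) p = ≈-trans (aboveSum-just R (λ _ → branch v) p)
        (≈-sym (≈-trans (+-congˡ (-‿cong (0*-cong _ (⟦⟧-no (root Fin.≟ v) root≢v)))) (x-0≈x _)))
        where
        root≢v : root ≢ v
        root≢v ≡.refl with () ← ≡.trans (≡.sym parent-root) p
      total≈ : total ≈ fromℕ# (size H) + (total - branch root)
      total≈ = begin
        total ≈⟨ ∑-cong branch-eq ⟩
        ∑ (λ v → ∑ (λ e → ⟦ apex e Fin.≟ v ⟧ * below e)) ≈⟨ ∑-comm (λ v e → ⟦ apex e Fin.≟ v ⟧ * below e) ⟩
        ∑ (λ e → ∑ (λ v → ⟦ apex e Fin.≟ v ⟧ * below e))
          ≈⟨ ∑-cong (λ e → ∑-unique (apex e Fin.≟_) (λ _ → below e) (apex e) ≡.refl (λ _ → ≡.sym)) ⟩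
        ∑ below ≈⟨ ∑-+ (λ _ → 1#) (childSum R branch) ⟩
        ∑ (λ _ → 1#) + ∑ (childSum R branch) ≈⟨ +-cong (≈-trans (∑-const (size H) 1#) (*-identityʳ _))
          (∑-comm (λ e v → ⟦ _≟ₘ_ R (parent v) (just e) ⟧ * branch v)) ⟩
        fromℕ# (size H) + ∑ (λ v → ∑ (λ e → ⟦ _≟ₘ_ R (parent v) (just e) ⟧ * branch v))
          ≈⟨ +-congˡ (∑-cong (λ v → parents v (parent v) ≡.refl)) ⟩
        fromℕ# (size H) + ∑ (λ v → branch v - ⟦ root Fin.≟ v ⟧ * branch v)
          ≈⟨ +-congˡ (∑-− branch (λ v → ⟦ root Fin.≟ v ⟧ * branch v)) ⟩
        fromℕ# (size H) + (total - ∑ (λ v → ⟦ root Fin.≟ v ⟧ * branch v))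
          ≈⟨ +-congˡ (+-congˡ (-‿cong (∑-unique (root Fin.≟_) branch root ≡.refl (λ _ → ≡.sym)))) ⟩
        fromℕ# (size H) + (total - branch root) ∎

    edgeBranch : Edge H → Carrier
    edgeBranch = childSum R branch

    edgeBranch-nonneg : ∀ e → 0# ≤ edgeBranch e
    edgeBranch-nonneg e = childSum-nonneg R e (λ v _ → branch-nonneg v)

    -- By `size-split` this is the number of edges that do not contain the root.
    outer : Carrier
    outer = apexSum R edgeBranch root

    size-split : childDegree root + outer ≈ fromℕ# (size H)
    size-split = ≈-trans (≈-sym (apexSum-+ R (λ _ → 1#) edgeBranch root)) (≈-trans (≈-sym (branch-eq root)) branch-root)

    edgeBranch≤apex : ∀ e → edgeBranch e ≤ branch (apex e)
    edgeBranch≤apex e = ≤-resp ≈-refl (≈-sym (branch-eq (apex e))) (≤-trans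
      (≤-by 1# (<⇒≤ 0<1) (solve 1 (λ x → num 1 :+ x :- x := num 1) ≈-refl (edgeBranch e)))
      (≤-resp (1*-cong _ (⟦⟧-yes (apex e Fin.≟ apex e) ≡.refl)) ≈-refl
        (term≤∑ (λ f → ⟦⟧*-nonneg (apex f Fin.≟ apex e) (λ _ → +-nonneg (<⇒≤ 0<1) (edgeBranch-nonneg f))) e)))

    branch≤edgeBranch : ∀ {v e} → parent v ≡ just e → branch v ≤ edgeBranch e
    branch≤edgeBranch {v} {e} p = ≤-resp (1*-cong _ (⟦⟧-yes (_≟ₘ_ R (parent v) (just e)) p)) ≈-refl
      (term≤∑ (λ u → ⟦⟧*-nonneg (_≟ₘ_ R (parent u) (just e)) (λ _ → branch-nonneg u)) v)

    -- On the way up, all edges beyond `e` are among those beyond the edge above it, until an edge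
    -- at the root is reached.
    edgeBranch≤outer : ∀ n e → depth (apex e) ℕ.≤ n → ∀ p → parent (apex e) ≡ p → edgeBranch e ≤ outer
    edgeBranch≤outer n e _ nothing p = ≤-resp (1*-cong _ (⟦⟧-yes (apex e Fin.≟ root) (parent≡nothing p))) ≈-refl
      (term≤∑ (λ f → ⟦⟧*-nonneg (apex f Fin.≟ root) (λ _ → edgeBranch-nonneg f)) e)
    edgeBranch≤outer zero e e≤ (just f) p = ⊥-elim (ℕ.n≮0 (ℕ.<-≤-trans (apex-depth p) e≤))
    edgeBranch≤outer (suc n) e e≤ (just f) p = ≤-trans (edgeBranch≤apex e) (≤-trans (branch≤edgeBranch p)
      (edgeBranch≤outer n f (ℕ.s≤s⁻¹ (ℕ.<-≤-trans (apex-depth p) e≤)) (parent (apex f)) ≡.refl))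

    edgeBranch-≤ : ∀ e → edgeBranch e ≤ outer
    edgeBranch-≤ e = edgeBranch≤outer _ e ℕ.≤-refl _ ≡.refl

  module _ {H : Hypergraph} (R : Rooted H) (r′ : ℕ) (uniform : Uniform (suc (suc r′)) H)
           (z : Carrier) (0<z : 0# < z) where
    open Rooted R
    private
      r κ iz : Carrier
      r = fromℕ# (suc r′)
      κ = z + r - 1#
      iz = inv z 0<z

      r>0 : 0# < r
      r>0 = fromℕ#-pos r′

      iz>0 : 0# < iz
      iz>0 = inv-pos z 0<z

    module _ (q : Carrier)
             (degrees : ∀ {v e} → parent v ≡ just e → childDegree R v ≤ q)
             (4qr≤z² : lit 4 * q * r ≤ z * z)
             (root-degree : lit 2 * r * childDegree R root < z * κ) where
      private
        t : Carrier
        t = lit 2 * iz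

        σ : ∀ e → childSum R (λ _ → t) e ≈ r * t
        σ e = ≈-trans (childSum-cong R e (λ _ _ → ≈-sym (*-identityˡ t)))
          (≈-trans (childSum-* R t (λ _ → 1#) e) (*-congʳ (childCount R uniform e)))

        τ : ∀ v → apexSum R (childSum R (λ _ → t)) v ≈ childDegree R v * (r * t)
        τ v = ≈-trans (apexSum-cong R v (λ e _ → ≈-trans (σ e) (≈-sym (*-identityˡ _)))) (apexSum-* R (r * t) (λ _ → 1#) v)

      -- As κ + 1 = z + r, a constant ratio t has to satisfy q r t² ≤ z t - 1. The quotient (z t -
      -- 1) / t² is largest at t = 2 / z, where the condition reads 4 q r ≤ z².
      lowDegree-bound : ∀ lam → IsLambda₁ ℝ (suc (suc r′)) H lam → lam < recip (suc r′) * κ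
      lowDegree-bound = ratio-test R (λ _ → t) (λ _ → *-pos (lit-pos 1) iz>0) κ ratio ratio-root (suc (suc r′)) r′ ≡.refl
        where
        ratio : ∀ {v e} → parent v ≡ just e →
          1# + childSum R (λ _ → t) e ≤ t * (κ + 1# - apexSum R (childSum R (λ _ → t)) v)
        ratio {v} {e} p = ≤-by (iz * iz * (z * z - lit 4 * q * r) + lit 4 * iz * iz * r * (q - childDegree R v))
          (+-nonneg (*-nonneg (sq-nonneg iz) (≤⇒0≤- 4qr≤z²))
            (*-nonneg (*-nonneg (*-nonneg (*-nonneg (lit-nonneg 4) (<⇒≤ iz>0)) (<⇒≤ iz>0)) (<⇒≤ r>0)) (≤⇒0≤- (degrees p))))
          (begin
            t * (κ + 1# - apexSum R (childSum R (λ _ → t)) v) - (1# + childSum R (λ _ → t) e)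
              ≈⟨ +-cong (*-congˡ (+-congˡ (-‿cong (τ v)))) (-‿cong (+-congˡ (σ e))) ⟩
            t * (κ + 1# - childDegree R v * (r * t)) - (1# + r * t)
              ≈⟨ solve 4 (λ i z r δ →
                   num 2 :* i :* (z :+ r :- num 1 :+ num 1 :- δ :* (r :* (num 2 :* i)))
                     :- (num 1 :+ r :* (num 2 :* i))
                   := num 2 :* (z :* i) :- num 1 :- num 4 :* i :* i :* r :* δ)
                 ≈-refl iz z r (childDegree R v) ⟩
            lit 2 * (z * iz) - 1# - lit 4 * iz * iz * r * childDegree R v
              ≈⟨ +-congʳ (+-congʳ (*-congˡ (inv-inverse z 0<z))) ⟩
            lit 2 * 1# - 1# - lit 4 * iz * iz * r * childDegree R v
              ≈⟨ solve 3 (λ i r δ → num 2 :* num 1 :- num 1 :- num 4 :* i :* i :* r :* δ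
                   := num 1 :* num 1 :- num 4 :* i :* i :* r :* δ) ≈-refl iz r (childDegree R v) ⟩
            1# * 1# - lit 4 * iz * iz * r * childDegree R v
              ≈⟨ +-congʳ (*-cong (inv-inverse z 0<z) (inv-inverse z 0<z)) ⟨
            z * iz * (z * iz) - lit 4 * iz * iz * r * childDegree R v
              ≈⟨ solve 5 (λ i z r δ q → z :* i :* (z :* i) :- num 4 :* i :* i :* r :* δ :=
                   i :* i :* (z :* z :- num 4 :* q :* r) :+ num 4 :* i :* i :* r :* (q :- δ))
                 ≈-refl iz z r (childDegree R v) q ⟩
            iz * iz * (z * z - lit 4 * q * r) + lit 4 * iz * iz * r * (q - childDegree R v) ∎)
          where open ≈R

        ratio-root : apexSum R (childSum R (λ _ → t)) root < κ
        ratio-root = <-resp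
          (≈-trans (solve 3 (λ i r δ → i :* (num 2 :* r :* δ) := δ :* (r :* (num 2 :* i))) ≈-refl iz r _) (≈-sym (τ root)))
          (≈-trans (≈-trans (≈-sym (*-assoc _ _ _)) (*-congʳ (*-comm _ _))) (1*-cong κ (inv-inverse z 0<z)))
          (*-monoˡ-< iz>0 root-degree)

    -- Let s be the number of edges below v and s′ the number beyond its parent edge. For the ratios
    -- (Γ + r z s + r s′) / (z Γ), and with the sum below v replaced by the bound `τ-≤`, the ratio
    -- condition is r s times Γ ≤ z² (z + r) - r (z s + s′), up to a positive factor. Since s and s′
    -- are at most `outer R`, this Γ is the largest constant that the estimate allows.
    Γ : Carrier
    Γ = z * z * (z + r) - (z + 1#) * r * outer R

    module _ (z+r≤Γ : z + r ≤ Γ)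
             (root-bound : r * (z + r) * outer R < (z * κ - r * childDegree R root) * Γ) where
      private
        z+r>0 : 0# < z + r
        z+r>0 = +-pos 0<z r>0

        0<Γ : 0# < Γ
        0<Γ = <-≤-trans z+r>0 z+r≤Γ

        i : Carrier
        i = inv (z * Γ) (*-pos 0<z 0<Γ)

        i>0 : 0# < i
        i>0 = inv-pos (z * Γ) (*-pos 0<z 0<Γ)

        zΓi : z * Γ * i ≈ 1#
        zΓi = inv-inverse (z * Γ) (*-pos 0<z 0<Γ)

        above : Vertex H → Carrier
        above = aboveSum R (edgeBranch R)

        numerator t : Vertex H → Carrier
        numerator v = Γ + r * z * branch R v + r * above v
        t v = numerator v * i

        above-nonneg : ∀ v → 0# ≤ above v
        above-nonneg v = ∑-nonneg (λ e → ⟦⟧*-nonneg (_≟ₘ_ R (parent v) (just e)) (λ _ → edgeBranch-nonneg R e))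

        t>0 : ∀ v → 0# < t v
        t>0 v = *-pos (+-pos-nonneg (+-pos-nonneg 0<Γ (*-nonneg (*-nonneg (<⇒≤ r>0) (<⇒≤ 0<z)) (branch-nonneg R v)))
          (*-nonneg (<⇒≤ r>0) (above-nonneg v))) i>0

        σ : ∀ e → childSum R t e ≈ (Γ + (z + r) * edgeBranch R e) * (r * i)
        σ e = begin
          childSum R t e ≈⟨ childSum-* R i numerator e ⟩
          childSum R numerator e * i
            ≈⟨ *-congʳ (childSum-cong R e (λ v p → ≈-trans (+-congˡ (*-congˡ (aboveSum-just R (edgeBranch R) p)))
                 (solve 5 (λ Γ r z b s → Γ :+ r :* z :* b :+ r :* s := num 1 :* (Γ :+ r :* s) :+ b :* (r :* z))
                   ≈-refl Γ r z (branch R v) (edgeBranch R e)))) ⟩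
          childSum R (λ v → 1# * (Γ + r * edgeBranch R e) + branch R v * (r * z)) e * i
            ≈⟨ *-congʳ (≈-trans (childSum-+ R (λ _ → 1# * (Γ + r * edgeBranch R e)) (λ v → branch R v * (r * z)) e)
                 (+-cong (≈-trans (childSum-* R (Γ + r * edgeBranch R e) (λ _ → 1#) e) (*-congʳ (childCount R uniform e)))
                   (childSum-* R (r * z) (branch R) e))) ⟩
          (r * (Γ + r * edgeBranch R e) + edgeBranch R e * (r * z)) * i
            ≈⟨ solve 5 (λ Γ r z s i → (r :* (Γ :+ r :* s) :+ s :* (r :* z)) :* i := (Γ :+ (z :+ r) :* s) :* (r :* i))
                 ≈-refl Γ r z (edgeBranch R e) i ⟩
          (Γ + (z + r) * edgeBranch R e) * (r * i) ∎
          where open ≈R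

        τ : ∀ v → apexSum R (childSum R t) v ≈ apexSum R (λ e → Γ + (z + r) * edgeBranch R e) v * (r * i)
        τ v = ≈-trans (apexSum-cong R v (λ e _ → σ e)) (apexSum-* R (r * i) (λ e → Γ + (z + r) * edgeBranch R e) v)

        -- Each edge at v contributes in proportion to Γ + (z + r) s_e, which is at most Γ (1 + s_e)
        -- because z + r ≤ Γ; the numbers 1 + s_e add up to `branch R v`.
        τ-≤ : ∀ v → apexSum R (childSum R t) v ≤ Γ * branch R v * (r * i)
        τ-≤ v = ≤-resp (≈-sym (τ v)) (*-congʳ branch≈) (≤-resp (*-comm _ _) (*-comm _ _)
          (*-monoˡ-≤ (<⇒≤ (*-pos r>0 i>0)) (apexSum-mono R v (λ e _ → pointwise e))))
          where
          pointwise : ∀ e → Γ + (z + r) * edgeBranch R e ≤ (1# + edgeBranch R e) * Γ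
          pointwise e = ≤-by (edgeBranch R e * (Γ - (z + r))) (*-nonneg (edgeBranch-nonneg R e) (≤⇒0≤- z+r≤Γ))
            (solve 3 (λ Γ w s → (num 1 :+ s) :* Γ :- (Γ :+ w :* s) := s :* (Γ :- w)) ≈-refl Γ (z + r) (edgeBranch R e))
          branch≈ : apexSum R (λ e → (1# + edgeBranch R e) * Γ) v ≈ Γ * branch R v
          branch≈ = ≈-trans (apexSum-* R Γ (λ e → 1# + edgeBranch R e) v) (≈-trans (*-comm _ _) (*-congˡ (≈-sym (branch-eq R v))))

      highDegree-bound : ∀ lam → IsLambda₁ ℝ (suc (suc r′)) H lam → lam < recip (suc r′) * κ
      highDegree-bound = ratio-test R t t>0 κ ratio ratio-root (suc (suc r′)) r′ ≡.refl
        where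
        ratio : ∀ {v e} → parent v ≡ just e →
          1# + childSum R t e ≤ t v * (κ + 1# - apexSum R (childSum R t) v)
        ratio {v} {e} p = ≤-trans
          (≤-by (i * i * Γ * (r * r) * s * (z * (S - s) + (S - se)))
            (*-nonneg (*-nonneg (*-nonneg (*-nonneg (*-nonneg (<⇒≤ i>0) (<⇒≤ i>0)) (<⇒≤ 0<Γ)) (<⇒≤ (*-pos r>0 r>0))) (branch-nonneg R v))
              (+-nonneg (*-nonneg (<⇒≤ 0<z) (≤⇒0≤- (≤-trans (branch≤edgeBranch R p) (edgeBranch-≤ R e))))
                (≤⇒0≤- (edgeBranch-≤ R e))))
            main)
          (*-monoˡ-≤ (<⇒≤ (t>0 v)) (+-mono-≤ ≤-refl
            (≤-by _ (≤⇒0≤- (τ-≤ v)) (solve 2 (λ x y → :- x :- :- y := y :- x) ≈-refl (apexSum R (childSum R t) v) (Γ * branch R v * (r * i))))))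
          where
          open ≈R
          S s se P : Carrier
          S = outer R
          s = branch R v
          se = edgeBranch R e
          P = Γ + r * z * s + r * se
          tv≈ : t v ≈ P * i
          tv≈ = *-congʳ (+-congˡ (*-congˡ (aboveSum-just R (edgeBranch R) p)))
          main : t v * (κ + 1# - Γ * s * (r * i)) - (1# + childSum R t e) ≈
            i * i * Γ * (r * r) * s * (z * (S - s) + (S - se))
          main = begin
            t v * (κ + 1# - Γ * s * (r * i)) - (1# + childSum R t e)
              ≈⟨ +-cong (*-congʳ tv≈) (-‿cong (+-congˡ (σ e))) ⟩
            P * i * (κ + 1# - Γ * s * (r * i)) - (1# + (Γ + (z + r) * se) * (r * i))
              ≈⟨ solve 7 (λ P i z r G s se → P :* i :* (z :+ r :- num 1 :+ num 1 :- G :* s :* (r :* i))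
                    :- (num 1 :+ (G :+ (z :+ r) :* se) :* (r :* i))
                    := i :* (P :* (z :+ r) :* num 1 :- (G :+ (z :+ r) :* se) :* r :* num 1) :- P :* i :* i :* G :* s :* r :- num 1)
                 ≈-refl P i z r Γ s se ⟩
            i * (P * (z + r) * 1# - (Γ + (z + r) * se) * r * 1#) - P * i * i * Γ * s * r - 1#
              -- Factors z Γ i = 1 are inserted until every term has degree two in `i`; what remains
              -- is a polynomial identity.
              ≈⟨ +-cong (+-congʳ (*-congˡ (+-cong (*-congˡ (≈-sym zΓi)) (-‿cong (*-congˡ (≈-sym zΓi))))))
                   (-‿cong (≈-trans (≈-sym zΓi) (≈-trans (≈-sym (*-identityʳ _)) (*-congˡ (≈-sym zΓi))))) ⟩
            i * (P * (z + r) * (z * Γ * i) - (Γ + (z + r) * se) * r * (z * Γ * i)) - P * i * i * Γ * s * r - z * Γ * i * (z * Γ * i)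
              ≈⟨ solve 6 (λ i z r s se S →
                   let G = z :* z :* (z :+ r) :- (z :+ num 1) :* r :* S
                       P = G :+ r :* z :* s :+ r :* se in
                   i :* (P :* (z :+ r) :* (z :* G :* i) :- (G :+ (z :+ r) :* se) :* r :* (z :* G :* i)) :- P :* i :* i :* G :* s :* r
                     :- z :* G :* i :* (z :* G :* i)
                   := i :* i :* G :* (r :* r) :* s :* (z :* (S :- s) :+ (S :- se)))
                 ≈-refl i z r s se S ⟩
            i * i * Γ * (r * r) * s * (z * (S - s) + (S - se)) ∎

        ratio-root : apexSum R (childSum R t) root < κ
        ratio-root = <-by (i * ((z * κ - r * childDegree R root) * Γ - r * (z + r) * outer R))
          (*-pos i>0 (<⇒0<- root-bound))
          (begin
            κ - apexSum R (childSum R t) root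
              ≈⟨ +-cong (≈-sym (≈-trans (*-congʳ zΓi) (*-identityˡ κ))) (-‿cong (≈-trans (τ root) (*-congʳ τ-root))) ⟩
            z * Γ * i * κ - (childDegree R root * Γ + outer R * (z + r)) * (r * i)
              ≈⟨ solve 7 (λ z G i k δ S r → z :* G :* i :* k :- (δ :* G :+ S :* (z :+ r)) :* (r :* i)
                   := i :* ((z :* k :- r :* δ) :* G :- r :* (z :+ r) :* S)) ≈-refl z Γ i κ (childDegree R root) (outer R) r ⟩
            i * ((z * κ - r * childDegree R root) * Γ - r * (z + r) * outer R) ∎)
          where
          open ≈R
          τ-root : apexSum R (λ e → Γ + (z + r) * edgeBranch R e) root ≈ childDegree R root * Γ + outer R * (z + r)
          τ-root = ≈-trans (apexSum-cong R root (λ e _ → +-cong (≈-sym (*-identityˡ Γ)) (*-comm _ _)))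
            (≈-trans (apexSum-+ R (λ _ → 1# * Γ) (λ e → edgeBranch R e * (z + r)) root)
              (+-cong (apexSum-* R Γ (λ _ → 1#) root) (apexSum-* R (z + r) (edgeBranch R) root)))

  -- The spectral radius of hypertrees with many edges

  module _ (r′ d′ k : ℕ)
           (large : 4 ℕ.* ((2 ℕ.+ d′) ℕ.* (2 ℕ.+ d′)) ℕ.* suc r′ ℕ.+ 2 ℕ.≤ 4 ℕ.* k ℕ.+ suc r′) where
    private
      r K D : Carrier
      r = fromℕ# (suc r′)
      K = fromℕ# k
      D = fromℕ# d′

    d²<k : (2 ℕ.+ d′) ℕ.* (2 ℕ.+ d′) ℕ.< k
    d²<k = large⇒d²<k r′ d′ k large

    large# : lit 4 * ((lit 2 + D) * (lit 2 + D)) * r + lit 2 ≤ lit 4 * K + r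
    large# = ≤-resp
      (≈-trans (fromℕ#-+ (4 ℕ.* q ℕ.* suc r′) 2) (+-cong (≈-trans (fromℕ#-* (4 ℕ.* q) (suc r′)) (*-congʳ
        (≈-trans (fromℕ#-* 4 q) (*-cong (fromℕ#≈lit 4) (≈-trans (fromℕ#-* (2 ℕ.+ d′) (2 ℕ.+ d′)) (*-cong d≈ d≈)))))) (fromℕ#≈lit 2)))
      (≈-trans (fromℕ#-+ (4 ℕ.* k) (suc r′)) (+-congʳ (≈-trans (fromℕ#-* 4 k) (*-congʳ (fromℕ#≈lit 4)))))
      (fromℕ#-mono-≤ large)
      where
      q : ℕ
      q = (2 ℕ.+ d′) ℕ.* (2 ℕ.+ d′)
      d≈ : fromℕ# (2 ℕ.+ d′) ≈ lit 2 + D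
      d≈ = ≈-trans (fromℕ#-+ 2 d′) (+-congʳ (fromℕ#≈lit 2))

    module _ (z : Carrier) (0<z : 0# < z) (low : r * (K - D) ≤ z * (z + r - 1#)) where
      private
        κ : Carrier
        κ = z + r - 1#

        r>0 : 0# < r
        r>0 = fromℕ#-pos r′

        R′ : Carrier
        R′ = fromℕ# r′

        R′≥0 : 0# ≤ R′
        R′≥0 = fromℕ#-nonneg r′

        D≥0 : 0# ≤ D
        D≥0 = fromℕ#-nonneg d′

        -- With D = d - 2 this is z ≥ (d - 1/2) r. It is a negation, so 2 z < c may be assumed; then
        -- 4 z κ is at most c (c + 2 R′), while `low` and the hypothesis on k put it at least 8 r
        -- higher.
        halfBound : (lit 2 * D + lit 3) * r ≤ lit 2 * z
        halfBound 2z<c = ≤-trans lower upper (<-by (lit 8 * r) (*-pos (lit-pos 7) r>0)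
          (solve 2 (λ D R → let r = num 1 :+ R in
            r :* (num 4 :* ((num 2 :+ D) :* (num 2 :+ D)) :* r :+ num 2 :- r :- num 4 :* D)
              :- ((num 2 :* D :+ num 3) :* r) :* ((num 2 :* D :+ num 3) :* r :+ num 2 :* R)
            := num 8 :* r) ≈-refl D R′))
          where
          c : Carrier
          c = (lit 2 * D + lit 3) * r
          lower : r * (lit 4 * ((lit 2 + D) * (lit 2 + D)) * r + lit 2 - r - lit 4 * D) ≤ lit 4 * (z * κ)
          lower = ≤-trans (≤-by (r * (lit 4 * K + r - (lit 4 * ((lit 2 + D) * (lit 2 + D)) * r + lit 2)))
            (*-nonneg (<⇒≤ r>0) (≤⇒0≤- large#))
            (solve 4 (λ r K q D → num 4 :* (r :* (K :- D)) :- r :* (q :+ num 2 :- r :- num 4 :* D)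
              := r :* (num 4 :* K :+ r :- (q :+ num 2))) ≈-refl r K (lit 4 * ((lit 2 + D) * (lit 2 + D)) * r) D))
            (*-monoˡ-≤ (lit-nonneg 4) low)
          upper : lit 4 * (z * κ) ≤ c * (c + lit 2 * R′)
          upper = ≤-by ((c - lit 2 * z) * (c + lit 2 * z + lit 2 * R′))
            (*-nonneg (<⇒≤ (<⇒0<- 2z<c)) (+-nonneg (+-nonneg
              (*-nonneg (+-nonneg (*-nonneg (lit-nonneg 2) D≥0) (lit-nonneg 3)) (<⇒≤ r>0))
              (*-nonneg (lit-nonneg 2) (<⇒≤ 0<z))) (*-nonneg (lit-nonneg 2) R′≥0)))
            (solve 3 (λ z R c → c :* (c :+ num 2 :* R) :- num 4 :* (z :* (z :+ (num 1 :+ R) :- num 1))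
              := (c :- num 2 :* z) :* (c :+ num 2 :* z :+ num 2 :* R)) ≈-refl z R′ c)

      4dr≤z² : lit 4 * D * r ≤ z * z
      4dr≤z² = *-cancelˡ-≤ (lit-pos 3) (≤-by
        ((lit 2 * z - c) * (lit 2 * z + c) + r * ((lit 2 * D + lit 3) * (lit 2 * D + lit 3) * R′ +
          ((lit 2 * D - 1#) * (lit 2 * D - 1#) + lit 8)))
        (+-nonneg (*-nonneg (≤⇒0≤- halfBound) (+-nonneg (*-nonneg (lit-nonneg 2) (<⇒≤ 0<z)) c≥0))
          (*-nonneg (<⇒≤ r>0) (+-nonneg (*-nonneg (sq-nonneg _) R′≥0) (+-nonneg (sq-nonneg _) (lit-nonneg 8)))))
        (solve 3 (λ z D R → let r = num 1 :+ R
                                c = (num 2 :* D :+ num 3) :* r in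
          num 4 :* (z :* z) :- num 4 :* (num 4 :* D :* r) :=
          (num 2 :* z :- c) :* (num 2 :* z :+ c) :+ r :* ((num 2 :* D :+ num 3) :* (num 2 :* D :+ num 3) :* R
            :+ ((num 2 :* D :- num 1) :* (num 2 :* D :- num 1) :+ num 8))) ≈-refl z D R′))
        where
        c : Carrier
        c = (lit 2 * D + lit 3) * r
        c≥0 : 0# ≤ c
        c≥0 = *-nonneg (+-nonneg (*-nonneg (lit-nonneg 2) D≥0) (lit-nonneg 3)) (<⇒≤ r>0)

      module _ {T : Hypergraph} (uniform : Uniform (suc (suc r′)) T) (size≡ : size T ≡ k)
               (rooting : ∀ v → Σ[ R ∈ Rooted T ] Rooted.root R ≡ v) (v₀ : Vertex T)
               (upper : (∀ v → degree T v ℕ.+ d′ ℕ.< k) ⊎ r * K < z * (z + r - 1#))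
               (lam : Carrier) (isλ : IsLambda₁ ℝ (suc (suc r′)) T lam) where
        private
          -- All degrees are at most d - 1, so a vertex other than the root has at most q = d - 2
          -- edges below it. Any root will do, because 2 (d - 1) < k - d + 2.
          lowDegrees : (∀ v → degree T v ℕ.≤ suc d′) → lam < recip (suc r′) * κ
          lowDegrees deg≤ with rooting v₀
          ... | R , _ = lowDegree-bound R r′ uniform z 0<z D degrees 4dr≤z² root-degree lam isλ
            where
            open Rooted R
            degrees : ∀ {v e} → parent v ≡ just e → childDegree R v ≤ D
            degrees {v} p = ≤-resp (≈-trans (+-congʳ (degree-child R p)) (solve 1 (λ x → x :+ num 1 :- num 1 := x) ≈-refl _))
              (solve 1 (λ x → num 1 :+ x :- num 1 := x) ≈-refl D)
              (+-mono-≤ (fromℕ#-mono-≤ (deg≤ v)) (≤-refl { - 1#}))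
            root-degree : lit 2 * r * childDegree R root < z * κ
            root-degree = <-≤-trans (<-by (r * (K - D - lit 2 * childDegree R root))
              (*-pos r>0 (<-≤-trans (<⇒0<- bound) (≤-by (lit 2 * (1# + D - childDegree R root))
                (*-nonneg (lit-nonneg 2) (≤⇒0≤- (≤-resp (degree-root R) ≈-refl (fromℕ#-mono-≤ (deg≤ root)))))
                (solve 3 (λ K D δ → K :- D :- num 2 :* δ :- (K :- D :- num 2 :* (num 1 :+ D))
                  := num 2 :* (num 1 :+ D :- δ)) ≈-refl K D (childDegree R root)))))
              (solve 4 (λ r K D δ → r :* (K :- D) :- num 2 :* r :* δ := r :* (K :- D :- num 2 :* δ))
                ≈-refl r K D (childDegree R root))) low
              where
              nat : d′ ℕ.+ 2 ℕ.* suc d′ ℕ.< k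
              nat = 2d-bound d′ k d²<k
              bound : lit 2 * (1# + D) < K - D
              bound = 0<-⇒< (<-respʳ-≈ (≈-trans (+-congˡ (-‿cong (≈-trans (fromℕ#-+ d′ (2 ℕ.* suc d′))
                  (+-congˡ (≈-trans (fromℕ#-* 2 (suc d′)) (*-congʳ (fromℕ#≈lit 2)))))))
                (solve 3 (λ K D q → K :- (D :+ q) := K :- D :- q) ≈-refl K D (lit 2 * (1# + D))))
                (<⇒0<- (fromℕ#-mono-< nat)))

          -- The root has degree δ ≥ d, and S edges avoid it. From `low`, Y = z κ - r S is at least
          -- 2 r, so r Γ ≥ (z + r) Y, and with X = z κ - r δ the condition at the root follows from
          -- r² S < X Y.
          highDegree : ∀ v → suc (suc d′) ℕ.≤ degree T v → lam < recip (suc r′) * κ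
          highDegree v d≤deg with rooting v
          ... | R , ≡.refl = highDegree-bound R r′ uniform z 0<z h₁ h₂ lam isλ
            where
            open Rooted R using (root)
            S δ Y X : Carrier
            S = outer R
            δ = childDegree R root
            Y = z * κ - r * S
            X = z * κ - r * δ
            S≥0 : 0# ≤ S
            S≥0 = apexSum-nonneg R root (λ e _ → edgeBranch-nonneg R e)
            split : δ + S ≈ K
            split = ≈-trans (size-split R) (≈-reflexive (≡.cong fromℕ# size≡))
            lit2≤ : lit 2 + D ≤ δ
            lit2≤ = ≤-resp (≈-trans (fromℕ#-+ 2 d′) (+-congʳ (fromℕ#≈lit 2))) (degree-root R) (fromℕ#-mono-≤ d≤deg)
            2r≤Y : lit 2 * r ≤ Y
            2r≤Y = ≤-by (z * κ - r * (K - D) + r * (δ - (lit 2 + D)))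
              (+-nonneg (≤⇒0≤- low) (*-nonneg (<⇒≤ r>0) (≤⇒0≤- lit2≤)))
              (≈-trans (solve 6 (λ q r S δ D K → q :- r :* S :- num 2 :* r
                  := q :- r :* ((δ :+ S) :- D) :+ r :* (δ :- (num 2 :+ D))) ≈-refl (z * κ) r S δ D K)
                (+-congʳ (+-congˡ (-‿cong (*-congˡ (+-congʳ split))))))
            r≤Y : r ≤ Y
            r≤Y = ≤-trans (≤-by r (<⇒≤ r>0) (solve 1 (λ r → num 2 :* r :- r := r) ≈-refl r)) 2r≤Y
            h₁ : z + r ≤ Γ R r′ uniform z 0<z
            h₁ = ≤-by ((z + 1#) * (Y - r)) (*-nonneg (<⇒≤ (+-pos 0<z 0<1)) (≤⇒0≤- r≤Y))
              (solve 3 (λ z r S → z :* z :* (z :+ r) :- (z :+ num 1) :* r :* S :- (z :+ r)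
                := (z :+ num 1) :* (z :* (z :+ r :- num 1) :- r :* S :- r)) ≈-refl z r S)
            product : r * r * S < X * Y × 0# ≤ X
            product = [ small , big ]′ upper
              where
              -- As Y ≥ r, it is enough that r X exceeds r² S, and r X - r² S is r (z κ - r k).
              big : r * K < z * κ → r * r * S < X * Y × 0# ≤ X
              big rK<zκ = <-≤-trans (<-by (r * (z * κ - r * K)) (*-pos r>0 (<⇒0<- rK<zκ))
                  (≈-trans (solve 4 (λ r q δ S → r :* (q :- r :* δ) :- r :* r :* S := r :* (q :- r :* (δ :+ S))) ≈-refl r (z * κ) δ S)
                    (*-congˡ (+-congˡ (-‿cong (*-congˡ split))))))
                (≤-by (X * (Y - r)) (*-nonneg X≥0 (≤⇒0≤- r≤Y))
                  (solve 3 (λ X Y r → X :* Y :- r :* X := X :* (Y :- r)) ≈-refl X Y r)) , X≥0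
                where
                X≥0 : 0# ≤ X
                X≥0 = ≤-resp ≈-refl
                  (≈-trans (+-congʳ (+-congˡ (-‿cong (*-congˡ (≈-sym split)))))
                    (solve 4 (λ q r δ S → q :- r :* (δ :+ S) :+ r :* S := q :- r :* δ) ≈-refl (z * κ) r δ S))
                  (+-nonneg (<⇒≤ (<⇒0<- rK<zκ)) (*-nonneg (<⇒≤ r>0) S≥0))
              -- Here z κ is only known to be at least r (k - d + 2). This gives X ≥ r (a + 1) and Y
              -- ≥ r (y + 2), and the claim becomes `product-bound`.
              small : (∀ v → degree T v ℕ.+ d′ ℕ.< k) → r * r * S < X * Y × 0# ≤ X
              small deg< = <-≤-trans (<-respˡ-≈ (*-congˡ (≈-sym S≈)) (*-monoˡ-< (*-pos r>0 r>0) (fromℕ#-mono-< nat)))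
                  (≤-trans (≤-reflexive (≈-trans (*-congˡ (fromℕ#-* (suc a) (2 ℕ.+ y)))
                      (solve 3 (λ r a y → r :* r :* (a :* y) := (r :* a) :* (r :* y)) ≈-refl r (fromℕ# (suc a)) (fromℕ# (2 ℕ.+ y)))))
                    (≤-trans (*-monoˡ-≤ (*-nonneg (<⇒≤ r>0) (fromℕ#-nonneg (suc a))) Y≥) (≤-resp (*-comm _ _) (*-comm _ _) (*-monoˡ-≤ (≤-trans (*-nonneg (<⇒≤ r>0) (fromℕ#-nonneg (2 ℕ.+ y))) Y≥) X≥)))) ,
                ≤-trans (*-nonneg (<⇒≤ r>0) (fromℕ#-nonneg (suc a))) X≥
                where
                n : ℕ
                n = degree T v
                y a : ℕ
                y = n ℕ.∸ (2 ℕ.+ d′)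
                a = k ℕ.∸ suc (n ℕ.+ d′)
                n≡ : 2 ℕ.+ d′ ℕ.+ y ≡ n
                n≡ = ℕ.m+[n∸m]≡n d≤deg
                k≡ : suc (n ℕ.+ d′) ℕ.+ a ≡ k
                k≡ = ℕ.m+[n∸m]≡n (deg< v)
                K≈ : K ≈ (1# + (δ + D)) + fromℕ# a
                K≈ = ≈-trans (≈-reflexive (≡.cong fromℕ# (≡.sym k≡))) (≈-trans (fromℕ#-+ (suc (n ℕ.+ d′)) a)
                  (+-congʳ (+-congˡ (≈-trans (fromℕ#-+ n d′) (+-congʳ (degree-root R))))))
                δ≈ : lit 2 + D + fromℕ# y ≈ δ
                δ≈ = ≈-trans (≈-sym (≈-trans (fromℕ#-+ (2 ℕ.+ d′) y) (+-congʳ (≈-trans (fromℕ#-+ 2 d′) (+-congʳ (fromℕ#≈lit 2))))))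
                  (≈-trans (≈-reflexive (≡.cong fromℕ# n≡)) (degree-root R))
                S≈ : S ≈ fromℕ# (suc d′ ℕ.+ a)
                S≈ = ≈-trans (solve 2 (λ S δ → S := δ :+ S :- δ) ≈-refl S δ) (≈-trans (+-congʳ (≈-trans split K≈))
                  (≈-trans (solve 3 (λ δ D a → num 1 :+ (δ :+ D) :+ a :- δ := num 1 :+ D :+ a) ≈-refl δ D (fromℕ# a))
                    (≈-sym (fromℕ#-+ (suc d′) a))))
                X≥ : r * fromℕ# (suc a) ≤ X
                X≥ = ≤-by (z * κ - r * (K - D)) (≤⇒0≤- low) (≈-trans
                  (solve 5 (λ q r δ a D → q :- r :* δ :- r :* (num 1 :+ a) := q :- r :* (num 1 :+ (δ :+ D) :+ a :- D)) ≈-refl (z * κ) r δ (fromℕ# a) D)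
                  (+-congˡ (-‿cong (*-congˡ (+-congʳ (≈-sym K≈))))))
                Y≥ : r * fromℕ# (2 ℕ.+ y) ≤ Y
                Y≥ = ≤-by (z * κ - r * (K - D)) (≤⇒0≤- low) (≈-trans
                  (+-congˡ (-‿cong (*-congˡ (≈-trans (fromℕ#-+ 2 y) (+-congʳ (fromℕ#≈lit 2))))))
                  (≈-trans (solve 5 (λ q r S y D → q :- r :* S :- r :* (num 2 :+ y) := q :- r :* (num 2 :+ D :+ y :+ S :- D)) ≈-refl (z * κ) r S (fromℕ# y) D)
                    (+-congˡ (-‿cong (*-congˡ (+-congʳ (≈-trans (+-congʳ δ≈) split)))))))
                nat : suc d′ ℕ.+ a ℕ.< suc a ℕ.* (2 ℕ.+ y)
                nat = product-bound d′ a y (≡.subst ((2 ℕ.+ d′) ℕ.* (2 ℕ.+ d′) ℕ.<_)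
                  (≡.trans (≡.sym k≡) (≡.cong (λ n → suc (n ℕ.+ d′) ℕ.+ a) (≡.sym n≡))) d²<k)
            h₂ : r * (z + r) * S < X * Γ R r′ uniform z 0<z
            h₂ = *-cancelˡ-< r>0 (<-≤-trans (<-by ((z + r) * (X * Y - r * r * S))
                (*-pos (+-pos 0<z r>0) (<⇒0<- (proj₁ product)))
                (solve 5 (λ z r X Y S → (z :+ r) :* (X :* Y) :- r :* (r :* (z :+ r) :* S) := (z :+ r) :* (X :* Y :- r :* r :* S))
                  ≈-refl z r X Y S))
              (≤-by (X * (R′ * z * (Y - r))) (*-nonneg (proj₂ product) (*-nonneg (*-nonneg R′≥0 (<⇒≤ 0<z)) (≤⇒0≤- r≤Y)))
                (solve 4 (λ z R S X → let r = num 1 :+ R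
                                          Y = z :* (z :+ r :- num 1) :- r :* S in
                  r :* (X :* (z :* z :* (z :+ r) :- (z :+ num 1) :* r :* S)) :- (z :+ r) :* (X :* Y)
                    := X :* (R :* z :* (Y :- r))) ≈-refl z R′ S X)))

        crude-bound : lam < recip (suc r′) * κ
        crude-bound with Fin.any? (λ v → suc (suc d′) ℕ.≤? degree T v)
        ... | yes (v , d≤) = highDegree v d≤
        ... | no ¬∃ = lowDegrees (λ v → ℕ.s≤s⁻¹ (ℕ.≰⇒> (λ d≤ → ¬∃ (v , d≤))))

  -- Vertices meeting all edges off a path

  ∑-atMostOne : ∀ {n} {p} {P : Fin n → Set p} (P? : ∀ i → Dec (P i)) → (∀ i j → P i → P j → i ≡ j) →
    (∃[ i ] P i × ∑ (λ i → ⟦ P? i ⟧) ≈ 1#) ⊎ ((∀ i → ¬ P i) × ∑ (λ i → ⟦ P? i ⟧) ≈ 0#)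
  ∑-atMostOne P? unique with Fin.any? P?
  ... | yes (i , Pi) = inj₁ (i , Pi , ≈-trans (∑-single _ i (λ j j≢i → ⟦⟧-no (P? j) (λ Pj → j≢i (unique j i Pj Pi)))) (⟦⟧-yes (P? i) Pi))
  ... | no ¬∃ = inj₂ ((λ i Pi → ¬∃ (i , Pi)) , ∑-0 (λ i → ⟦⟧-no (P? i) (λ Pi → ¬∃ (i , Pi))))

  module _ {T : Hypergraph} (R : Rooted T) (d : ℕ) (v : Fin (suc d) → Vertex T) (e : Fin d → Edge T)
           (e-injective : ∀ {i j} → e i ≡ e j → i ≡ j) (v-injective : ∀ {i j} → v i ≡ v j → i ≡ j)
           (left∈ : ∀ i → v (inject₁ i) ∈ edge T (e i)) (right∈ : ∀ i → v (suc i) ∈ edge T (e i))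
           (root≡ : Rooted.root R ≡ v zero)
           (x : Vertex T) (heavy : size T ℕ.+ 2 ℕ.≤ degree T x ℕ.+ d) where
    open Rooted R
    private
      apex≡ : ∀ j → apex (e j) ≡ v (inject₁ j)
      apex≡ = path-apex R d v e e-injective v-injective left∈ right∈ root≡

      parent≡ : ∀ j → parent (v (suc j)) ≡ just (e j)
      parent≡ = path-parent R d v e e-injective v-injective left∈ right∈ root≡

      -- `gap` is the indicator of the edges that are neither on the path nor at `x`; the aim is to
      -- show that there are none.
      inc onPath gap : Edge T → Carrier
      inc f = incidence R x f
      onPath f = ∑ (λ j → ⟦ e j Fin.≟ f ⟧)
      gap f = (1# - onPath f) * (1# - inc f)

      A? : ∀ j → Dec (apex (e j) ≡ x)
      A? j = apex (e j) Fin.≟ x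

      B? : ∀ j → Dec (parent x ≡ just (e j))
      B? j = _≟ₘ_ R (parent x) (just (e j))

      A B : Carrier
      A = ∑ (λ j → ⟦ A? j ⟧)
      B = ∑ (λ j → ⟦ B? j ⟧)

      A-unique : ∀ i j → apex (e i) ≡ x → apex (e j) ≡ x → i ≡ j
      A-unique i j p q = Fin.inject₁-injective (v-injective (≡.trans (≡.sym (apex≡ i)) (≡.trans p (≡.trans (≡.sym q) (apex≡ j)))))

      B-unique : ∀ i j → parent x ≡ just (e i) → parent x ≡ just (e j) → i ≡ j
      B-unique i j p q = e-injective (Maybe.just-injective (≡.trans (≡.sym p) q))

      onPath-cases : ∀ f → (∃[ j ] e j ≡ f × onPath f ≈ 1#) ⊎ ((∀ j → e j ≢ f) × onPath f ≈ 0#)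
      onPath-cases f = ∑-atMostOne (λ j → e j Fin.≟ f) (λ i j p q → e-injective (≡.trans p (≡.sym q)))

      inc≤1 : ∀ f → 0# ≤ 1# - inc f
      inc≤1 f = helper (x ∈? edge T f)
        where
        helper : (x? : Dec (x ∈ edge T f)) → 0# ≤ 1# - ⟦ x? ⟧
        helper (yes _) = ≤⇒0≤- ≤-refl
        helper (no _)  = ≤⇒0≤- (<⇒≤ 0<1)

      gap-nonneg : ∀ f → 0# ≤ gap f
      gap-nonneg f = [ (λ (_ , _ , p) → ≤-reflexive (≈-sym (0*-cong _ (≈-trans (+-congˡ (-‿cong p)) (-‿inverseʳ 1#)))))
                     , (λ (_ , p) → *-nonneg (≤⇒0≤- (≤-resp (≈-sym p) ≈-refl (<⇒≤ 0<1))) (inc≤1 f)) ]′ (onPath-cases f)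

      ∑onPath : ∑ onPath ≈ fromℕ# d
      ∑onPath = ≈-trans (∑-comm (λ f j → ⟦ e j Fin.≟ f ⟧)) (≈-trans
        (∑-cong (λ j → ≈-trans (∑-cong (λ f → ≈-sym (*-identityʳ _))) (∑-unique (e j Fin.≟_) (λ _ → 1#) (e j) ≡.refl (λ _ → ≡.sym))))
        (≈-trans (∑-const d 1#) (*-identityʳ _)))

      ∑onPath*inc : ∑ (λ f → onPath f * inc f) ≈ A + B
      ∑onPath*inc = ≈-trans (∑-cong (λ f → ≈-sym (∑-*ʳ (inc f) (λ j → ⟦ e j Fin.≟ f ⟧))))
        (≈-trans (∑-comm (λ f j → ⟦ e j Fin.≟ f ⟧ * inc f))
        (≈-trans (∑-cong (λ j → ≈-trans (∑-unique (e j Fin.≟_) inc (e j) ≡.refl (λ _ → ≡.sym)) (incidence-split R x (e j))))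
          (∑-+ (λ j → ⟦ A? j ⟧) (λ j → ⟦ B? j ⟧))))

      ∑gap : ∑ gap ≈ (A + B) + (fromℕ# (size T) - fromℕ# d - fromℕ# (degree T x))
      ∑gap = begin
        ∑ gap ≈⟨ ∑-cong (λ f → solve 2 (λ p i → (num 1 :- p) :* (num 1 :- i) := p :* i :+ (num 1 :- p :- i)) ≈-refl (onPath f) (inc f)) ⟩
        ∑ (λ f → onPath f * inc f + (1# - onPath f - inc f)) ≈⟨ ∑-+ (λ f → onPath f * inc f) (λ f → 1# - onPath f - inc f) ⟩
        ∑ (λ f → onPath f * inc f) + ∑ (λ f → 1# - onPath f - inc f)
          ≈⟨ +-cong ∑onPath*inc (≈-trans (∑-− (λ f → 1# - onPath f) inc) (+-cong
               (≈-trans (∑-− (λ _ → 1#) onPath) (+-cong (≈-trans (∑-const (size T) 1#) (*-identityʳ _)) (-‿cong ∑onPath)))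
               (-‿cong (≈-sym (degree-∑ T x))))) ⟩
        (A + B) + (fromℕ# (size T) - fromℕ# d - fromℕ# (degree T x)) ∎
        where open ≈R

      -- Inclusion and exclusion over edges on the path and edges at `x`; A + B counts the path
      -- edges through `x`. As `x` is the apex of at most one path edge and has at most one parent
      -- edge, A + B ≤ 2. Hence both occur and no edge is missed.
      ∑gap≤ : lit 2 + ∑ gap ≤ A + B
      ∑gap≤ = ≤-by (fromℕ# (degree T x ℕ.+ d) - fromℕ# (size T ℕ.+ 2)) (≤⇒0≤- (fromℕ#-mono-≤ heavy))
        (≈-trans (+-congˡ (-‿cong (+-congˡ ∑gap))) (≈-trans
          (solve 4 (λ s k d δ → s :- (num 2 :+ (s :+ (k :- d :- δ))) := (δ :+ d) :- (k :+ num 2))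
            ≈-refl (A + B) (fromℕ# (size T)) (fromℕ# d) (fromℕ# (degree T x)))
          (+-cong (≈-sym (fromℕ#-+ (degree T x) d)) (-‿cong (≈-trans (+-congˡ (≈-sym (fromℕ#≈lit 2))) (≈-sym (fromℕ#-+ (size T) 2)))))))

      many : lit 2 ≤ A + B
      many = ≤-trans (≤-resp (+-identityʳ _) ≈-refl (+-mono-≤ (≤-refl {lit 2}) (∑-nonneg gap-nonneg))) ∑gap≤

      A≤1 : A ≤ 1#
      A≤1 = [ (λ (_ , _ , p) → ≤-reflexive p) , (λ (_ , p) → ≤-resp (≈-sym p) ≈-refl (<⇒≤ 0<1)) ]′ (∑-atMostOne A? A-unique)

      B≤1 : B ≤ 1#
      B≤1 = [ (λ (_ , _ , p) → ≤-reflexive p) , (λ (_ , p) → ≤-resp (≈-sym p) ≈-refl (<⇒≤ 0<1)) ]′ (∑-atMostOne B? B-unique)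

      1<2 : ∀ {s} → s ≤ 0# + 1# → lit 2 ≤ s → ⊥
      1<2 s≤ 2≤s = ≤-trans 2≤s s≤ (<-by 1# 0<1 (solve 0 (num 2 :- (num 0 :+ num 1) := num 1) ≈-refl))

      below : ∃[ j ] apex (e j) ≡ x
      below = [ (λ (j , p , _) → j , p)
              , (λ (_ , p) → ⊥-elim (1<2 (+-mono-≤ (≤-reflexive p) B≤1) many)) ]′ (∑-atMostOne A? A-unique)

      above : ∃[ j ] parent x ≡ just (e j)
      above = [ (λ (j , p , _) → j , p)
              , (λ (_ , p) → ⊥-elim (1<2 (≤-resp (+-comm _ _) ≈-refl (+-mono-≤ (≤-reflexive p) A≤1)) many)) ]′ (∑-atMostOne B? B-unique)

      gap≤0 : ∀ f → gap f ≤ 0#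
      gap≤0 f = ≤-trans (term≤∑ gap-nonneg f) (≤-by _ (≤⇒0≤- (≤-trans ∑gap≤ (+-mono-≤ A≤1 B≤1)))
        (solve 1 (λ g → num 0 :- g := num 1 :+ num 1 :- (num 2 :+ g)) ≈-refl (∑ gap)))

      covered : ∀ f → (∀ j → e j ≢ f) → x ∈ edge T f
      covered f off = helper (x ∈? edge T f) ≈-refl
        where
        off≈0 : onPath f ≈ 0#
        off≈0 = ∑-0 (λ j → ⟦⟧-no (e j Fin.≟ f) (off j))
        helper : (x? : Dec (x ∈ edge T f)) → inc f ≈ ⟦ x? ⟧ → x ∈ edge T f
        helper (yes x∈) _ = x∈
        helper (no _) eq = ⊥-elim (gap≤0 f (<-respʳ-≈
          (≈-sym (≈-trans (*-cong (+-congˡ (-‿cong off≈0)) (+-congˡ (-‿cong eq)))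
            (solve 0 ((num 1 :- num 0) :* (num 1 :- num 0) := num 1) ≈-refl))) 0<1))

    -- The vertex `x` has a path edge above it and one below, so it is an inner vertex of the path.
    -- An edge off the path contains `x` and is not its parent edge, so `x` is its apex.
    hub : Σ[ i₀ ∈ Fin (suc d) ] 1 ℕ.≤ toℕ i₀ × toℕ i₀ ℕ.< d × (∀ f → (∀ j → e j ≢ f) → apex f ≡ v i₀)
    hub = inject₁ (proj₁ below) , positive (proj₁ below) (≡.trans (≡.sym (apex≡ (proj₁ below))) (proj₂ below)) ,
      ≡.subst (ℕ._< d) (≡.sym (Fin.toℕ-inject₁ (proj₁ below))) (Fin.toℕ<n (proj₁ below)) , off
      where
      positive : ∀ j → v (inject₁ j) ≡ x → 1 ℕ.≤ toℕ (inject₁ j)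
      positive zero p = ⊥-elim (nothing≢just (≡.trans (≡.sym parent-root)
        (≡.trans (≡.cong parent (≡.trans root≡ p)) (proj₂ above))))
        where
        nothing≢just : ∀ {A : Set} {a : A} → nothing ≢ just a
        nothing≢just ()
      positive (suc j) _ = ℕ.s≤s ℕ.z≤n
      off : ∀ f → (∀ j → e j ≢ f) → apex f ≡ v (inject₁ (proj₁ below))
      off f p = [ (λ q → ≡.trans q (≡.trans (≡.sym (proj₂ below)) (apex≡ (proj₁ below))))
                , (λ q → ⊥-elim (p (proj₁ above) (Maybe.just-injective (≡.trans (≡.sym (proj₂ above)) q)))) ]′ (∈⇒ (covered f p))

  -- Eigenvectors of paths with pendant edges

  ∑-split : ∀ d {s} (f : Fin (d ℕ.+ s) → Carrier) → ∑ f ≈ ∑ (λ j → f (j ↑ˡ s)) + ∑ (λ j → f (d ↑ʳ j))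
  ∑-split zero    f = ≈-sym (≈-trans (+-congʳ (∑-zero _)) (+-identityˡ _))
  ∑-split (suc d) {s} f = ≈-trans (∑-suc f) (≈-trans (+-congˡ (∑-split d (f ∘ suc)))
    (≈-trans (≈-sym (+-assoc _ _ _)) (+-congʳ (≈-sym (∑-suc (λ j → f (j ↑ˡ s)))))))

  ∑-last : ∀ n (f : Fin (suc n) → Carrier) y → (∀ i → i ≢ fromℕ n → f i ≈ y) → ∑ f ≈ fromℕ# n * y + f (fromℕ n)
  ∑-last zero    f y p = ≈-trans (∑-suc f) (≈-trans (+-congˡ (∑-zero _)) (solve 2 (λ a y → a :+ num 0 := num 0 :* y :+ a) ≈-refl (f zero) y))
  ∑-last (suc n) f y p = ≈-trans (∑-suc f) (≈-trans (+-cong (p zero (λ ())) (∑-last n (f ∘ suc) y (λ i i≢ → p (suc i) (i≢ ∘ Fin.suc-injective))))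
    (solve 3 (λ n y l → y :+ (n :* y :+ l) := (num 1 :+ n) :* y :+ l) ≈-refl (fromℕ# n) y (f (fromℕ (suc n)))))

  -- The eigenvalue equation at pendant vertices prescribes all values other than those `X j` on the
  -- path. An inner vertex of a path edge has κ Y = X_j + X_{j+1} + (r - 2) Y, that is (z + 1) Y =
  -- X_j + X_{j+1}; a vertex of an attached edge has z y′ = X at the hub. The sum over an edge is κ
  -- + 1 = z + r times the value at one of its pendant vertices.
  module PendantVector (r′ d : ℕ) {s : ℕ} (at : Fin s → Fin (suc (d ℕ.* suc r′))) (i₀ : Fin (suc d))
           (1≤i₀ : 1 ℕ.≤ toℕ i₀) (i₀<d : toℕ i₀ ℕ.< d)
           (at≡ : ∀ j → at j ≡ pathVertex (suc r′) d i₀)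
           (z : Carrier) (0<z : 0# < z) (X : ℕ → Carrier) (X>0 : ∀ j → 0# < X j) where
    open Pendants r′ d at hiding (r)
    private
      R : Rooted graph
      R = rooted
      module R = Rooted R

      ρ R′ κ : Carrier
      ρ = fromℕ# (suc r′)
      R′ = fromℕ# r′
      κ = z + ρ - 1#

      z+1>0 : 0# < z + 1#
      z+1>0 = +-pos 0<z 0<1

      iz iz₁ : Carrier
      iz = inv z 0<z
      iz₁ = inv (z + 1#) z+1>0

      Y S : ℕ → Carrier
      Y j = (X j + X (suc j)) * iz₁
      S j = (z + ρ) * Y j

      y′ S′ : Carrier
      y′ = X (toℕ i₀) * iz
      S′ = (z + ρ) * y′

      slotValue : Slot → Fin (suc r′) → Carrier
      pathValue : ∀ j {q : Fin (suc r′)} → Dec (q ≡ fromℕ r′) → Carrier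
      pathValue j (yes _) = X (suc j)
      pathValue j (no _)  = Y j
      slotValue (inj₁ j) q = pathValue (toℕ j) (q Fin.≟ fromℕ r′)
      slotValue (inj₂ _) q = y′

      value : Maybe (Slot × Fin (suc r′)) → Carrier
      value nothing        = X 0
      value (just (e , q)) = slotValue e q

    x : Vertex graph → Carrier
    x v = value (decode v)

    private
      x-child : ∀ e q → x (child e q) ≈ slotValue e q
      x-child e q = ≈-reflexive (≡.cong value (decode-child e q))

      slotValue-last : ∀ j → slotValue (inj₁ j) (fromℕ r′) ≈ X (suc (toℕ j))
      slotValue-last j = helper (fromℕ r′ Fin.≟ fromℕ r′)
        where
        helper : (q : Dec (fromℕ r′ ≡ fromℕ r′)) → pathValue (toℕ j) q ≈ X (suc (toℕ j))
        helper (yes _) = ≈-refl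
        helper (no ¬p) = ⊥-elim (¬p ≡.refl)

      slotValue-inner : ∀ j q → q ≢ fromℕ r′ → slotValue (inj₁ j) q ≈ Y (toℕ j)
      slotValue-inner j q q≢ = helper (q Fin.≟ fromℕ r′)
        where
        helper : (p : Dec (q ≡ fromℕ r′)) → pathValue (toℕ j) p ≈ Y (toℕ j)
        helper (yes p) = ⊥-elim (q≢ p)
        helper (no _)  = ≈-refl

    x-onPath : ∀ i → x (onPath i) ≈ X (toℕ i)
    x-onPath zero    = ≈-refl
    x-onPath (suc j) = ≈-trans (≈-reflexive (≡.cong x (onPath-suc j))) (≈-trans (x-child (inj₁ j) (fromℕ r′)) (slotValue-last j))

    private
      Y>0 : ∀ j → 0# < Y j
      Y>0 j = *-pos (+-pos (X>0 j) (X>0 (suc j))) (inv-pos (z + 1#) z+1>0)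

    x>0 : ∀ v → 0# < x v
    x>0 v = positive (decode v)
      where
      positive : ∀ c → 0# < value c
      positive nothing             = X>0 0
      positive (just (inj₁ j , q)) = helper (q Fin.≟ fromℕ r′)
        where
        helper : (p : Dec (q ≡ fromℕ r′)) → 0# < pathValue (toℕ j) p
        helper (yes _) = X>0 (suc (toℕ j))
        helper (no _)  = Y>0 (toℕ j)
      positive (just (inj₂ _ , q)) = *-pos (X>0 _) (inv-pos z 0<z)

    private
      childSum≈ : ∀ f e → childSum R f e ≈ ∑ (λ q → f (child (splitAt d e) q))
      childSum≈ f e = ≈-trans (∑-cong (λ u → ≈-trans (*-congʳ (indicator u)) (≈-sym (∑-*ʳ (f u) (λ q → ⟦ child (splitAt d e) q Fin.≟ u ⟧)))))
        (≈-trans (∑-comm (λ u q → ⟦ child (splitAt d e) q Fin.≟ u ⟧ * f u))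
          (∑-cong (λ q → ∑-unique (child (splitAt d e) q Fin.≟_) f (child (splitAt d e) q) ≡.refl (λ _ → ≡.sym))))
        where
        parent-e : ∀ q → R.parent (child (splitAt d e) q) ≡ just e
        parent-e q = ≡.trans (parent-child (splitAt d e) q) (≡.cong just (Fin.join-splitAt d s e))
        child-injective : ∀ {q q′} → child (splitAt d e) q ≡ child (splitAt d e) q′ → q ≡ q′
        child-injective {q} {q′} eq = ≡.cong proj₂ (Maybe.just-injective (≡.trans (≡.sym (decode-child (splitAt d e) q))
          (≡.trans (≡.cong decode eq) (decode-child (splitAt d e) q′))))
        isThere : ∀ {u} → Node u → R.parent u ≡ just e → ∃[ q ] child (splitAt d e) q ≡ u
        isThere isStart ()
        isThere (isChild c q) p = q , ≡.cong (λ c → child c q) (≡.trans (≡.cong (splitAt d)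
          (≡.sym (Maybe.just-injective (≡.trans (≡.sym (parent-child c q)) p)))) (Fin.splitAt-join d s c))
        indicator : ∀ u → ⟦ _≟ₘ_ R (R.parent u) (just e) ⟧ ≈ ∑ (λ q → ⟦ child (splitAt d e) q Fin.≟ u ⟧)
        indicator u = [ (λ (q , p , eq) → ≈-trans (⟦⟧-yes (_≟ₘ_ R (R.parent u) (just e)) (≡.trans (≡.cong R.parent (≡.sym p)) (parent-e q))) (≈-sym eq))
                      , (λ (none , eq) → ≈-trans (⟦⟧-no (_≟ₘ_ R (R.parent u) (just e))
                          (λ p → none _ (proj₂ (isThere (node u) p)))) (≈-sym eq)) ]′
          (∑-atMostOne (λ q → child (splitAt d e) q Fin.≟ u) (λ q q′ p p′ → child-injective (≡.trans p (≡.sym p′))))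

      slotSum : Slot → Carrier
      slotSum (inj₁ j) = S (toℕ j)
      slotSum (inj₂ _) = S′

      z₁Y : ∀ j → (z + 1#) * Y j ≈ X j + X (suc j)
      z₁Y j = ≈-trans (solve 3 (λ a b c → a :* (b :* c) := a :* c :* b) ≈-refl (z + 1#) (X j + X (suc j)) iz₁)
        (1*-cong _ (inv-inverse (z + 1#) z+1>0))

      zy′ : z * y′ ≈ X (toℕ i₀)
      zy′ = ≈-trans (solve 3 (λ a b c → a :* (b :* c) := a :* c :* b) ≈-refl z (X (toℕ i₀)) iz)
        (1*-cong _ (inv-inverse z 0<z))

      apexOf₂ : ∀ j → apexOf (inj₂ j) ≡ onPath i₀
      apexOf₂ j = ≡.cong (_↑ˡ (s ℕ.* suc r′)) (at≡ j)

      edgeSum≈ : ∀ e → edgeSum R x e ≈ slotSum (splitAt d e)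
      edgeSum≈ e = ≈-trans (edgeSum-split R x e) (≈-trans (+-congˡ (childSum≈ x e)) (total (splitAt d e)))
        where
        total : ∀ c → x (apexOf c) + ∑ (λ q → x (child c q)) ≈ slotSum c
        total (inj₁ j) = begin
          x (onPath (inject₁ j)) + ∑ (λ q → x (child (inj₁ j) q))
            ≈⟨ +-cong (≈-trans (x-onPath (inject₁ j)) (≈-reflexive (≡.cong X (Fin.toℕ-inject₁ j))))
                 (≈-trans (∑-cong (x-child (inj₁ j))) (≈-trans (∑-last r′ (slotValue (inj₁ j)) (Y (toℕ j)) (slotValue-inner j)) (+-congˡ (slotValue-last j)))) ⟩
          X (toℕ j) + (R′ * Y (toℕ j) + X (suc (toℕ j)))
            ≈⟨ solve 4 (λ a R y b → a :+ (R :* y :+ b) := (a :+ b) :+ R :* y) ≈-refl (X (toℕ j)) R′ (Y (toℕ j)) (X (suc (toℕ j))) ⟩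
          (X (toℕ j) + X (suc (toℕ j))) + R′ * Y (toℕ j) ≈⟨ +-congʳ (z₁Y (toℕ j)) ⟨
          (z + 1#) * Y (toℕ j) + R′ * Y (toℕ j)
            ≈⟨ solve 3 (λ z y R → (z :+ num 1) :* y :+ R :* y := (z :+ (num 1 :+ R)) :* y) ≈-refl z (Y (toℕ j)) R′ ⟩
          S (toℕ j) ∎
          where open ≈R
        total (inj₂ j) = begin
          x (apexOf (inj₂ j)) + ∑ (λ q → x (child (inj₂ j) q))
            ≈⟨ +-cong (≈-trans (≈-reflexive (≡.cong x (apexOf₂ j))) (x-onPath i₀)) (≈-trans (∑-cong (x-child (inj₂ j))) (∑-const (suc r′) y′)) ⟩
          X (toℕ i₀) + ρ * y′ ≈⟨ +-congʳ zy′ ⟨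
          z * y′ + ρ * y′ ≈⟨ distribʳ y′ z ρ ⟨
          S′ ∎
          where open ≈R

      onPath-injective : ∀ {i j} → onPath i ≡ onPath j → i ≡ j
      onPath-injective {i} {j} eq = Fin.toℕ-injective (ℕ.*-cancelʳ-≡ (toℕ i) (toℕ j) (suc r′)
        (≡.trans (≡.sym (toℕ-pathVertex (suc r′) d i)) (≡.trans (≡.cong toℕ (Fin.↑ˡ-injective _ _ _ eq)) (toℕ-pathVertex (suc r′) d j))))

      onPath≢inner : ∀ i {c q} → (∀ j → c ≡ inj₁ j → q ≢ fromℕ r′) → onPath i ≢ child c q
      onPath≢inner zero    {c} {q} _ eq with () ← ≡.trans (≡.cong decode eq) (decode-child c q)
      onPath≢inner (suc j) {c} {q} p eq = p j (≡.cong proj₁ cq) (≡.cong proj₂ cq)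
        where
        cq : (c , q) ≡ (inj₁ j , fromℕ r′)
        cq = Maybe.just-injective (≡.trans (≡.sym (decode-child c q)) (≡.trans (≡.cong decode (≡.trans (≡.sym eq) (onPath-suc j))) (decode-child (inj₁ j) (fromℕ r′))))

      apexOf-onPath : ∀ c → ∃[ i ] apexOf c ≡ onPath i
      apexOf-onPath (inj₁ j) = inject₁ j , ≡.refl
      apexOf-onPath (inj₂ j) = i₀ , apexOf₂ j

      G : Vertex graph → Edge graph → Carrier
      G v e = edgeSum R x e - x v

      innerSum : ∀ c q → (∀ j → c ≡ inj₁ j → q ≢ fromℕ r′) → slotSum c ≈ (z + ρ) * slotValue c q →
        neighbourSum R x (child c q) ≈ κ * x (child c q)
      innerSum c q inner eq = begin
        neighbourSum R x (child c q) ≈⟨ neighbourSum-rooted R x (child c q) ⟩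
        apexSum R (G (child c q)) (child c q) + aboveSum R (G (child c q)) (child c q)
          ≈⟨ +-cong (∑-0 (λ e → 0*-cong _ (⟦⟧-no (R.apex e Fin.≟ child c q) (λ p →
               onPath≢inner (proj₁ (apexOf-onPath (splitAt d e))) inner (≡.trans (≡.sym (proj₂ (apexOf-onPath (splitAt d e)))) p)))))
               (aboveSum-just R (G (child c q)) {child c q} {Fin.join d s c} (parent-child c q)) ⟩
        0# + (edgeSum R x (Fin.join d s c) - x (child c q))
          ≈⟨ +-congˡ (+-cong (≈-trans (edgeSum≈ (Fin.join d s c)) (≈-trans (≈-reflexive (≡.cong slotSum (Fin.splitAt-join d s c)))
               (≈-trans eq (*-congˡ (≈-sym (x-child c q)))))) ≈-refl) ⟩
        0# + ((z + ρ) * x (child c q) - x (child c q))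
          ≈⟨ solve 3 (λ z r x → num 0 :+ ((z :+ r) :* x :- x) := (z :+ r :- num 1) :* x) ≈-refl z ρ (x (child c q)) ⟩
        κ * x (child c q) ∎
        where open ≈R

      afterSum beforeSum pendantSum : Fin (suc d) → Carrier
      afterSum i = ∑ (λ j → ⟦ onPath (inject₁ j) Fin.≟ onPath i ⟧ * (S (toℕ j) - X (toℕ i)))
      beforeSum i = aboveSum R (G (onPath i)) (onPath i)
      pendantSum i = ∑ {s} (λ _ → ⟦ onPath i₀ Fin.≟ onPath i ⟧ * (S′ - X (toℕ i)))

      pathSum : ∀ i → neighbourSum R x (onPath i) ≈ afterSum i + pendantSum i + beforeSum i
      pathSum i = ≈-trans (neighbourSum-rooted R x (onPath i)) (+-congʳ (≈-trans
        (∑-split d (λ e → ⟦ R.apex e Fin.≟ onPath i ⟧ * G (onPath i) e))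
        (+-cong (∑-cong (λ j → term (j ↑ˡ s) (inj₁ j) (onPath (inject₁ j)) ≡.refl (Fin.splitAt-↑ˡ d j s)))
          (∑-cong (λ j → term (d ↑ʳ j) (inj₂ j) (onPath i₀) (apexOf₂ j) (Fin.splitAt-↑ʳ d s j))))))
        where
        term : ∀ e c w → apexOf c ≡ w → splitAt d e ≡ c →
          ⟦ R.apex e Fin.≟ onPath i ⟧ * G (onPath i) e ≈ ⟦ w Fin.≟ onPath i ⟧ * (slotSum c - X (toℕ i))
        term e c w p eq = *-cong (⟦⟧-cong (R.apex e Fin.≟ onPath i) (w Fin.≟ onPath i) (≡.trans (≡.sym apex≡)) (≡.trans apex≡))
          (+-cong (≈-trans (edgeSum≈ e) (≈-reflexive (≡.cong slotSum eq))) (-‿cong (x-onPath i)))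
          where
          apex≡ : R.apex e ≡ w
          apex≡ = ≡.trans (≡.cong apexOf eq) p

      afterSum-inner : ∀ i → toℕ i ℕ.< d → afterSum i ≈ S (toℕ i) - X (toℕ i)
      afterSum-inner i i<d = ≈-trans (∑-unique (λ j → onPath (inject₁ j) Fin.≟ onPath i) (λ j → S (toℕ j) - X (toℕ i)) (fromℕ< i<d)
          (≡.cong onPath (Fin.toℕ-injective (≡.trans (Fin.toℕ-inject₁ _) (Fin.toℕ-fromℕ< i<d))))
          (λ j p → Fin.toℕ-injective (≡.trans (≡.sym (Fin.toℕ-inject₁ j)) (≡.trans (≡.cong toℕ (onPath-injective p)) (≡.sym (Fin.toℕ-fromℕ< i<d))))))
        (≈-reflexive (≡.cong (λ k → S k - X (toℕ i)) (Fin.toℕ-fromℕ< i<d)))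

      afterSum-last : ∀ i → toℕ i ≡ d → afterSum i ≈ 0#
      afterSum-last i i≡d = ∑-0 (λ j → 0*-cong _ (⟦⟧-no (onPath (inject₁ j) Fin.≟ onPath i) (λ p →
        ℕ.<-irrefl (≡.trans (≡.sym (Fin.toℕ-inject₁ j)) (≡.trans (≡.cong toℕ (onPath-injective p)) i≡d)) (Fin.toℕ<n j))))

      pendantSum-other : ∀ i → i ≢ i₀ → pendantSum i ≈ 0#
      pendantSum-other i i≢ = ∑-0 {s} (λ _ → 0*-cong _ (⟦⟧-no (onPath i₀ Fin.≟ onPath i) (i≢ ∘ ≡.sym ∘ onPath-injective)))

      pendantSum-centre : pendantSum i₀ ≈ fromℕ# s * (S′ - X (toℕ i₀))
      pendantSum-centre = ≈-trans (∑-cong {s} (λ _ → 1*-cong _ (⟦⟧-yes (onPath i₀ Fin.≟ onPath i₀) ≡.refl))) (∑-const s _)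

      beforeSum-suc : ∀ j → beforeSum (suc j) ≈ S (toℕ j) - X (suc (toℕ j))
      beforeSum-suc j = ≈-trans (aboveSum-just R (G (onPath (suc j))) {onPath (suc j)} {Fin.join d s (inj₁ j)} (≡.trans (≡.cong R.parent (onPath-suc j)) (parent-child (inj₁ j) (fromℕ r′))))
        (+-cong (≈-trans (edgeSum≈ (Fin.join d s (inj₁ j))) (≈-reflexive (≡.cong slotSum (Fin.splitAt-join d s (inj₁ j))))) (-‿cong (x-onPath (suc j))))

      beforeSum-zero : beforeSum zero ≈ 0#
      beforeSum-zero = aboveSum-root R (G (onPath zero)) {onPath zero} ≡.refl

    module _ (iw : Carrier) (w*iw : (z + ρ) * iw ≈ 1#)
             (first-eq : X 1 ≈ z * X 0)
             (last-eq : ∀ j → suc j ≡ d → X j ≈ z * X d)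
             (inner-eq : ∀ j → suc j ℕ.< d → suc j ≢ toℕ i₀ → X j + X (suc (suc j)) ≈ (z - R′ * iw) * X (suc j))
             where
      private
        -- The end of the path is pendant, so its value agrees with that of the inner vertices of
        -- its edge: (z + 1) a = a + b.
        end-value : ∀ a b → b ≈ z * a → (z + ρ) * ((a + b) * iz₁) - a ≈ κ * a
        end-value a b eq = begin
          (z + ρ) * ((a + b) * iz₁) - a ≈⟨ +-congʳ (*-congˡ (*-congʳ (+-congˡ eq))) ⟩
          (z + ρ) * ((a + z * a) * iz₁) - a
            ≈⟨ solve 4 (λ z r a i → (z :+ r) :* ((a :+ z :* a) :* i) :- a := (z :+ r) :* a :* ((z :+ num 1) :* i) :- a) ≈-refl z ρ a iz₁ ⟩
          (z + ρ) * a * ((z + 1#) * iz₁) - a ≈⟨ +-congʳ (*-congˡ (inv-inverse (z + 1#) z+1>0)) ⟩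
          (z + ρ) * a * 1# - a ≈⟨ solve 3 (λ z r a → (z :+ r) :* a :* num 1 :- a := (z :+ r :- num 1) :* a) ≈-refl z ρ a ⟩
          κ * a ∎
          where open ≈R

        -- Eliminating the inner vertices of the two path edges turns the equation at a path vertex
        -- into a + c = (z - R′ / (z + r)) b. The factor θ is left free because the hub deviates
        -- from this value.
        sides : ∀ a b c θ → a + c ≈ θ * b → (z + ρ) * ((b + c) * iz₁) - b + ((z + ρ) * ((a + b) * iz₁) - b) ≈
          κ * b + b * ((z + ρ) * iz₁ * (θ - (z - R′ * iw)))
        sides a b c θ eq = begin
          (z + ρ) * ((b + c) * iz₁) - b + ((z + ρ) * ((a + b) * iz₁) - b)
            ≈⟨ solve 5 (λ w i a b c → w :* ((b :+ c) :* i) :- b :+ (w :* ((a :+ b) :* i) :- b)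
                 := w :* i :* ((a :+ c) :+ num 2 :* b) :- num 2 :* b) ≈-refl (z + ρ) iz₁ a b c ⟩
          (z + ρ) * iz₁ * ((a + c) + lit 2 * b) - lit 2 * b ≈⟨ +-congʳ (*-congˡ (+-congʳ eq)) ⟩
          (z + ρ) * iz₁ * (θ * b + lit 2 * b) - lit 2 * b
            ≈⟨ solve 6 (λ z R i b θ iw → let w = z :+ (num 1 :+ R) in
                 w :* i :* (θ :* b :+ num 2 :* b) :- num 2 :* b :=
                 b :* (w :* i :* (θ :- (z :- R :* iw))) :+ (b :* i :* (w :* (z :+ num 2) :- R :* (w :* iw)) :- num 2 :* b))
                 ≈-refl z R′ iz₁ b θ iw ⟩
          b * ((z + ρ) * iz₁ * (θ - (z - R′ * iw))) + (b * iz₁ * ((z + ρ) * (z + lit 2) - R′ * ((z + ρ) * iw)) - lit 2 * b)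
            ≈⟨ +-congˡ (+-congʳ (*-congˡ (+-congˡ (-‿cong (*-congˡ w*iw))))) ⟩
          b * ((z + ρ) * iz₁ * (θ - (z - R′ * iw))) + (b * iz₁ * ((z + ρ) * (z + lit 2) - R′ * 1#) - lit 2 * b)
            ≈⟨ solve 5 (λ z R i b q → let w = z :+ (num 1 :+ R) in
                 q :+ (b :* i :* (w :* (z :+ num 2) :- R :* num 1) :- num 2 :* b) :=
                 q :+ (b :* (w :+ num 1) :* ((z :+ num 1) :* i) :- num 2 :* b))
                 ≈-refl z R′ iz₁ b (b * ((z + ρ) * iz₁ * (θ - (z - R′ * iw)))) ⟩
          b * ((z + ρ) * iz₁ * (θ - (z - R′ * iw))) + (b * (z + ρ + 1#) * ((z + 1#) * iz₁) - lit 2 * b)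
            ≈⟨ +-congˡ (+-congʳ (*-congˡ (inv-inverse (z + 1#) z+1>0))) ⟩
          b * ((z + ρ) * iz₁ * (θ - (z - R′ * iw))) + (b * (z + ρ + 1#) * 1# - lit 2 * b)
            ≈⟨ solve 4 (λ z r b q → q :+ (b :* (z :+ r :+ num 1) :* num 1 :- num 2 :* b) := (z :+ r :- num 1) :* b :+ q)
                 ≈-refl z ρ b (b * ((z + ρ) * iz₁ * (θ - (z - R′ * iw)))) ⟩
          κ * b + b * ((z + ρ) * iz₁ * (θ - (z - R′ * iw))) ∎
          where open ≈R

      onPath-sum : ∀ i → i ≢ i₀ → neighbourSum R x (onPath i) ≈ κ * x (onPath i)
      onPath-sum zero i≢ = ≈-trans (pathSum zero) (≈-trans (+-cong (+-cong
          (afterSum-inner zero (ℕ.≤-<-trans ℕ.z≤n i₀<d)) (pendantSum-other zero i≢)) beforeSum-zero)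
        (≈-trans (solve 1 (λ a → a :+ num 0 :+ num 0 := a) ≈-refl (S 0 - X 0)) (end-value (X 0) (X 1) first-eq)))
      onPath-sum (suc j) i≢ with suc (toℕ j) ℕ.≟ d
      ... | yes i≡d = ≈-trans (pathSum (suc j)) (≈-trans (+-cong (+-cong
          (afterSum-last (suc j) i≡d) (pendantSum-other (suc j) i≢)) (beforeSum-suc j))
        (≈-trans (solve 1 (λ a → num 0 :+ num 0 :+ a := a) ≈-refl (S (toℕ j) - X (suc (toℕ j))))
          (≈-trans (+-congʳ (*-congˡ (*-congʳ (+-comm _ _))))
            (≈-trans (end-value (X (suc (toℕ j))) (X (toℕ j)) (≈-trans (last-eq (toℕ j) i≡d) (*-congˡ (≈-reflexive (≡.cong X (≡.sym i≡d))))))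
              (*-congˡ (≈-sym (x-onPath (suc j))))))))
      ... | no i≢d = ≈-trans (pathSum (suc j)) (≈-trans (+-cong (+-cong
          (afterSum-inner (suc j) i<d) (pendantSum-other (suc j) i≢)) (beforeSum-suc j))
        (≈-trans (+-congʳ (+-identityʳ _)) (≈-trans (sides (X (toℕ j)) (X (suc (toℕ j))) (X (suc (suc (toℕ j)))) _
            (inner-eq (toℕ j) i<d (i≢ ∘ Fin.toℕ-injective)))
          (≈-trans (solve 4 (λ k b q t → k :+ b :* (q :* (t :- t)) := k) ≈-refl (κ * X (suc (toℕ j))) (X (suc (toℕ j))) ((z + ρ) * iz₁) (z - R′ * iw))
            (*-congˡ (≈-sym (x-onPath (suc j))))))))
        where
        i<d : suc (toℕ j) ℕ.< d
        i<d = ℕ.≤∧≢⇒< (ℕ.s≤s⁻¹ (Fin.toℕ<n (suc j))) i≢d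

      away-from-centre : ∀ v → v ≢ onPath i₀ → neighbourSum R x v ≈ κ * x v
      away-from-centre v v≢ = go (node v) v≢
        where
        go : ∀ {v} → Node v → v ≢ onPath i₀ → neighbourSum R x v ≈ κ * x v
        go isStart v≢ = onPath-sum zero (v≢ ∘ ≡.cong onPath)
        go (isChild (inj₂ j) q) _ = innerSum (inj₂ j) q (λ _ ()) ≈-refl
        go (isChild (inj₁ j) q) v≢ with q Fin.≟ fromℕ r′
        ... | no q≢ = innerSum (inj₁ j) q (λ _ _ → q≢) (*-congˡ (≈-sym (slotValue-inner j q q≢)))
        ... | yes ≡.refl = ≡.subst (λ v → neighbourSum R x v ≈ κ * x v) (onPath-suc j)
          (onPath-sum (suc j) (λ eq → v≢ (≡.trans (≡.sym (onPath-suc j)) (≡.cong onPath eq))))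

      -- Each attached edge adds 1 / z + R′ / (z + r) to θ, in the same units as a path edge. When θ
      -- is twice a ratio, the bracket is the negative of `defect` below, which is where that
      -- function comes from.
      at-centre : ∀ θ j → suc j ≡ toℕ i₀ → X j + X (suc (suc j)) ≈ θ * X (suc j) →
        neighbourSum R x (onPath i₀) ≈ κ * x (onPath i₀) + x (onPath i₀) *
          ((z + ρ) * iz₁ * (θ + fromℕ# s * iz + (fromℕ# s + 1#) * (R′ * iw) - z))
      at-centre θ j j≡ eq = begin
        neighbourSum R x (onPath i₀)
          ≈⟨ ≈-trans (pathSum i₀) (+-cong (+-cong (afterSum-inner i₀ i₀<d) pendantSum-centre) (before i₀ j≡)) ⟩
        S (toℕ i₀) - X (toℕ i₀) + fromℕ# s * (S′ - X (toℕ i₀)) + (S j - X (suc j))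
          ≡⟨ ≡.cong (λ k → S k - X k + fromℕ# s * ((z + ρ) * (X k * iz) - X k) + (S j - X (suc j))) (≡.sym j≡) ⟩
        S (suc j) - X (suc j) + fromℕ# s * ((z + ρ) * (X (suc j) * iz) - X (suc j)) + (S j - X (suc j))
          ≈⟨ solve 3 (λ a b c → a :+ b :+ c := a :+ c :+ b) ≈-refl _ _ _ ⟩
        S (suc j) - X (suc j) + (S j - X (suc j)) + fromℕ# s * ((z + ρ) * (X (suc j) * iz) - X (suc j))
          ≈⟨ +-cong (sides (X j) (X (suc j)) (X (suc (suc j))) θ eq) (*-congˡ pendants) ⟩
        κ * b + b * (g * (θ - (z - R′ * iw))) + fromℕ# s * (b * (g * (iz + R′ * iw)))
          ≈⟨ solve 8 (λ k b g θ z ri s i → k :+ b :* (g :* (θ :- (z :- ri))) :+ s :* (b :* (g :* (i :+ ri)))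
               := k :+ b :* (g :* (θ :+ s :* i :+ (s :+ num 1) :* ri :- z))) ≈-refl (κ * b) b g θ z (R′ * iw) (fromℕ# s) iz ⟩
        κ * b + b * (g * (θ + fromℕ# s * iz + (fromℕ# s + 1#) * (R′ * iw) - z))
          ≈⟨ +-cong (*-congˡ b≈) (*-congʳ b≈) ⟩
        κ * x (onPath i₀) + x (onPath i₀) * (g * (θ + fromℕ# s * iz + (fromℕ# s + 1#) * (R′ * iw) - z)) ∎
        where
        open ≈R
        b g : Carrier
        b = X (suc j)
        g = (z + ρ) * iz₁
        b≈ : b ≈ x (onPath i₀)
        b≈ = ≈-trans (≈-reflexive (≡.cong X j≡)) (≈-sym (x-onPath i₀))
        before : ∀ i → suc j ≡ toℕ i → beforeSum i ≈ S j - X (suc j)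
        before (suc i) eq = ≈-trans (beforeSum-suc i) (≈-reflexive (≡.cong (λ k → S k - X (suc k)) (≡.sym (ℕ.suc-injective eq))))
        pendants : (z + ρ) * (b * iz) - b ≈ b * (g * (iz + R′ * iw))
        pendants = begin
          (z + ρ) * (b * iz) - b
            ≈⟨ solve 4 (λ z r b i → (z :+ r) :* (b :* i) :- b := b :* (z :* i) :+ b :* r :* i :- b) ≈-refl z ρ b iz ⟩
          b * (z * iz) + b * ρ * iz - b ≈⟨ +-congʳ (+-congʳ (*-congˡ (inv-inverse z 0<z))) ⟩
          b * 1# + b * ρ * iz - b
            ≈⟨ solve 3 (λ b r i → b :* num 1 :+ b :* r :* i :- b := b :* r :* i :* num 1) ≈-refl b ρ iz ⟩
          b * ρ * iz * 1# ≈⟨ *-congˡ (inv-inverse (z + 1#) z+1>0) ⟨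
          b * ρ * iz * ((z + 1#) * iz₁)
            ≈⟨ solve 5 (λ b r i z i₁ → b :* r :* i :* ((z :+ num 1) :* i₁) := b :* i₁ :* (r :* (z :* i) :+ r :* i)) ≈-refl b ρ iz z iz₁ ⟩
          b * iz₁ * (ρ * (z * iz) + ρ * iz) ≈⟨ *-congˡ (+-congʳ (*-congˡ (inv-inverse z 0<z))) ⟩
          b * iz₁ * (ρ * 1# + ρ * iz)
            ≈⟨ solve 4 (λ b i₁ R i → b :* i₁ :* ((num 1 :+ R) :* num 1 :+ (num 1 :+ R) :* i)
                 := b :* i₁ :* (num 1 :+ (num 1 :+ R) :* i :+ R :* num 1)) ≈-refl b iz₁ R′ iz ⟩
          b * iz₁ * (1# + ρ * iz + R′ * 1#) ≈⟨ *-congˡ (+-cong (+-congʳ (inv-inverse z 0<z)) (*-congˡ w*iw)) ⟨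
          b * iz₁ * (z * iz + ρ * iz + R′ * ((z + ρ) * iw))
            ≈⟨ solve 7 (λ b i₁ z i r R iw → b :* i₁ :* (z :* i :+ r :* i :+ R :* ((z :+ r) :* iw))
                 := b :* ((z :+ r) :* i₁ :* (i :+ R :* iw))) ≈-refl b iz₁ z iz ρ R′ iw ⟩
          b * (g * (iz + R′ * iw)) ∎

  -- Ratios along a path

  inv<1 : ∀ x (0<x : 0# < x) → 1# < x → inv x 0<x < 1#
  inv<1 x 0<x 1<x = <-resp (*-identityʳ _) (≈-trans (*-comm _ _) (inv-inverse x 0<x)) (*-monoˡ-< (inv-pos x 0<x) 1<x)

  inv-difference : ∀ x y (0<x : 0# < x) (0<y : 0# < y) →
    inv x 0<x - inv y 0<y ≈ inv x 0<x * inv y 0<y * (y - x)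
  inv-difference x y 0<x 0<y = begin
    i - j ≈⟨ +-cong (≈-sym (*-identityʳ i)) (-‿cong (≈-sym (*-identityʳ j))) ⟩
    i * 1# - j * 1# ≈⟨ +-cong (*-congˡ (≈-sym (inv-inverse y 0<y))) (-‿cong (*-congˡ (≈-sym (inv-inverse x 0<x)))) ⟩
    i * (y * j) - j * (x * i) ≈⟨ solve 4 (λ x y i j → i :* (y :* j) :- j :* (x :* i) := i :* j :* (y :- x)) ≈-refl x y i j ⟩
    i * j * (y - x) ∎
    where
    open ≈R
    i = inv x 0<x
    j = inv y 0<y

  *-≤1 : ∀ {x y} → 0# ≤ x → x ≤ 1# → y ≤ 1# → x * y ≤ 1#
  *-≤1 {x} {y} 0≤x x≤1 y≤1 = ≤-trans (≤-resp ≈-refl (*-identityʳ x) (*-monoˡ-≤ 0≤x y≤1)) x≤1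

  -- Here z + R′ is r λ for an eigenvalue λ, with r = R′ + 1.  Along a path
  -- with pendant end, the ratios of consecutive entries of an eigenvector are
  -- then ratio 0 = 1 / z and ratio (n + 1) = 1 / (τ - ratio n).
  module Ratios (r′ : ℕ) where
    private
      R′ ρ : Carrier
      R′ = fromℕ# r′
      ρ = fromℕ# (suc r′)

      R′≥0 : 0# ≤ R′
      R′≥0 = fromℕ#-nonneg r′

    module _ (z : Carrier) (1<z : 1# < z) where
      0<z′ : 0# < z
      0<z′ = <-trans 0<1 1<z

      z+ρ>0 : 0# < z + ρ
      z+ρ>0 = +-pos 0<z′ (fromℕ#-pos r′)

      iz iw τ : Carrier
      iz = inv z 0<z′
      iw = inv (z + ρ) z+ρ>0
      τ = z - R′ * iw

      iw>0 : 0# < iw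
      iw>0 = inv-pos (z + ρ) z+ρ>0

      iw<1 : iw < 1#
      iw<1 = inv<1 (z + ρ) z+ρ>0 (<-trans 1<z (<-by ρ (fromℕ#-pos r′) (solve 2 (λ z r → z :+ r :- z := r) ≈-refl z ρ)))

      R′iw≤1 : R′ * iw ≤ 1#
      R′iw≤1 = ≤-by ((z + 1#) * iw) (*-nonneg (<⇒≤ (+-pos 0<z′ 0<1)) (<⇒≤ iw>0))
        (≈-trans (+-congʳ (≈-sym (inv-inverse (z + ρ) z+ρ>0)))
          (solve 3 (λ z R i → (z :+ (num 1 :+ R)) :* i :- R :* i := (z :+ num 1) :* i) ≈-refl z R′ iw))

      τ≤z : τ ≤ z
      τ≤z = ≤-by (R′ * iw) (*-nonneg R′≥0 (<⇒≤ iw>0)) (solve 2 (λ z q → z :- (z :- q) := q) ≈-refl z (R′ * iw))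

    -- With τ ≥ 2, a growth factor g > 1 is followed by τ - 1 / g > 1, so all ratios exist and lie
    -- between 0 and 1.
    record Admissible (z : Carrier) : Set ℓ₂ where
      field
        1<z : 1# < z
        2≤τ : lit 2 ≤ τ z 1<z

    module Sequence (z : Carrier) (adm : Admissible z) where
      open Admissible adm

      growth : ℕ → Σ[ g ∈ Carrier ] 1# < g
      growth zero    = z , 1<z
      growth (suc n) = τ z 1<z - inv g (<-trans 0<1 1<g) , <-≤-trans
        (<-by (1# - inv g (<-trans 0<1 1<g)) (<⇒0<- (inv<1 g (<-trans 0<1 1<g) 1<g))
          (solve 1 (λ i → num 2 :- i :- num 1 := num 1 :- i) ≈-refl (inv g (<-trans 0<1 1<g))))
        (+-mono-≤ 2≤τ ≤-refl)
        where
        g = proj₁ (growth n)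
        1<g = proj₂ (growth n)

      g : ℕ → Carrier
      g n = proj₁ (growth n)

      g>1 : ∀ n → 1# < g n
      g>1 n = proj₂ (growth n)

      g>0 : ∀ n → 0# < g n
      g>0 n = <-trans 0<1 (g>1 n)

      ratio : ℕ → Carrier
      ratio n = inv (g n) (g>0 n)

      ratio>0 : ∀ n → 0# < ratio n
      ratio>0 n = inv-pos (g n) (g>0 n)

      ratio<1 : ∀ n → ratio n < 1#
      ratio<1 n = inv<1 (g n) (g>0 n) (g>1 n)

      ratio*ratio<1 : ∀ m n → ratio m * ratio n < 1#
      ratio*ratio<1 m n = <-trans (<-respʳ-≈ (*-identityʳ _) (*-monoˡ-< (ratio>0 m) (ratio<1 n))) (ratio<1 m)

      step : ℕ → Carrier
      step n = ratio (suc n) - ratio n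

      -- Under x ↦ 1 / (τ - x) a difference is multiplied by the product of the two images. As
      -- ratios are below 1, the steps stay positive and decrease, which is the concavity.
      step-suc : ∀ n → step (suc n) ≈ ratio (suc (suc n)) * ratio (suc n) * step n
      step-suc n = ≈-trans (inv-difference (g (suc (suc n))) (g (suc n)) (g>0 (suc (suc n))) (g>0 (suc n)))
        (*-congˡ (solve 3 (λ τ a b → τ :- a :- (τ :- b) := b :- a) ≈-refl (τ z 1<z) (ratio n) (ratio (suc n))))

      step>0 : ∀ n → 0# < step n
      step>0 zero = <-respʳ-≈ (≈-sym (inv-difference (g 1) z (g>0 1) (g>0 0)))
        (*-pos (*-pos (ratio>0 1) (ratio>0 0)) (<-respʳ-≈
          (solve 3 (λ z τ i → (z :- τ) :+ i := z :- (τ :- i)) ≈-refl z (τ z 1<z) (ratio 0))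
          (+-nonneg-pos (≤⇒0≤- (τ≤z z 1<z)) (ratio>0 0))))
      step>0 (suc n) = <-respʳ-≈ (≈-sym (step-suc n)) (*-pos (*-pos (ratio>0 (suc (suc n))) (ratio>0 (suc n))) (step>0 n))

      step-decreasing : ∀ n → step (suc n) < step n
      step-decreasing n = <-resp (≈-trans (*-comm _ _) (≈-sym (step-suc n))) (*-identityʳ _)
        (*-monoˡ-< (step>0 n) (ratio*ratio<1 (suc (suc n)) (suc n)))

      step-mono : ∀ n j → step (suc (j ℕ.+ n)) < step n
      step-mono n zero    = step-decreasing n
      step-mono n (suc j) = <-trans (step-decreasing (suc (j ℕ.+ n))) (step-mono n j)

      -- Induction on the half width: moving both ends inwards by one raises the sum, since the step
      -- at the lower end exceeds the step at the upper end.
      concave : ∀ j n → ratio n + ratio (suc j ℕ.+ suc j ℕ.+ n) < lit 2 * ratio (suc j ℕ.+ n)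
      concave j n = <-≤-trans (<-by (step n - step (suc (j ℕ.+ j) ℕ.+ n)) (<⇒0<- (step-mono n (j ℕ.+ j)))
          (≈-trans (+-congˡ (-‿cong (+-congˡ (≈-reflexive (≡.cong (λ k → ratio (suc k ℕ.+ n)) (ℕ.+-suc j j))))))
            (solve 4 (λ a b c d → (b :+ c) :- (a :+ d) := (b :- a) :- (d :- c)) ≈-refl
              (ratio n) (ratio (suc n)) (ratio (suc (j ℕ.+ j) ℕ.+ n)) (ratio (suc (suc (j ℕ.+ j) ℕ.+ n))))))
        (inner j)
        where
        inner : ∀ j → ratio (suc n) + ratio (suc (j ℕ.+ j) ℕ.+ n) ≤ lit 2 * ratio (suc j ℕ.+ n)
        inner zero    = ≤-reflexive (solve 1 (λ x → x :+ x := num 2 :* x) ≈-refl (ratio (suc n)))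
        inner (suc j) = ≤-resp (+-congˡ (≈-reflexive (≡.cong ratio (eq j)))) (*-congˡ (≈-reflexive (≡.cong ratio (ℕ.+-suc (suc j) n)))) (<⇒≤ (concave j (suc n)))
          where
          eq : ∀ j → suc j ℕ.+ suc j ℕ.+ suc n ≡ suc (suc j ℕ.+ suc j) ℕ.+ n
          eq j = ℕ.+-suc (suc j ℕ.+ suc j) n

      iz≤ratio : ∀ n → iz z 1<z ≤ ratio n
      iz≤ratio zero    = ≤-by 0# ≤-refl (-‿inverseʳ′ _ _ ≈-refl)
        where
        -‿inverseʳ′ : ∀ x y → x ≈ y → x - y ≈ 0#
        -‿inverseʳ′ x y p = ≈-trans (+-congʳ p) (-‿inverseʳ y)
      iz≤ratio (suc n) = ≤-trans (iz≤ratio n) (<⇒≤ (0<-⇒< (step>0 n)))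

      -- The first entries of the eigenvector, from the pendant end.
      entry : ℕ → Carrier
      entry zero    = 1#
      entry (suc n) = entry n * g n

      entry>0 : ∀ n → 0# < entry n
      entry>0 zero    = 0<1
      entry>0 (suc n) = *-pos (entry>0 n) (g>0 n)

      entry-ratio : ∀ n → entry n ≈ ratio n * entry (suc n)
      entry-ratio n = ≈-sym (≈-trans (solve 3 (λ i e g → i :* (e :* g) := (g :* i) :* e) ≈-refl (ratio n) (entry n) (g n))
        (1*-cong _ (inv-inverse (g n) (g>0 n))))

      entry-recurrence : ∀ n → entry n + entry (suc (suc n)) ≈ τ z 1<z * entry (suc n)
      entry-recurrence n = ≈-trans (+-congʳ (entry-ratio n))
        (solve 3 (λ i e τ → i :* e :+ e :* (τ :- i) := τ :* e) ≈-refl (ratio n) (entry (suc n)) (τ z 1<z))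

  -- Existence of the Perron root

  -- A function on [a, ∞) with slopes between 1 and M, nonpositive at a, has a
  -- zero: u ↦ u - h u / M increases and keeps h nonpositive, and since slopes
  -- are at least 1 the distance to later iterates is at most - h u, which
  -- decreases geometrically.
  module Zero (a M : Carrier) (M>0 : 0# < M)
              (h : ∀ u → a ≤ u → Carrier)
              (lower : ∀ u v p q → u ≤ v → v - u ≤ h v q - h u p)
              (upper : ∀ u v p q → u ≤ v → h v q - h u p ≤ M * (v - u))
              (start≤0 : h a ≤-refl ≤ 0#) where
    private
      iM : Carrier
      iM = inv M M>0

      iM>0 : 0# < iM
      iM>0 = inv-pos M M>0

      Point : Set (ℓ₀ ⊔ ℓ₂)
      Point = Σ[ u ∈ Carrier ] Σ[ p ∈ a ≤ u ] h u p ≤ 0#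

      advance : ∀ u p → h u p ≤ 0# → u ≤ u - h u p * iM
      advance u p h≤0 = ≤-by ((0# - h u p) * iM) (*-nonneg (≤⇒0≤- h≤0) (<⇒≤ iM>0))
        (solve 3 (λ u h i → u :- h :* i :- u := (num 0 :- h) :* i) ≈-refl u (h u p) iM)

      next : Point → Point
      next (u , p , h≤0) = u - h u p * iM , ≤-trans p (advance u p h≤0) ,
        ≤-by _ (≤⇒0≤- (upper u (u - h u p * iM) p (≤-trans p (advance u p h≤0)) (advance u p h≤0)))
          (≈-sym (≈-trans (+-congʳ (≈-trans
              (solve 4 (λ M i u h → M :* (u :- h :* i :- u) := :- (h :* (M :* i))) ≈-refl M iM u (h u p))
              (-‿cong (≈-trans (*-congˡ (inv-inverse M M>0)) (*-identityʳ _)))))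
            (solve 2 (λ h h′ → :- h :- (h′ :- h) := num 0 :- h′) ≈-refl (h u p) (h (u - h u p * iM) (≤-trans p (advance u p h≤0))))))

      point : ℕ → Point
      point zero    = a , ≤-refl , start≤0
      point (suc n) = next (point n)

      u : ℕ → Carrier
      u n = proj₁ (point n)

      a≤u : ∀ n → a ≤ u n
      a≤u n = proj₁ (proj₂ (point n))

      hu : ℕ → Carrier
      hu n = h (u n) (a≤u n)

      hu≤0 : ∀ n → hu n ≤ 0#
      hu≤0 n = proj₂ (proj₂ (point n))

      u-mono : ∀ m n → u m ≤ u (n ℕ.+ m)
      u-mono m zero    = ≤-refl
      u-mono m (suc n) = ≤-trans (u-mono m n) (advance _ _ (hu≤0 (n ℕ.+ m)))

      later : ∀ m n → u (n ℕ.+ m) ≤ u m - hu m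
      later m n = ≤-by (hu (n ℕ.+ m) - hu m - (u (n ℕ.+ m) - u m) + (0# - hu (n ℕ.+ m)))
        (+-nonneg (≤⇒0≤- (lower _ _ _ _ (u-mono m n))) (≤⇒0≤- (hu≤0 (n ℕ.+ m))))
        (solve 4 (λ h′ h u′ u → u :- h :- u′ := h′ :- h :- (u′ :- u) :+ (num 0 :- h′)) ≈-refl (hu (n ℕ.+ m)) (hu m) (u (n ℕ.+ m)) (u m))

      decay-step : ∀ n → hu n * (1# - iM) ≤ hu (suc n)
      decay-step n = ≤-by _ (≤⇒0≤- (lower _ _ (a≤u n) (a≤u (suc n)) (advance _ _ (hu≤0 n))))
        (solve 4 (λ h′ h u i → h′ :- h :* (num 1 :- i) := h′ :- h :- (u :- h :* i :- u)) ≈-refl (hu (suc n)) (hu n) (u n) iM)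

      -- A Bernoulli form of the geometric decay with factor 1 - 1 / M: being linear in `n`, it can
      -- be used directly with the Archimedean property.
      decay : ∀ n → (0# - hu n) * (1# + fromℕ# n * iM) ≤ 0# - hu 0
      decay zero    = ≤-reflexive (solve 2 (λ h i → (num 0 :- h) :* (num 1 :+ num 0 :* i) := num 0 :- h) ≈-refl (hu 0) iM)
      decay (suc n) = ≤-trans (≤-by
        ((hu (suc n) - hu n * (1# - iM)) * (1# + fromℕ# (suc n) * iM) + (0# - hu n) * (fromℕ# (suc n) * (iM * iM)))
        (+-nonneg (*-nonneg (≤⇒0≤- (decay-step n)) (+-nonneg (<⇒≤ 0<1) (*-nonneg (fromℕ#-nonneg (suc n)) (<⇒≤ iM>0))))
          (*-nonneg (≤⇒0≤- (hu≤0 n)) (*-nonneg (fromℕ#-nonneg (suc n)) (sq-nonneg iM))))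
        (solve 4 (λ h′ h n i → let n′ = num 1 :+ n in
           (num 0 :- h) :* (num 1 :+ n :* i) :- (num 0 :- h′) :* (num 1 :+ n′ :* i)
             := (h′ :- h :* (num 1 :- i)) :* (num 1 :+ n′ :* i) :+ (num 0 :- h) :* (n′ :* (i :* i)))
           ≈-refl (hu (suc n)) (hu n) (fromℕ# n) iM)) (decay n)

      small : ∀ ε → 0# < ε → ∃[ n ] 0# - hu n < ε
      small ε 0<ε = found (archimedean ((0# - hu 0) * (M * inv ε 0<ε)))
        where
        bound : ∀ n → (0# - hu 0) * (M * inv ε 0<ε) < fromℕ# n → 0# - hu 0 < ε * (fromℕ# n * iM)
        bound n p = <-resp
          (≈-trans (solve 5 (λ e i h M ie → e :* i :* (h :* (M :* ie)) := (e :* ie) :* ((M :* i) :* h)) ≈-refl ε iM (0# - hu 0) M (inv ε 0<ε))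
            (≈-trans (1*-cong _ (inv-inverse ε 0<ε)) (1*-cong _ (inv-inverse M M>0))))
          (solve 3 (λ e i n → e :* i :* n := e :* (n :* i)) ≈-refl ε iM (fromℕ# n))
          (*-monoˡ-< (*-pos 0<ε iM>0) p)
        found : (∃[ n ] (0# - hu 0) * (M * inv ε 0<ε) < fromℕ# n) → ∃[ n ] 0# - hu n < ε
        found (n , p) = n , 0<-⇒< (*-cancel-pos (1# + fromℕ# n * iM)
              (+-pos-nonneg 0<1 (*-nonneg (fromℕ#-nonneg n) (<⇒≤ iM>0)))
              (<-respʳ-≈ (solve 3 (λ c ε h → ε :* c :- h :* c := c :* (ε :- h)) ≈-refl (1# + fromℕ# n * iM) ε (0# - hu n))
                (<⇒0<- (≤-<-trans (decay n) (<-trans (bound n p) (<-by ε 0<ε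
                  (solve 3 (λ ε n i → ε :* (num 1 :+ n :* i) :- ε :* (n :* i) := ε) ≈-refl ε (fromℕ# n) iM)))))))

      cauchy : IsCauchy u
      cauchy ε 0<ε = found (small ε 0<ε)
        where
        found : (∃[ n ] 0# - hu n < ε) → ∃[ n ] ∀ i j → n ℕ.≤ i → n ℕ.≤ j → u i < u j + ε
        found (n , small-n) = n , λ i j n≤i n≤j → ≤-<-trans
            (≡.subst (λ k → u k ≤ u n - hu n) (ℕ.m∸n+n≡m n≤i) (later n (i ℕ.∸ n)))
            (<-≤-trans (<-by (ε - (0# - hu n)) (<⇒0<- small-n)
                (solve 3 (λ u h e → u :+ e :- (u :- h) := e :- (num 0 :- h)) ≈-refl (u n) (hu n) ε))
              (+-mono-≤ (≡.subst (λ k → u n ≤ u k) (ℕ.m∸n+n≡m n≤j) (u-mono n (j ℕ.∸ n))) ≤-refl))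

    zero-point : Carrier
    zero-point = proj₁ (complete u cauchy)

    private
      l : Carrier
      l = zero-point

      converges : u ConvergesTo l
      converges = proj₂ (complete u cauchy)

      u≤l : ∀ n → u n ≤ l
      u≤l n l<un = found (converges (u n - l) (<⇒0<- l<un))
        where
        found : (∃[ N ] ∀ i → N ℕ.≤ i → u i < l + (u n - l) × l < u i + (u n - l)) → ⊥
        found (N , p) = u-mono n N (<-respʳ-≈ (solve 2 (λ l u → l :+ (u :- l) := u) ≈-refl l (u n))
            (proj₁ (p (N ℕ.+ n) (ℕ.m≤m+n N n))))

    zero-point≥ : a ≤ zero-point
    zero-point≥ = u≤l 0

    zero-point-zero : h zero-point zero-point≥ ≈ 0#
    zero-point-zero = ≤-antisym h≤0 h≥0
      where
      hl : Carrier
      hl = h l zero-point≥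
      h≥0 : 0# ≤ hl
      h≥0 hl<0 = found (small (0# - hl) (<⇒0<- hl<0))
        where
        found : (∃[ n ] 0# - hu n < 0# - hl) → ⊥
        found (n , p) = lower (u n) l (a≤u n) zero-point≥ (u≤l n) (<-≤-trans
            (<-by _ (<⇒0<- p) (solve 2 (λ h h′ → num 0 :- (h′ :- h) := num 0 :- h′ :- (num 0 :- h)) ≈-refl (hu n) hl)) (≤⇒0≤- (u≤l n)))
      h≤0 : hl ≤ 0#
      h≤0 0<hl = found (converges (hl * iM) (*-pos 0<hl iM>0))
        where
        found : (∃[ n ] ∀ i → n ℕ.≤ i → u i < l + hl * iM × l < u i + hl * iM) → ⊥
        found (n , p) = upper (u n) l (a≤u n) zero-point≥ (u≤l n) (<-≤-trans
              (<-by (M * (u n + hl * iM - l)) (*-pos M>0 (<⇒0<- (proj₂ (p n ℕ.≤-refl))))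
                (≈-trans (+-congʳ (≈-trans (≈-sym (*-identityʳ hl)) (*-congˡ (≈-sym (inv-inverse M M>0)))))
                  (solve 5 (λ M u l h i → h :* (M :* i) :- M :* (l :- u) := M :* (u :+ h :* i :- l)) ≈-refl M (u n) l hl iM)))
              (≤-by (0# - hu n) (≤⇒0≤- (hu≤0 n)) (solve 2 (λ h h′ → h′ :- h :- h′ := num 0 :- h) ≈-refl (hu n) hl)))

  *-shrink : ∀ {q x y} → 0# ≤ q → q ≤ 1# → 0# ≤ x → x ≤ y → 0# ≤ q * x × q * x ≤ y
  *-shrink {q} {x} {y} 0≤q q≤1 0≤x x≤y = *-nonneg 0≤q 0≤x ,
    ≤-trans (≤-resp (*-comm _ _) (*-identityʳ _) (*-monoˡ-≤ 0≤x q≤1)) x≤y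

  -- Lipschitz constants of the ratios as functions of z: τ has slope at most 2, and inverting
  -- numbers above 1 does not expand distances.
  slope : ℕ → Carrier
  slope zero    = 1#
  slope (suc n) = lit 2 + slope n

  slope>0 : ∀ n → 0# < slope n
  slope>0 zero    = 0<1
  slope>0 (suc n) = +-pos (lit-pos 1) (slope>0 n)

  module _ (r′ : ℕ) where
    open Ratios r′
    private
      R′ ρ : Carrier
      R′ = fromℕ# r′
      ρ = fromℕ# (suc r′)

      R′≥0 : 0# ≤ R′
      R′≥0 = fromℕ#-nonneg r′

    module _ {u v : Carrier} (1<u : 1# < u) (1<v : 1# < v) (u≤v : u ≤ v) where
      iw-antitone : 0# ≤ R′ * (iw u 1<u - iw v 1<v) × R′ * (iw u 1<u - iw v 1<v) ≤ v - u
      iw-antitone = ≤-resp ≈-refl eq (proj₁ shrunk) , ≤-resp eq ≈-refl (proj₂ shrunk)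
        where
        shrunk = *-shrink (*-nonneg (*-nonneg R′≥0 (<⇒≤ (iw>0 u 1<u))) (<⇒≤ (iw>0 v 1<v)))
          (*-≤1 (*-nonneg R′≥0 (<⇒≤ (iw>0 u 1<u))) (R′iw≤1 u 1<u) (<⇒≤ (iw<1 v 1<v))) (≤⇒0≤- u≤v) ≤-refl
        eq : R′ * iw u 1<u * iw v 1<v * (v - u) ≈ R′ * (iw u 1<u - iw v 1<v)
        eq = ≈-trans (solve 6 (λ R i j u v r → R :* i :* j :* (v :- u) := R :* (i :* j :* (v :+ r :- (u :+ r)))) ≈-refl R′ (iw u 1<u) (iw v 1<v) u v ρ)
          (*-congˡ (≈-sym (inv-difference (u + ρ) (v + ρ) (z+ρ>0 u 1<u) (z+ρ>0 v 1<v))))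

      τ-monotone : τ u 1<u ≤ τ v 1<v
      τ-monotone = ≤-by _ (+-nonneg (≤⇒0≤- u≤v) (proj₁ iw-antitone))
        (solve 5 (λ u v R i j → v :- R :* j :- (u :- R :* i) := (v :- u) :+ R :* (i :- j)) ≈-refl u v R′ (iw u 1<u) (iw v 1<v))

      τ-slope : τ v 1<v - τ u 1<u ≤ lit 2 * (v - u)
      τ-slope = ≤-by _ (≤⇒0≤- (proj₂ iw-antitone))
        (solve 5 (λ u v R i j → num 2 :* (v :- u) :- (v :- R :* j :- (u :- R :* i)) := v :- u :- R :* (i :- j)) ≈-refl u v R′ (iw u 1<u) (iw v 1<v))

    admissible-≥ : ∀ {u v} → Admissible u → u ≤ v → Admissible v
    admissible-≥ {u} {v} adm u≤v = record { 1<z = 1<v ; 2≤τ = ≤-trans (Admissible.2≤τ adm) (τ-monotone (Admissible.1<z adm) 1<v u≤v) }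
      where
      1<v : 1# < v
      1<v = <-≤-trans (Admissible.1<z adm) u≤v

    module _ {u v : Carrier} (au : Admissible u) (av : Admissible v) (u≤v : u ≤ v) where
      private
        module U = Sequence u au
        module V = Sequence v av
        1<u = Admissible.1<z au
        1<v = Admissible.1<z av

      ratio-antitone : ∀ n → 0# ≤ U.ratio n - V.ratio n × U.ratio n - V.ratio n ≤ slope n * (v - u)
      ratio-antitone n = ≤-resp ≈-refl eq (proj₁ (shrunk n)) , ≤-resp eq ≈-refl (proj₂ (shrunk n))
        where
        eq : U.ratio n * V.ratio n * (V.g n - U.g n) ≈ U.ratio n - V.ratio n
        eq = ≈-sym (inv-difference (U.g n) (V.g n) (U.g>0 n) (V.g>0 n))
        growth-monotone : ∀ n → 0# ≤ V.g n - U.g n × V.g n - U.g n ≤ slope n * (v - u)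
        shrunk : ∀ n → 0# ≤ U.ratio n * V.ratio n * (V.g n - U.g n) × U.ratio n * V.ratio n * (V.g n - U.g n) ≤ slope n * (v - u)
        shrunk n = *-shrink (<⇒≤ (*-pos (U.ratio>0 n) (V.ratio>0 n)))
          (*-≤1 (<⇒≤ (U.ratio>0 n)) (<⇒≤ (U.ratio<1 n)) (<⇒≤ (V.ratio<1 n))) (proj₁ (growth-monotone n)) (proj₂ (growth-monotone n))
        growth-monotone zero    = ≤⇒0≤- u≤v , ≤-reflexive (≈-sym (*-identityˡ _))
        growth-monotone (suc n) = ≤-resp ≈-refl (≈-sym expand) (+-nonneg (≤⇒0≤- (τ-monotone 1<u 1<v u≤v)) (proj₁ (ratio-antitone n))) ,
          ≤-resp (≈-sym expand) (≈-sym (distribʳ _ _ _)) (+-mono-≤ (τ-slope 1<u 1<v u≤v) (proj₂ (ratio-antitone n)))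
          where
          expand : V.g (suc n) - U.g (suc n) ≈ (τ v 1<v - τ u 1<u) + (U.ratio n - V.ratio n)
          expand = solve 4 (λ a b c d → a :- c :- (b :- d) := (a :- b) :+ (d :- c)) ≈-refl (τ v 1<v) (τ u 1<u) (V.ratio n) (U.ratio n)

    -- Its zeros are the positions z of the Perron root when a path with s
    -- pendant edges at the centre has n further vertices on either side.
    defect : ℕ → ℕ → ∀ z → Admissible z → Carrier
    defect n s z adm = z - lit 2 * Sequence.ratio z adm n - fromℕ# s * Sequence.ratio z adm 0
      - (fromℕ# s + 1#) * (R′ * iw z (Admissible.1<z adm))

    -- Because `ratio n` is at least 1 / z, the defect does not exceed the one with both arms cut
    -- down to a single edge. That hypertree is a star with s + 2 edges, whose equation is z κ = (s
    -- + 2) r.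
    defect-≤ : ∀ n s z adm → defect n s z adm ≤
      Sequence.ratio z adm 0 * iw z (Admissible.1<z adm) * (z + 1#) * (z * (z + ρ - 1#) - (fromℕ# s + lit 2) * ρ)
    defect-≤ n s z adm = ≤-by (lit 2 * (ratio n - ratio 0)) (*-nonneg (lit-nonneg 2) (≤⇒0≤- (iz≤ratio n)))
      (≈-trans (+-congʳ polynomial) (solve 5 (λ z t i s q → z :- (s :+ num 2) :* i :- (s :+ num 1) :* q :- (z :- num 2 :* t :- s :* i :- (s :+ num 1) :* q)
          := num 2 :* (t :- i)) ≈-refl z (ratio n) (ratio 0) (fromℕ# s) (R′ * iw z 1<z)))
      where
      open Sequence z adm
      open Admissible adm
      open ≈R
      i j S : Carrier
      i = ratio 0
      j = iw z 1<z
      S = fromℕ# s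
      zi : z * i ≈ 1#
      zi = inv-inverse z (g>0 0)
      wj : (z + ρ) * j ≈ 1#
      wj = inv-inverse (z + ρ) (z+ρ>0 z 1<z)
      polynomial : i * j * (z + 1#) * (z * (z + ρ - 1#) - (S + lit 2) * ρ) ≈ z - (S + lit 2) * i - (S + 1#) * (R′ * j)
      polynomial = begin
        i * j * (z + 1#) * (z * (z + ρ - 1#) - (S + lit 2) * ρ)
          ≈⟨ solve 5 (λ i j z R S → let r = num 1 :+ R in
               i :* j :* (z :+ num 1) :* (z :* (z :+ r :- num 1) :- (S :+ num 2) :* r)
               := (z :* i) :* z :* ((z :+ r) :* j) :- (S :+ num 2) :* i :* ((z :+ r) :* j) :- (S :+ num 1) :* (R :* j) :* (z :* i))
               ≈-refl i j z R′ S ⟩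
        (z * i) * z * ((z + ρ) * j) - (S + lit 2) * i * ((z + ρ) * j) - (S + 1#) * (R′ * j) * (z * i)
          ≈⟨ +-cong (+-cong (*-cong (*-congʳ zi) wj) (-‿cong (*-congˡ wj))) (-‿cong (*-congˡ zi)) ⟩
        1# * z * 1# - (S + lit 2) * i * 1# - (S + 1#) * (R′ * j) * 1#
          ≈⟨ solve 4 (λ z S i q → num 1 :* z :* num 1 :- (S :+ num 2) :* i :* num 1 :- (S :+ num 1) :* q :* num 1
               := z :- (S :+ num 2) :* i :- (S :+ num 1) :* q) ≈-refl z S i (R′ * j) ⟩
        z - (S + lit 2) * i - (S + 1#) * (R′ * j) ∎

    module _ (n s : ℕ) (a : Carrier) (adm-a : Admissible a)
             (start : a * (a + ρ - 1#) ≤ (fromℕ# s + lit 2) * ρ) where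
      private
        adm : ∀ {u} → a ≤ u → Admissible u
        adm = admissible-≥ adm-a

        h : ∀ u → a ≤ u → Carrier
        h u p = defect n s u (adm p)

        M S : Carrier
        S = fromℕ# s
        M = 1# + lit 2 * slope n + S + (S + 1#)

        S≥0 : 0# ≤ S
        S≥0 = fromℕ#-nonneg s

        M>0 : 0# < M
        M>0 = +-pos-nonneg (+-pos-nonneg (+-pos 0<1 (*-pos (lit-pos 1) (slope>0 n))) S≥0) (+-nonneg S≥0 (<⇒≤ 0<1))

        module Slopes (u v : Carrier) (p : a ≤ u) (q : a ≤ v) (u≤v : u ≤ v) where
          open Admissible
          t i j : Carrier
          t = Sequence.ratio u (adm p) n - Sequence.ratio v (adm q) n
          i = Sequence.ratio u (adm p) 0 - Sequence.ratio v (adm q) 0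
          j = R′ * (iw u (adm p .1<z) - iw v (adm q .1<z))
          t∈ : 0# ≤ t × t ≤ slope n * (v - u)
          t∈ = ratio-antitone (adm p) (adm q) u≤v n
          i∈ : 0# ≤ i × i ≤ 1# * (v - u)
          i∈ = ratio-antitone (adm p) (adm q) u≤v 0
          j∈ : 0# ≤ j × j ≤ v - u
          j∈ = iw-antitone (adm p .1<z) (adm q .1<z) u≤v
          difference : h v q - h u p ≈ (v - u) + (lit 2 * t + S * i + (S + 1#) * j)
          difference = solve 10 (λ u v tu tv iu iv R wu wv S →
              (v :- num 2 :* tv :- S :* iv :- (S :+ num 1) :* (R :* wv)) :- (u :- num 2 :* tu :- S :* iu :- (S :+ num 1) :* (R :* wu))
              := (v :- u) :+ (num 2 :* (tu :- tv) :+ S :* (iu :- iv) :+ (S :+ num 1) :* (R :* (wu :- wv))))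
            ≈-refl u v (Sequence.ratio u (adm p) n) (Sequence.ratio v (adm q) n) (Sequence.ratio u (adm p) 0) (Sequence.ratio v (adm q) 0)
              R′ (iw u (adm p .1<z)) (iw v (adm q .1<z)) S
          lower : v - u ≤ h v q - h u p
          lower = ≤-by (lit 2 * t + S * i + (S + 1#) * j)
            (+-nonneg (+-nonneg (*-nonneg (lit-nonneg 2) (proj₁ t∈)) (*-nonneg S≥0 (proj₁ i∈)))
              (*-nonneg (+-nonneg S≥0 (<⇒≤ 0<1)) (proj₁ j∈)))
            (≈-trans (+-congʳ difference) (solve 2 (λ x y → x :+ y :- x := y) ≈-refl (v - u) (lit 2 * t + S * i + (S + 1#) * j)))
          upper : h v q - h u p ≤ M * (v - u)
          upper = ≤-by (lit 2 * (slope n * (v - u) - t) + S * (1# * (v - u) - i) + (S + 1#) * (v - u - j))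
            (+-nonneg (+-nonneg (*-nonneg (lit-nonneg 2) (≤⇒0≤- (proj₂ t∈))) (*-nonneg S≥0 (≤⇒0≤- (proj₂ i∈))))
              (*-nonneg (+-nonneg S≥0 (<⇒≤ 0<1)) (≤⇒0≤- (proj₂ j∈))))
            (≈-trans (+-congˡ (-‿cong difference)) (solve 6 (λ x c S t i j →
               (num 1 :+ num 2 :* c :+ S :+ (S :+ num 1)) :* x :- (x :+ (num 2 :* t :+ S :* i :+ (S :+ num 1) :* j))
               := num 2 :* (c :* x :- t) :+ S :* (num 1 :* x :- i) :+ (S :+ num 1) :* (x :- j))
               ≈-refl (v - u) (slope n) S t i j))

        start≤0 : h a ≤-refl ≤ 0#
        start≤0 = ≤-trans (defect-≤ n s a (adm ≤-refl)) (≤-resp (-‿involutive′ _) ≈-refl (≤-by _ (*-nonneg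
            (*-nonneg (<⇒≤ (*-pos (Sequence.ratio>0 a (adm ≤-refl) 0) (iw>0 a _))) (<⇒≤ (+-pos (0<z′ a (Admissible.1<z adm-a)) 0<1)))
            (≤⇒0≤- start))
          (solve 3 (λ q x y → num 0 :- (:- :- (q :* (x :- y))) := q :* (y :- x)) ≈-refl
            (Sequence.ratio a (adm ≤-refl) 0 * iw a (Admissible.1<z (adm ≤-refl)) * (a + 1#)) (a * (a + ρ - 1#)) ((fromℕ# s + lit 2) * ρ))))
          where
          -‿involutive′ : ∀ x → - - x ≈ x
          -‿involutive′ = solve 1 (λ x → :- :- x := x) ≈-refl

        module Z = Zero a M M>0 h (λ u v p q u≤v → Slopes.lower u v p q u≤v) (λ u v p q u≤v → Slopes.upper u v p q u≤v) start≤0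

      perronRoot : Σ[ z ∈ Carrier ] Σ[ adm ∈ Admissible z ] defect n s z adm ≈ 0#
      perronRoot = Z.zero-point , adm Z.zero-point≥ , Z.zero-point-zero

    -- For s = k - d this is the lower bound r (k - d + 2) ≤ z κ needed for `crude-bound`.
    perronRoot-≥ : ∀ n s z adm → defect n s z adm ≈ 0# → ρ * (fromℕ# s + lit 2) ≤ z * (z + ρ - 1#)
    perronRoot-≥ n s z adm h≈0 = 0≤-⇒≤ (≤-resp ≈-refl (+-congˡ (-‿cong (*-comm _ _)))
      (*-cancel-nonneg (Sequence.ratio z adm 0 * iw z (Admissible.1<z adm) * (z + 1#))
        (*-pos (*-pos (Sequence.ratio>0 z adm 0) (iw>0 z _)) (+-pos (0<z′ z (Admissible.1<z adm)) 0<1))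
        (≤-resp h≈0 ≈-refl (defect-≤ n s z adm))))

  module _ (r′ : ℕ) (d : ℕ) {s : ℕ} (at : Fin s → Fin (suc (d ℕ.* suc r′))) (i₀ : Fin (suc d))
           (1≤i₀ : 1 ℕ.≤ toℕ i₀) (i₀<d : toℕ i₀ ℕ.< d) (at≡ : ∀ j → at j ≡ pathVertex (suc r′) d i₀)
           (z : Carrier) (adm : Ratios.Admissible r′ z) where
    open Ratios r′
    open Sequence z adm
    open Admissible adm
    private
      i : ℕ
      i = toℕ i₀

      ρ κ : Carrier
      ρ = fromℕ# (suc r′)
      κ = z + ρ - 1#

      -- The sequences grown from the two ends of the path, each scaled by the value of the other at
      -- the hub, so that they agree there without a division.
      side : ∀ j → Dec (j ℕ.≤ i) → Carrier
      side j (yes _) = entry j * entry (d ℕ.∸ i)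
      side j (no _)  = entry i * entry (d ℕ.∸ j)

      X : ℕ → Carrier
      X j = side j (j ℕ.≤? i)

      X>0 : ∀ j → 0# < X j
      X>0 j = helper (j ℕ.≤? i)
        where
        helper : ∀ j≤?i → 0# < side j j≤?i
        helper (yes _) = *-pos (entry>0 j) (entry>0 (d ℕ.∸ i))
        helper (no _)  = *-pos (entry>0 i) (entry>0 (d ℕ.∸ j))

      X-left : ∀ {j} → j ℕ.≤ i → X j ≈ entry j * entry (d ℕ.∸ i)
      X-left {j} j≤i = helper (j ℕ.≤? i)
        where
        helper : ∀ j≤?i → side j j≤?i ≈ entry j * entry (d ℕ.∸ i)
        helper (yes _)  = ≈-refl
        helper (no j≰i) = ⊥-elim (j≰i j≤i)

      X-right : ∀ {j} → i ℕ.≤ j → X j ≈ entry i * entry (d ℕ.∸ j)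
      X-right {j} i≤j = helper (j ℕ.≤? i)
        where
        same : i ≡ j → entry j * entry (d ℕ.∸ i) ≈ entry i * entry (d ℕ.∸ j)
        same eq = ≈-reflexive (≡.cong₂ (λ a b → entry a * entry (d ℕ.∸ b)) (≡.sym eq) eq)
        helper : ∀ j≤?i → side j j≤?i ≈ entry i * entry (d ℕ.∸ j)
        helper (yes j≤i) = same (ℕ.≤-antisym i≤j j≤i)
        helper (no _)    = ≈-refl

      module PV = PendantVector r′ d at i₀ 1≤i₀ i₀<d at≡ z (0<z′ z 1<z) X X>0

      first-eq : X 1 ≈ z * X 0
      first-eq = ≈-trans (X-left 1≤i₀) (≈-trans
        (solve 2 (λ z e → num 1 :* z :* e := z :* (num 1 :* e)) ≈-refl z (entry (d ℕ.∸ i))) (*-congˡ (≈-sym (X-left ℕ.z≤n))))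

      last-eq : ∀ j → suc j ≡ d → X j ≈ z * X d
      last-eq j eq = ≈-trans (X-right (ℕ.s≤s⁻¹ (≡.subst (suc i ℕ.≤_) (≡.sym eq) i₀<d)))
        (≈-trans (*-congˡ (≈-reflexive (≡.cong entry (≡.trans (≡.cong (ℕ._∸ j) (≡.sym eq)) (ℕ.m+n∸n≡m 1 j)))))
        (≈-trans (solve 2 (λ e z → e :* (num 1 :* z) := z :* (e :* num 1)) ≈-refl (entry i) z)
          (*-congˡ (≈-sym (≈-trans (X-right (ℕ.<⇒≤ i₀<d)) (*-congˡ (≈-reflexive (≡.cong entry (ℕ.n∸n≡0 d)))))))))

      suc-∸ : ∀ {j} → j ℕ.< d → d ℕ.∸ j ≡ suc (d ℕ.∸ suc j)
      suc-∸ j<d = ℕ.+-∸-assoc 1 j<d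

      inner-eq : ∀ j → suc j ℕ.< d → suc j ≢ i → X j + X (suc (suc j)) ≈ τ z 1<z * X (suc j)
      inner-eq j j<d j≢ = [ leftOf ∘ (λ j≤i → ℕ.≤∧≢⇒< j≤i j≢) , rightOf ]′ (ℕ.≤-<-connex (suc j) i)
        where
        leftOf : suc j ℕ.< i → X j + X (suc (suc j)) ≈ τ z 1<z * X (suc j)
        leftOf j<i = ≈-trans (+-cong (X-left (ℕ.<⇒≤ (ℕ.<-trans (ℕ.n<1+n j) j<i))) (X-left j<i))
          (≈-trans (≈-sym (distribʳ _ _ _)) (≈-trans (*-congʳ (entry-recurrence j)) (≈-trans (*-assoc _ _ _) (*-congˡ (≈-sym (X-left (ℕ.<⇒≤ j<i)))))))
        rightOf : i ℕ.< suc j → X j + X (suc (suc j)) ≈ τ z 1<z * X (suc j)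
        rightOf i<j = ≈-trans (+-cong
            (≈-trans (X-right (ℕ.s≤s⁻¹ i<j)) (*-congˡ (≈-reflexive (≡.cong entry (≡.trans (suc-∸ (ℕ.<-trans (ℕ.n<1+n j) j<d)) (≡.cong suc (suc-∸ j<d)))))))
            (X-right (ℕ.<⇒≤ (ℕ.<-trans i<j (ℕ.n<1+n (suc j))))))
          (≈-trans (solve 3 (λ e a b → e :* a :+ e :* b := e :* (b :+ a)) ≈-refl (entry i) (entry (suc (suc (d ℕ.∸ suc (suc j))))) (entry (d ℕ.∸ suc (suc j))))
          (≈-trans (*-congˡ (entry-recurrence (d ℕ.∸ suc (suc j))))
          (≈-trans (solve 3 (λ e t a → e :* (t :* a) := t :* (e :* a)) ≈-refl (entry i) (τ z 1<z) (entry (suc (d ℕ.∸ suc (suc j)))))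
            (*-congˡ (≈-sym (≈-trans (X-right (ℕ.<⇒≤ i<j)) (*-congˡ (≈-reflexive (≡.cong entry (suc-∸ j<d))))))))))

      centre-eq : ∀ j → suc j ≡ i → X j + X (suc (suc j)) ≈ (ratio j + ratio (d ℕ.∸ suc i)) * X (suc j)
      centre-eq j eq = begin
        X j + X (suc (suc j))
          ≈⟨ +-cong (X-left (≡.subst (j ℕ.≤_) eq (ℕ.n≤1+n j))) (X-right (≡.subst (ℕ._≤ suc (suc j)) eq (ℕ.n≤1+n (suc j)))) ⟩
        entry j * entry (d ℕ.∸ i) + entry i * entry (d ℕ.∸ suc (suc j))
          ≡⟨ ≡.cong₂ (λ a b → entry j * entry a + entry b * entry (d ℕ.∸ suc (suc j))) (suc-∸ i₀<d) (≡.sym eq) ⟩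
        entry j * entry (suc m) + entry (suc j) * entry (d ℕ.∸ suc (suc j))
          ≡⟨ ≡.cong (λ a → entry j * entry (suc m) + entry (suc j) * entry (d ℕ.∸ suc a)) eq ⟩
        entry j * entry (suc m) + entry (suc j) * entry m
          ≈⟨ +-cong (*-congʳ (entry-ratio j)) (*-congˡ (entry-ratio m)) ⟩
        ratio j * entry (suc j) * entry (suc m) + entry (suc j) * (ratio m * entry (suc m))
          ≈⟨ solve 4 (λ t e t′ e′ → t :* e :* e′ :+ e :* (t′ :* e′) := (t :+ t′) :* (e :* e′)) ≈-refl (ratio j) (entry (suc j)) (ratio m) (entry (suc m)) ⟩
        (ratio j + ratio m) * (entry (suc j) * entry (suc m))
          ≈⟨ *-congˡ (≈-sym (≈-trans (X-left (ℕ.≤-reflexive eq)) (≈-reflexive (≡.cong (λ a → entry (suc j) * entry a) (suc-∸ i₀<d))))) ⟩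
        (ratio j + ratio m) * X (suc j) ∎
        where
        open ≈R
        m : ℕ
        m = d ℕ.∸ suc i

    private
      P = Pendants.graph r′ d at
      R = Pendants.rooted r′ d at
      centre = Pendants.onPath r′ d at i₀

      wj : (z + ρ) * iw z 1<z ≈ 1#
      wj = inv-inverse (z + ρ) (z+ρ>0 z 1<z)

      away : ∀ v → v ≢ centre → neighbourSum R PV.x v ≈ κ * PV.x v
      away = PV.away-from-centre (iw z 1<z) wj first-eq last-eq inner-eq

      iz₁ : Carrier
      iz₁ = inv (z + 1#) (+-pos (0<z′ z 1<z) 0<1)

      excess : Carrier
      excess = (z + ρ) * iz₁ * (ratio (i ℕ.∸ 1) + ratio (d ℕ.∸ suc i) + fromℕ# s * ratio 0 + (fromℕ# s + 1#) * (fromℕ# r′ * iw z 1<z) - z)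

      at-hub : neighbourSum R PV.x centre ≈ κ * PV.x centre + PV.x centre * excess
      at-hub = PV.at-centre (iw z 1<z) wj first-eq last-eq inner-eq (ratio (i ℕ.∸ 1) + ratio (d ℕ.∸ suc i)) (i ℕ.∸ 1) suc-pred
        (centre-eq (i ℕ.∸ 1) suc-pred)
        where
        suc-pred : suc (i ℕ.∸ 1) ≡ i
        suc-pred = ℕ.m+[n∸m]≡n 1≤i₀

    module _ (n : ℕ) (zero-defect : defect r′ n s z adm ≈ 0#) where
      private
        excess≈ : excess ≈ (z + ρ) * iz₁ * (ratio (i ℕ.∸ 1) + ratio (d ℕ.∸ suc i) - lit 2 * ratio n)
        excess≈ = *-congˡ (≈-trans (solve 7 (λ a b S t q z u → a :+ b :+ S :* t :+ (S :+ num 1) :* q :- z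
            := a :+ b :- num 2 :* u :- (z :- num 2 :* u :- S :* t :- (S :+ num 1) :* q))
            ≈-refl (ratio (i ℕ.∸ 1)) (ratio (d ℕ.∸ suc i)) (fromℕ# s) (ratio 0) (fromℕ# r′ * iw z 1<z) z (ratio n))
          (≈-trans (+-congˡ (-‿cong zero-defect)) (x-0≈x _)))

      -- Here z is the Perron position for two arms of equal length, while the hub is at `i`. The
      -- vector still satisfies the eigenvalue equation away from the hub, and at the hub the
      -- neighbours fall short by a positive multiple of the gap in the hypothesis.
      offCentre-< : ratio (i ℕ.∸ 1) + ratio (d ℕ.∸ suc i) < lit 2 * ratio n →
        ∀ lam → IsLambda₁ ℝ (suc (suc r′)) P lam → lam < recip (suc r′) * κ
      offCentre-< uneven = spectralRadius-< R PV.x κ PV.x>0 sub centre strict (suc (suc r′)) r′ ≡.refl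
        where
        strict : neighbourSum R PV.x centre < κ * PV.x centre
        strict = <-respˡ-≈ (≈-sym at-hub) (<-by (PV.x centre * ((z + ρ) * iz₁ * (lit 2 * ratio n - (ratio (i ℕ.∸ 1) + ratio (d ℕ.∸ suc i)))))
          (*-pos (PV.x>0 centre) (*-pos (*-pos (z+ρ>0 z 1<z) (inv-pos (z + 1#) (+-pos (0<z′ z 1<z) 0<1))) (<⇒0<- uneven)))
          (≈-trans (+-congˡ (-‿cong (+-congˡ (*-congˡ excess≈))))
            (solve 5 (λ k x g a b → k :- (k :+ x :* (g :* (a :- b))) := x :* (g :* (b :- a))) ≈-refl (κ * PV.x centre) (PV.x centre) ((z + ρ) * iz₁)
              (ratio (i ℕ.∸ 1) + ratio (d ℕ.∸ suc i)) (lit 2 * ratio n))))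
        sub : ∀ v → neighbourSum R PV.x v ≤ κ * PV.x v
        sub v = at-or-away (v Fin.≟ centre)
          where
          at-or-away : Dec (v ≡ centre) → neighbourSum R PV.x v ≤ κ * PV.x v
          at-or-away (yes v≡) = ≡.subst (λ v → neighbourSum R PV.x v ≤ κ * PV.x v) (≡.sym v≡) (<⇒≤ strict)
          at-or-away (no v≢)  = ≤-reflexive (away v v≢)

      -- With equal arms the vector is an eigenvector, so κ / r is an eigenvalue and the spectral
      -- radius is at least as large.
      centred-≤ : ratio (i ℕ.∸ 1) + ratio (d ℕ.∸ suc i) ≈ lit 2 * ratio n →
        ∀ lam → IsLambda₁ ℝ (suc (suc r′)) P lam → recip (suc r′) * κ ≤ lam
      centred-≤ even lam (0≤lam , _ , maximal) = sq-cancel-≤ 0≤lam (≤-resp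
          (solve 1 (λ a → a :* a :+ num 0 :* num 0 := a :* a) ≈-refl (recip (suc r′) * κ)) ≈-refl
          (maximal (recip (suc r′) * κ , 0#) (PV.x , (λ _ → 0#) , (centre , inj₁ (#-sym (<⇒# (PV.x>0 centre)))) , λ v → real v , imaginary v)))
        where
        eigen : ∀ v → neighbourSum R PV.x v ≈ κ * PV.x v
        eigen v = at-or-away (v Fin.≟ centre)
          where
          hub-eigen : neighbourSum R PV.x centre ≈ κ * PV.x centre
          hub-eigen = ≈-trans at-hub (≈-trans (+-congˡ (≈-trans (*-congˡ (≈-trans excess≈
            (≈-trans (*-congˡ (≈-trans (+-congʳ even) (-‿inverseʳ _))) (zeroʳ _)))) (zeroʳ _))) (+-identityʳ _))
          at-or-away : Dec (v ≡ centre) → neighbourSum R PV.x v ≈ κ * PV.x v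
          at-or-away (yes v≡) = ≡.subst (λ v → neighbourSum R PV.x v ≈ κ * PV.x v) (≡.sym v≡) hub-eigen
          at-or-away (no v≢)  = away v v≢
        A = adjacencyMatrix ℝ (suc (suc r′)) P
        real : ∀ v → (A · PV.x) v ≈ recip (suc r′) * κ * PV.x v - 0# * 0#
        real v = ≈-trans (adjacency-neighbourSum R (suc (suc r′)) PV.x v) (≈-trans (*-congˡ (eigen v))
          (solve 3 (λ a b c → a :* (b :* c) := a :* b :* c :- num 0 :* num 0) ≈-refl (recip (suc r′)) κ (PV.x v)))
        imaginary : ∀ v → (A · (λ _ → 0#)) v ≈ recip (suc r′) * κ * 0# + 0# * PV.x v
        imaginary v = ≈-trans (≈-sym (∑≈sum (λ w → A v w * 0#))) (≈-trans (∑-0 (λ w → zeroʳ _))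
          (solve 2 (λ a b → num 0 := a :* num 0 :+ num 0 :* b) ≈-refl (recip (suc r′) * κ) (PV.x v)))

  -- The extremal hypertree

  module _ {G H : Hypergraph} (iso : G ≅ H) where
    open _≅_ iso
    private
      to = Inverse.to vertices
      from = Inverse.from vertices

      adjacent-to : ∀ {u v} → Adjacent G u v → Adjacent H (to u) (to v)
      adjacent-to (u≢v , e , u∈ , v∈) = (λ eq → u≢v (≡.trans (≡.sym (Inverse.strictlyInverseʳ vertices _))
          (≡.trans (≡.cong from eq) (Inverse.strictlyInverseʳ vertices _)))) ,
        Inverse.to edges e , Equivalence.to (incident _ _) u∈ , Equivalence.to (incident _ _) v∈

      adjacent-from : ∀ {u v} → Adjacent H (to u) (to v) → Adjacent G u v
      adjacent-from (u≢v , e , u∈ , v∈) = u≢v ∘ ≡.cong to , Inverse.from edges e , back u∈ , back v∈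
        where
        back : ∀ {u} → to u ∈ edge H e → u ∈ edge G (Inverse.from edges e)
        back {u} u∈ = Equivalence.from (incident _ _) (≡.subst (λ f → to u ∈ edge H f) (≡.sym (Inverse.strictlyInverseˡ edges e)) u∈)

      entry-≡ : ∀ m u v → adjacencyMatrix ℝ m H (to u) (to v) ≡ adjacencyMatrix ℝ m G u v
      entry-≡ m u v = helper (adjacent? H (to u) (to v)) (adjacent? G u v)
        where
        helper : ∀ (a? : Dec (Adjacent H (to u) (to v))) (b? : Dec (Adjacent G u v)) →
          (if does a? then recip (m ℕ.∸ 1) else 0#) ≡ (if does b? then recip (m ℕ.∸ 1) else 0#)
        helper (yes _) (yes _) = ≡.refl
        helper (no _)  (no _)  = ≡.refl
        helper (yes a) (no ¬b) = ⊥-elim (¬b (adjacent-from a))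
        helper (no ¬a) (yes b) = ⊥-elim (¬a (adjacent-to b))

      transport : ∀ m (x : Vertex G → Carrier) v →
        (adjacencyMatrix ℝ m H · (x ∘ from)) v ≈ (adjacencyMatrix ℝ m G · x) (from v)
      transport m x v = begin
        (adjacencyMatrix ℝ m H · (x ∘ from)) v ≈⟨ ∑≈sum (λ w → adjacencyMatrix ℝ m H v w * x (from w)) ⟨
        ∑ (λ w → adjacencyMatrix ℝ m H v w * x (from w)) ≈⟨ ∑-permute (λ w → adjacencyMatrix ℝ m H v w * x (from w)) vertices ⟩
        ∑ (λ u → adjacencyMatrix ℝ m H v (to u) * x (from (to u)))
          ≈⟨ ∑-cong (λ u → ≈-reflexive (≡.cong₂ _*_
               (≡.trans (≡.cong (λ v → adjacencyMatrix ℝ m H v (to u)) (≡.sym (Inverse.strictlyInverseˡ vertices v))) (entry-≡ m (from v) u))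
               (≡.cong x (Inverse.strictlyInverseʳ vertices u)))) ⟩
        ∑ (λ u → adjacencyMatrix ℝ m G (from v) u * x u) ≈⟨ ∑≈sum (λ u → adjacencyMatrix ℝ m G (from v) u * x u) ⟩
        (adjacencyMatrix ℝ m G · x) (from v) ∎
        where open ≈R

    eigenvalue-≅ : ∀ m z → IsEigenvalue (adjacencyMatrix ℝ m G) z → IsEigenvalue (adjacencyMatrix ℝ m H) z
    eigenvalue-≅ m (a , b) (u , w , (i , #0) , eqs) = u ∘ from , w ∘ from ,
      (to i , ≡.subst (λ i → u i # 0# ⊎ w i # 0#) (≡.sym (Inverse.strictlyInverseʳ vertices i)) #0) ,
      λ v → ≈-trans (transport m u v) (proj₁ (eqs (from v))) , ≈-trans (transport m w v) (proj₂ (eqs (from v)))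

  λ₁-≅ : ∀ {G H} → G ≅ H → ∀ m lam → IsLambda₁ ℝ m G lam → IsLambda₁ ℝ m H lam
  λ₁-≅ iso m lam (0≤lam , (z , ev , norm) , maximal) =
    0≤lam , (z , eigenvalue-≅ iso m z ev , norm) , λ z ev → maximal z (eigenvalue-≅ (≅-sym iso) m z ev)

  λ₁-≤ : ∀ {H} m lam lam′ → IsLambda₁ ℝ m H lam → IsLambda₁ ℝ m H lam′ → lam ≤ lam′
  λ₁-≤ m lam lam′ (_ , (z , ev , norm) , _) (0≤lam′ , _ , maximal) =
    sq-cancel-≤ 0≤lam′ (≤-resp norm ≈-refl (maximal z ev))

  module _ (r′ : ℕ) where
    open Ratios r′

    -- Up to exchanging the arms, a < p and b lies equally far above p, which is the situation of
    -- `concave`.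
    uneven : ∀ z adm p a b → a ℕ.+ b ≡ p ℕ.+ p → a ≢ p →
      Sequence.ratio z adm a + Sequence.ratio z adm b < lit 2 * Sequence.ratio z adm p
    uneven z adm p a b a+b≡ a≢p = [ left a b p a+b≡ , (λ p<a → <-respˡ-≈ (+-comm _ _)
        (left b a p (≡.trans (ℕ.+-comm b a) a+b≡) (ℕ.+-cancelˡ-< a b p (≡.subst (ℕ._< a ℕ.+ p) (≡.sym a+b≡) (ℕ.+-monoˡ-< p p<a))))) ]′
      (apart (ℕ.≤-<-connex a p))
      where
      open Sequence z adm
      apart : a ℕ.≤ p ⊎ p ℕ.< a → a ℕ.< p ⊎ p ℕ.< a
      apart (inj₁ a≤p) = inj₁ (ℕ.≤∧≢⇒< a≤p a≢p)
      apart (inj₂ p<a) = inj₂ p<a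
      left : ∀ a b p → a ℕ.+ b ≡ p ℕ.+ p → a ℕ.< p → ratio a + ratio b < lit 2 * ratio p
      left a b p a+b≡ a<p = ≡.subst₂ (λ b p → ratio a + ratio b < lit 2 * ratio p) b≡ p≡ (concave j a)
        where
        j : ℕ
        j = p ℕ.∸ suc a
        p≡ : suc j ℕ.+ a ≡ p
        p≡ = ≡.trans (≡.sym (ℕ.+-suc j a)) (ℕ.m∸n+n≡m a<p)
        b≡ : suc j ℕ.+ suc j ℕ.+ a ≡ b
        b≡ = ℕ.+-cancelˡ-≡ a _ _ (≡.trans (≡.trans (≡.cong (a ℕ.+_) (ℕ.+-assoc (suc j) (suc j) a)) (≡.trans (≡.sym (ℕ.+-assoc a (suc j) (suc j ℕ.+ a)))
          (≡.cong (ℕ._+ (suc j ℕ.+ a)) (ℕ.+-comm a (suc j))))) (≡.trans (≡.cong₂ ℕ._+_ p≡ p≡) (≡.sym a+b≡)))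

    -- A point below the Perron root from which the iteration can start.
    startPoint : ∀ s → 2 ℕ.≤ s → (1 ℕ.≤ r′ → 6 ℕ.≤ s) →
      Σ[ a ∈ Carrier ] Admissible a × a * (a + fromℕ# (suc r′) - 1#) ≤ (fromℕ# s + lit 2) * fromℕ# (suc r′)
    startPoint s 2≤s 6≤s = go r′ ≡.refl
      where
      ρ R′ S : Carrier
      ρ = fromℕ# (suc r′)
      R′ = fromℕ# r′
      S = fromℕ# s
      lit≤ : ∀ {n} → n ℕ.≤ s → lit n ≤ S
      lit≤ {n} n≤s = ≤-resp (fromℕ#≈lit n) ≈-refl (fromℕ#-mono-≤ n≤s)
      1<2 : 1# < lit 2
      1<2 = <-by 1# 0<1 (solve 0 (num 2 :- num 1 := num 1) ≈-refl)
      1<3 : 1# < lit 3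
      1<3 = <-by (lit 2) (lit-pos 1) (solve 0 (num 3 :- num 1 := num 2) ≈-refl)
      go : ∀ n → r′ ≡ n → Σ[ a ∈ Carrier ] Admissible a × a * (a + ρ - 1#) ≤ (S + lit 2) * ρ
      -- For m = 2 the correction R′ / (z + r) vanishes, so τ = z and 2 is admissible.
      go zero r≡0 = lit 2 , record { 1<z = 1<2 ; 2≤τ = ≤-reflexive (≈-sym (≈-trans (+-congˡ (-‿cong (0*-cong _ R′≈0))) (x-0≈x _))) } ,
        ≤-by (S - lit 2) (≤⇒0≤- (lit≤ 2≤s)) (≈-trans (+-cong (*-congˡ ρ≈1) (-‿cong (*-congˡ (+-congʳ (+-congˡ ρ≈1)))))
          (solve 1 (λ S → (S :+ num 2) :* num 1 :- num 2 :* (num 2 :+ num 1 :- num 1) := S :- num 2) ≈-refl S))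
        where
        R′≈0 : R′ ≈ 0#
        R′≈0 = ≈-reflexive (≡.cong fromℕ# r≡0)
        ρ≈1 : ρ ≈ 1#
        ρ≈1 = ≈-trans (+-congˡ R′≈0) (+-identityʳ 1#)
      -- For m ≥ 3 the correction is at most 1, so 3 is admissible; `6 ≤ s` and R′ ≥ 1 leave room
      -- for the second condition.
      go (suc n) r≡ = lit 3 , record { 1<z = 1<3 ; 2≤τ = ≤-by (1# - R′ * iw (lit 3) 1<3) (≤⇒0≤- (R′iw≤1 (lit 3) 1<3))
            (solve 1 (λ q → num 3 :- q :- num 2 := num 1 :- q) ≈-refl (R′ * iw (lit 3) 1<3)) } ,
        ≤-by ((S - lit 6) * (1# + R′) + lit 5 * (R′ - 1#) + lit 4)
          (+-nonneg (+-nonneg (*-nonneg (≤⇒0≤- (lit≤ (6≤s 1≤r′))) (+-nonneg (<⇒≤ 0<1) (fromℕ#-nonneg r′)))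
            (*-nonneg (lit-nonneg 5) (≤⇒0≤- (≤-resp (fromℕ#≈lit 1) ≈-refl (fromℕ#-mono-≤ 1≤r′))))) (lit-nonneg 4))
          (solve 2 (λ S R → (S :+ num 2) :* (num 1 :+ R) :- num 3 :* (num 3 :+ (num 1 :+ R) :- num 1)
            := (S :- num 6) :* (num 1 :+ R) :+ num 5 :* (R :- num 1) :+ num 4) ≈-refl S R′)
        where
        1≤r′ : 1 ℕ.≤ r′
        1≤r′ = ≡.subst (1 ℕ.≤_) (≡.sym r≡) (ℕ.s≤s ℕ.z≤n)

    module _ (d′ p′ k : ℕ) (d′≡ : d′ ≡ p′ ℕ.+ p′)
             (large : 4 ℕ.* ((2 ℕ.+ d′) ℕ.* (2 ℕ.+ d′)) ℕ.* suc r′ ℕ.+ 2 ℕ.≤ 4 ℕ.* k ℕ.+ suc r′)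
             (T : Hypergraph) (uniform : Uniform (suc (suc r′)) T) (tree : IsHypertree T) (size≡ : size T ≡ k)
             {x y : Vertex T} (path : Path T x y (2 ℕ.+ d′))
             (λT : Carrier) (isλT : IsLambda₁ ℝ (suc (suc r′)) T λT) where
      private
        m d N p : ℕ
        m = suc (suc r′)
        d = 2 ℕ.+ d′
        N = k ℕ.∸ d
        p = suc p′

        ρ K D : Carrier
        ρ = fromℕ# (suc r′)
        K = fromℕ# k
        D = fromℕ# d′

        K≈ : K ≈ lit 2 + D + fromℕ# N
        K≈ = ≈-trans (≈-reflexive (≡.cong fromℕ# (≡.sym (ℕ.m+[n∸m]≡n (d≤k r′ d′ k large)))))
          (≈-trans (fromℕ#-+ d N) (+-congʳ (≈-trans (fromℕ#-+ 2 d′) (+-congʳ (fromℕ#≈lit 2)))))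

        rooting : ∀ v → Σ[ R ∈ Rooted T ] Rooted.root R ≡ v
        rooting = hypertree-rooted tree

        start : Σ[ a ∈ Carrier ] Admissible a × a * (a + ρ - 1#) ≤ (fromℕ# N + lit 2) * ρ
        start = startPoint N (ℕ.≤-trans (ℕ.n≤1+n 2) (3≤k∸d r′ d′ k large)) (λ 1≤r′ → many r′ 1≤r′ large)
          where
          many : ∀ r → 1 ℕ.≤ r → 4 ℕ.* ((2 ℕ.+ d′) ℕ.* (2 ℕ.+ d′)) ℕ.* suc r ℕ.+ 2 ℕ.≤ 4 ℕ.* k ℕ.+ suc r → 6 ℕ.≤ N
          many (suc r) _ large = 6≤k∸d r d′ k large

        perron : Σ[ z ∈ Carrier ] Σ[ adm ∈ Admissible z ] defect r′ p′ N z adm ≈ 0#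
        perron = perronRoot r′ p′ N (proj₁ start) (proj₁ (proj₂ start)) (proj₂ (proj₂ start))

        p<1+d : p ℕ.< suc d
        p<1+d = ℕ.s≤s (ℕ.s≤s (ℕ.≤-trans (≡.subst (p′ ℕ.≤_) (≡.sym d′≡) (ℕ.m≤m+n p′ p′)) (ℕ.n≤1+n d′)))

        iₚ : Fin (suc d)
        iₚ = fromℕ< p<1+d

        toℕ-iₚ : toℕ iₚ ≡ p
        toℕ-iₚ = Fin.toℕ-fromℕ< p<1+d

        1≤iₚ : 1 ℕ.≤ toℕ iₚ
        1≤iₚ = ≡.subst (1 ℕ.≤_) (≡.sym toℕ-iₚ) (ℕ.s≤s ℕ.z≤n)

        iₚ<d : toℕ iₚ ℕ.< d
        iₚ<d = ≡.subst (ℕ._< d) (≡.sym toℕ-iₚ) (ℕ.s≤s (ℕ.s≤s (≡.subst (p′ ℕ.≤_) (≡.sym d′≡) (ℕ.m≤m+n p′ p′))))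

        attachments : attachmentList (suc r′) d (onlyAt (p ℕ.+ 1) N) ≡ List.replicate N (pathVertex (suc r′) d iₚ)
        attachments = ≡.subst (λ q → attachmentList (suc r′) d (onlyAt (q ℕ.+ 1) N) ≡ List.replicate N (pathVertex (suc r′) d iₚ)) toℕ-iₚ
          (attachments-single (suc r′) d N iₚ 1≤iₚ iₚ<d)

        at* : Fin (List.length (attachmentList (suc r′) d (onlyAt (p ℕ.+ 1) N))) → Fin (suc (d ℕ.* suc r′))
        at* = List.lookup (attachmentList (suc r′) d (onlyAt (p ℕ.+ 1) N))

        at*≡ : ∀ j → at* j ≡ pathVertex (suc r′) d iₚ
        at*≡ = lookup-constant N (pathVertex (suc r′) d iₚ) attachments

        length≡ : List.length (attachmentList (suc r′) d (onlyAt (p ℕ.+ 1) N)) ≡ N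
        length≡ = ≡.trans (≡.cong List.length attachments) (List.length-replicate N)

        T* : Hypergraph
        T* = Pendants.graph r′ d at*

        module AtRoot (z : Carrier) (adm : Admissible z) (zero-defect : defect r′ p′ N z adm ≈ 0#) where
          κ : Carrier
          κ = z + ρ - 1#

          perron≤λ* : ∀ λ* → IsLambda₁ ℝ m T* λ* → recip (suc r′) * κ ≤ λ*
          perron≤λ* = centred-≤ r′ d at* iₚ 1≤iₚ iₚ<d at*≡ z adm p′
            (≡.subst (λ s → defect r′ p′ s z adm ≈ 0#) (≡.sym length≡) zero-defect)
            (≈-trans (+-cong (≈-reflexive (≡.cong (λ i → ratio (i ℕ.∸ 1)) toℕ-iₚ))
                (≈-reflexive (≡.cong ratio (≡.trans (≡.cong (λ i → d ℕ.∸ suc i) toℕ-iₚ) (≡.trans (≡.cong (ℕ._∸ p′) d′≡) (ℕ.m+n∸n≡m p′ p′))))))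
              (solve 1 (λ t → t :+ t := num 2 :* t) ≈-refl (ratio p′)))
            where open Sequence z adm

          crude : (∀ v → degree T v ℕ.+ d′ ℕ.< k) → λT < recip (suc r′) * κ
          crude upper = crude-bound r′ d′ k large z (0<z′ z (Admissible.1<z adm))
            (≤-resp (*-congˡ (≈-sym (≈-trans (+-congʳ K≈) (solve 2 (λ D N → num 2 :+ D :+ N :- D := N :+ num 2) ≈-refl D (fromℕ# N))))) ≈-refl
              (perronRoot-≥ r′ p′ N z adm zero-defect))
            uniform size≡ rooting x (inj₁ upper) λT isλT

          module OnHub (v : Vertex T) (heavy : size T ℕ.+ 2 ℕ.≤ degree T v ℕ.+ d) where
            open Path path
            R : Rooted T
            R = proj₁ (rooting (vertexAt zero))
            root≡ : Rooted.root R ≡ vertexAt zero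
            root≡ = proj₂ (rooting (vertexAt zero))
            hub′ : Σ[ i₀ ∈ Fin (suc d) ] 1 ℕ.≤ toℕ i₀ × toℕ i₀ ℕ.< d × (∀ f → (∀ j → edgeAt j ≢ f) → Rooted.apex R f ≡ vertexAt i₀)
            hub′ = hub R d vertexAt edgeAt edgeAt-injective vertexAt-injective left∈ right∈ root≡ v heavy
            i₀ : Fin (suc d)
            i₀ = proj₁ hub′
            1≤i₀ : 1 ℕ.≤ toℕ i₀
            1≤i₀ = proj₁ (proj₂ hub′)
            i₀<d : toℕ i₀ ℕ.< d
            i₀<d = proj₁ (proj₂ (proj₂ hub′))
            shape : ∀ {s} → d ℕ.+ s ≡ size T → (at : Fin s → Fin (suc (d ℕ.* suc r′))) →
              (∀ j → at j ≡ pathVertex (suc r′) d i₀) → T ≅ Pendants.graph r′ d at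
            shape = PendantShape.shape-≅ R r′ uniform d vertexAt edgeAt edgeAt-injective root≡
              (path-parent R d vertexAt edgeAt edgeAt-injective vertexAt-injective left∈ right∈ root≡)
              (path-apex R d vertexAt edgeAt edgeAt-injective vertexAt-injective left∈ right∈ root≡) i₀ (proj₂ (proj₂ (proj₂ hub′)))
            d+N≡ : d ℕ.+ N ≡ size T
            d+N≡ = ≡.trans (ℕ.m+[n∸m]≡n (d≤k r′ d′ k large)) (≡.sym size≡)
            result : T ≅ T* ⊎ λT < recip (suc r′) * κ
            result = placed-at (toℕ i₀ ℕ.≟ p)
              where
              at₀ : Fin N → Fin (suc (d ℕ.* suc r′))
              at₀ _ = pathVertex (suc r′) d i₀
              sum≡ : toℕ i₀ ℕ.∸ 1 ℕ.+ (d ℕ.∸ suc (toℕ i₀)) ≡ p′ ℕ.+ p′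
              sum≡ = ℕ.suc-injective (ℕ.suc-injective (≡.trans (≡.cong (λ i → suc (i ℕ.+ (d ℕ.∸ suc (toℕ i₀)))) (ℕ.m+[n∸m]≡n 1≤i₀))
                (≡.trans (ℕ.m+[n∸m]≡n i₀<d) (≡.cong (2 ℕ.+_) d′≡))))
              placed-at : Dec (toℕ i₀ ≡ p) → T ≅ T* ⊎ λT < recip (suc r′) * κ
              placed-at (yes i≡p) = inj₁ (shape (≡.trans (≡.cong (d ℕ.+_) length≡) d+N≡) at*
                (λ j → ≡.trans (at*≡ j) (≡.cong (pathVertex (suc r′) d) (Fin.toℕ-injective (≡.trans toℕ-iₚ (≡.sym i≡p))))))
              placed-at (no i≢p) = inj₂ (offCentre-< r′ d at₀ i₀ 1≤i₀ i₀<d (λ _ → ≡.refl) z adm p′ zero-defect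
                (uneven z adm p′ (toℕ i₀ ℕ.∸ 1) (d ℕ.∸ suc (toℕ i₀)) sum≡ (λ eq → i≢p (≡.trans (≡.sym (ℕ.m+[n∸m]≡n 1≤i₀)) (≡.cong suc eq))))
                λT (λ₁-≅ {T} {Pendants.graph r′ d at₀} (shape d+N≡ at₀ (λ _ → ≡.refl)) m λT isλT))

          -- The decision is about a degree of at least k - d + 2. Without such a vertex `crude`
          -- applies. With one, T is a path with all further edges at one vertex, and its position
          -- is either the middle or is handled by `offCentre-<`.
          dichotomy : T ≅ T* ⊎ λT < recip (suc r′) * κ
          dichotomy = decide (Fin.any? (λ v → size T ℕ.+ 2 ℕ.≤? degree T v ℕ.+ d))
            where
            eq : ∀ v → degree T v ℕ.+ (2 ℕ.+ d′) ≡ degree T v ℕ.+ d′ ℕ.+ 2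
            eq v = ≡.trans (≡.cong (degree T v ℕ.+_) (ℕ.+-comm 2 d′)) (≡.sym (ℕ.+-assoc (degree T v) d′ 2))
            decide : Dec (∃[ v ] size T ℕ.+ 2 ℕ.≤ degree T v ℕ.+ d) → T ≅ T* ⊎ λT < recip (suc r′) * κ
            decide (yes (v , heavy)) = OnHub.result v heavy
            decide (no ¬∃) = inj₂ (crude (λ v → ℕ.+-cancelʳ-< 2 (degree T v ℕ.+ d′) k
              (≡.subst₂ ℕ._<_ (eq v) (≡.cong (ℕ._+ 2) size≡) (ℕ.≰⇒> (λ h → ¬∃ (v , h))))))

          -- In the second alternative λT lies strictly below κ / r ≤ λ*, so equality is absurd; in
          -- the first, isomorphic hypergraphs share their spectral radii.
          extremal-at : ∀ H → T* ≡ H → ∀ λ* → IsLambda₁ ℝ m H λ* → λT ≤ λ* × (λT ≈ λ* → T ≅ H)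
          extremal-at H ≡.refl λ* isλ* = [ (λ iso → λ₁-≤ {T*} m λT λ* (λ₁-≅ {T} {T*} iso m λT isλT) isλ* , λ _ → iso)
                           , (λ λT< → let λT<λ* = <-≤-trans λT< (perron≤λ* λ* isλ*) in
                               <⇒≤ λT<λ* , λ λT≈λ* → ⊥-elim (<-irrefl λT≈λ* λT<λ*)) ]′ dichotomy

      extremal : ∀ H → pendantTree m d (onlyAt (p ℕ.+ 1) N) ≡ H → ∀ λ* → IsLambda₁ ℝ m H λ* → λT ≤ λ* × (λT ≈ λ* → T ≅ H)
      extremal = AtRoot.extremal-at (proj₁ perron) (proj₁ (proj₂ perron)) (proj₂ (proj₂ perron))

  -- The quadratic bound

  inverse-unique : ∀ x {a b} → x * a ≈ 1# → x * b ≈ 1# → a ≈ b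
  inverse-unique x {a} {b} xa≈1 xb≈1 = begin
    a           ≈⟨ *-identityʳ a ⟨
    a * 1#      ≈⟨ *-congˡ xb≈1 ⟨
    a * (x * b) ≈⟨ solve 3 (λ a x b → a :* (x :* b) := x :* a :* b) ≈-refl a x b ⟩
    x * a * b   ≈⟨ 1*-cong b xa≈1 ⟩
    b           ∎
    where open ≈R

  module _ (r′ : ℕ) (N : ℕ) (s : Carrier)
           (isSqrt : s IsSqrtOf fromℕ# (suc r′ ℕ.^ 2 ℕ.+ 4 ℕ.* N ℕ.* suc r′)) where
    private
      ρ R′ half : Carrier
      ρ = fromℕ# (suc r′)
      R′ = fromℕ# r′
      half = inv (lit 2) (lit-pos 1)

      ρ>0 : 0# < ρ
      ρ>0 = fromℕ#-pos r′

      half>0 : 0# < half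
      half>0 = inv-pos (lit 2) (lit-pos 1)

      2*half : lit 2 * half ≈ 1#
      2*half = inv-inverse (lit 2) (lit-pos 1)

      s² : s * s ≈ ρ * ρ + lit 4 * fromℕ# N * ρ
      s² = ≈-trans (proj₂ isSqrt) (≈-trans (fromℕ#-+ (suc r′ ℕ.^ 2) (4 ℕ.* N ℕ.* suc r′)) (+-cong
        (≈-trans (fromℕ#-* (suc r′) (suc r′ ℕ.* 1)) (*-congˡ (≈-reflexive (≡.cong fromℕ# (ℕ.*-identityʳ (suc r′))))))
        (≈-trans (fromℕ#-* (4 ℕ.* N) (suc r′)) (*-congʳ (≈-trans (fromℕ#-* 4 N) (*-congʳ (fromℕ#≈lit 4)))))))

    -- The larger root of κ² = r κ + r N, which is r times the bound in (ii).
    κ₀ : Carrier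
    κ₀ = (ρ + s) * half

    κ₀>0 : 0# < κ₀
    κ₀>0 = *-pos (+-pos-nonneg ρ>0 (proj₁ isSqrt)) half>0

    κ₀-quadratic : κ₀ * κ₀ ≈ ρ * κ₀ + ρ * fromℕ# N
    κ₀-quadratic = begin
      κ₀ * κ₀ ≈⟨ solve 3 (λ r s h → (r :+ s) :* h :* ((r :+ s) :* h) := h :* h :* (r :* r :+ num 2 :* r :* s :+ s :* s)) ≈-refl ρ s half ⟩
      half * half * (ρ * ρ + lit 2 * ρ * s + s * s) ≈⟨ *-congˡ (+-congˡ s²) ⟩
      half * half * (ρ * ρ + lit 2 * ρ * s + (ρ * ρ + lit 4 * fromℕ# N * ρ))
        ≈⟨ solve 4 (λ r s h N → h :* h :* (r :* r :+ num 2 :* r :* s :+ (r :* r :+ num 4 :* N :* r))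
             := (num 2 :* h) :* (r :* ((r :+ s) :* h)) :+ (num 2 :* h) :* ((num 2 :* h) :* (r :* N))) ≈-refl ρ s half (fromℕ# N) ⟩
      (lit 2 * half) * (ρ * κ₀) + (lit 2 * half) * ((lit 2 * half) * (ρ * fromℕ# N))
        ≈⟨ +-cong (1*-cong _ 2*half) (≈-trans (1*-cong _ 2*half) (1*-cong _ 2*half)) ⟩
      ρ * κ₀ + ρ * fromℕ# N ∎
      where open ≈R

    κ₀-scaled : recip (suc r′) * κ₀ ≈ (ρ + s) * recip (2 ℕ.* suc (suc r′) ℕ.∸ 2)
    κ₀-scaled = ≈-trans (solve 3 (λ a b h → a :* (b :* h) := b :* (h :* a)) ≈-refl (recip (suc r′)) (ρ + s) half)
      (*-congˡ (≈-trans (inverse-unique (lit 2 * ρ)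
          (≈-trans (solve 4 (λ t r h q → t :* r :* (h :* q) := t :* h :* (r :* q)) ≈-refl (lit 2) ρ half (recip (suc r′)))
            (≈-trans (1*-cong _ 2*half) (recip-inverse r′)))
          (≈-trans (*-congʳ (≈-sym (≈-trans (fromℕ#-* 2 (suc r′)) (*-congʳ (fromℕ#≈lit 2))))) (recip-inverse (r′ ℕ.+ suc (r′ ℕ.+ 0)))))
        (≈-reflexive (≡.cong recip (≡.sym (ℕ.+-suc r′ (suc (r′ ℕ.+ 0))))))))

    module _ (d′ k : ℕ) (N≡ : N ≡ k ℕ.∸ (2 ℕ.+ d′))
             (large : 4 ℕ.* ((2 ℕ.+ d′) ℕ.* (2 ℕ.+ d′)) ℕ.* suc r′ ℕ.+ 2 ℕ.≤ 4 ℕ.* k ℕ.+ suc r′) where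
      private
        K D M z κ : Carrier
        K = fromℕ# k
        D = fromℕ# d′
        M = fromℕ# N
        z = κ₀ + 1# - ρ
        κ = z + ρ - 1#

        D≥0 : 0# ≤ D
        D≥0 = fromℕ#-nonneg d′

        R′≥0 : 0# ≤ R′
        R′≥0 = fromℕ#-nonneg r′

        K≈ : K ≈ lit 2 + D + M
        K≈ = ≈-trans (≈-reflexive (≡.cong fromℕ# (≡.trans (≡.sym (ℕ.m+[n∸m]≡n (d≤k r′ d′ k large))) (≡.cong (2 ℕ.+ d′ ℕ.+_) (≡.sym N≡)))))
          (≈-trans (fromℕ#-+ (2 ℕ.+ d′) N) (+-congʳ (≈-trans (fromℕ#-+ 2 d′) (+-congʳ (fromℕ#≈lit 2)))))

        κ≈ : κ ≈ κ₀
        κ≈ = solve 2 (λ k r → k :+ num 1 :- r :+ r :- num 1 := k) ≈-refl κ₀ ρ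

        -- With D = d - 2 this is (2 d - 1) r. As 2 κ₀ = r + s, the inequality `c<s` means κ₀ > d r.
        c : Carrier
        c = (lit 2 * D + lit 3) * ρ

        c<s : c < s
        c<s = sq-cancel-< (*-nonneg (+-nonneg (*-nonneg (lit-nonneg 2) D≥0) (lit-nonneg 3)) (<⇒≤ ρ>0)) s>0 (<-respʳ-≈ (≈-sym s²)
          (<-by (ρ * (lit 4 * K + ρ - (lit 4 * ((lit 2 + D) * (lit 2 + D)) * ρ + lit 2)) + ρ * ((lit 4 * D + lit 7) * R′ + 1#))
            (+-nonneg-pos (*-nonneg (<⇒≤ ρ>0) (≤⇒0≤- (large# r′ d′ k large)))
              (*-pos ρ>0 (+-nonneg-pos (*-nonneg (+-nonneg (*-nonneg (lit-nonneg 4) D≥0) (lit-nonneg 7)) R′≥0) 0<1)))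
            (≈-sym (≈-trans (+-congʳ (*-congˡ (+-congʳ (+-congʳ (*-congˡ K≈)))))
              (solve 3 (λ D M R → let r = num 1 :+ R
                                      c = (num 2 :* D :+ num 3) :* r in
                r :* (num 4 :* (num 2 :+ D :+ M) :+ r :- (num 4 :* ((num 2 :+ D) :* (num 2 :+ D)) :* r :+ num 2))
                  :+ r :* ((num 4 :* D :+ num 7) :* R :+ num 1)
                := (r :* r :+ num 4 :* M :* r) :- c :* c) ≈-refl D M R′)))))
          where
          s>0 : 0# < s
          s>0 = [ (λ 0<s → 0<s) , (λ s<0 → ⊥-elim (proj₁ isSqrt s<0)) ]′ (#⇒<⊎> (#-sym (#0-factor s s (#0-resp (≈-sym s²)
            (#-sym (<⇒# (+-pos-nonneg (*-pos ρ>0 ρ>0) (*-nonneg (*-nonneg (lit-nonneg 4) (fromℕ#-nonneg N)) (<⇒≤ ρ>0)))))))))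

        dρ<κ : (lit 2 + D) * ρ < κ₀
        dρ<κ = *-cancelˡ-< (lit-pos 1) (<-by (s - c) (<⇒0<- c<s)
          (≈-trans (+-congʳ (≈-trans (solve 3 (λ t r h → t :* (r :* h) := (t :* h) :* r) ≈-refl (lit 2) (ρ + s) half) (1*-cong _ 2*half)))
            (solve 3 (λ r s D → r :+ s :- num 2 :* ((num 2 :+ D) :* r) := s :- (num 2 :* D :+ num 3) :* r) ≈-refl ρ s D)))

        z>0 : 0# < z
        z>0 = <-respʳ-≈ (solve 3 (λ k q r → (k :- q) :+ (q :- r :+ num 1) := k :+ num 1 :- r) ≈-refl κ₀ ((lit 2 + D) * ρ) ρ)
          (+-pos-nonneg (<⇒0<- dρ<κ) (≤-resp ≈-refl (solve 2 (λ D r → (num 1 :+ D) :* r :+ num 1 := (num 2 :+ D) :* r :- r :+ num 1) ≈-refl D ρ)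
            (+-nonneg (*-nonneg (+-nonneg (<⇒≤ 0<1) D≥0) (<⇒≤ ρ>0)) (<⇒≤ 0<1))))

        -- By the quadratic equation z κ exceeds r (k - d) by exactly κ₀, so z κ > r k is the same
        -- as κ₀ > r d.
        zκ≈ : z * κ ≈ ρ * M + κ₀
        zκ≈ = ≈-trans (*-congˡ κ≈) (≈-trans (solve 2 (λ k r → (k :+ num 1 :- r) :* k := k :* k :+ k :- r :* k) ≈-refl κ₀ ρ)
          (≈-trans (+-congʳ (+-congʳ κ₀-quadratic)) (solve 3 (λ k r m → r :* k :+ r :* m :+ k :- r :* k := r :* m :+ k) ≈-refl κ₀ ρ M)))

        ρK<zκ : ρ * K < z * κ
        ρK<zκ = <-respʳ-≈ (≈-sym zκ≈) (<-by (κ₀ - (lit 2 + D) * ρ) (<⇒0<- dρ<κ)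
          (≈-trans (+-congˡ (-‿cong (*-congˡ K≈)))
            (solve 4 (λ r m k D → r :* m :+ k :- r :* (num 2 :+ D :+ m) := k :- (num 2 :+ D) :* r) ≈-refl ρ M κ₀ D)))

        low : ρ * (K - D) ≤ z * κ
        low = ≤-trans (≤-by (ρ * D) (*-nonneg (<⇒≤ ρ>0) D≥0) (solve 3 (λ r K D → r :* K :- r :* (K :- D) := r :* D) ≈-refl ρ K D)) (<⇒≤ ρK<zκ)

      quadratic-bound : ∀ {T} → Uniform (suc (suc r′)) T → IsHypertree T → size T ≡ k → Vertex T →
        ∀ lam → IsLambda₁ ℝ (suc (suc r′)) T lam → lam < recip (suc r′) * κ₀
      quadratic-bound uniform tree size≡ v lam isλ = <-respʳ-≈ (*-congˡ κ≈)
        (crude-bound r′ d′ k large z z>0 low uniform size≡ (hypertree-rooted tree) v (inj₂ ρK<zκ) lam isλ)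

  ≅⇒extremal : ∀ {T H} m → T ≅ H → ∀ λT → IsLambda₁ ℝ m T λT → ∀ λ* → IsLambda₁ ℝ m H λ* → λT ≤ λ* × (λT ≈ λ* → T ≅ H)
  ≅⇒extremal {T} {H} m iso λT isλT λ* isλ* = λ₁-≤ {H} m λT λ* (λ₁-≅ {T} {H} iso m λT isλT) isλ* , λ _ → iso

  -- Diameter zero

  module _ (r′ : ℕ) (T : Hypergraph) (uniform : Uniform (suc (suc r′)) T) (tree : IsHypertree T) (diameter : IsDiameter T 0) where
    private
      u : Vertex T
      u = proj₁ (proj₁ diameter)

    -- An edge has m ≥ 2 vertices, and two of them are at distance 1.
    noEdge : ¬ Edge T
    noEdge e = ℕ.n≮0 (proj₂ diameter a b 1 (path , shortest))
      where
      E : Enumeration (suc (suc r′)) (_∈ edge T e)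
      E = ≡.subst (λ n → Enumeration n (_∈ edge T e)) (uniform e) (enumerate (edge T e))
      a b : Vertex T
      a = item E zero
      b = item E (suc zero)
      a≢b : a ≢ b
      a≢b eq = Fin.0≢1+n (injective E eq)
      vertexAt : Fin 2 → Vertex T
      vertexAt zero    = a
      vertexAt (suc _) = b
      vertexAt-injective : ∀ {i j} → vertexAt i ≡ vertexAt j → i ≡ j
      vertexAt-injective {zero}     {zero}     _  = ≡.refl
      vertexAt-injective {zero}     {suc zero} eq = ⊥-elim (a≢b eq)
      vertexAt-injective {suc zero} {zero}     eq = ⊥-elim (a≢b (≡.sym eq))
      vertexAt-injective {suc zero} {suc zero} _  = ≡.refl
      path : Path T a b 1
      path = record
        { vertexAt = vertexAt ; edgeAt = λ _ → e
        ; vertexAt-injective = vertexAt-injective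
        ; edgeAt-injective = λ { {zero} {zero} _ → ≡.refl }
        ; start = ≡.refl ; end = ≡.refl
        ; left∈ = λ { zero → sound E zero } ; right∈ = λ { zero → sound E (suc zero) } }
      shortest : ∀ l → Path T a b l → 1 ℕ.≤ l
      shortest zero    q = ⊥-elim (a≢b (≡.trans (≡.sym (Path.start q)) (Path.end q)))
      shortest (suc l) q = ℕ.s≤s ℕ.z≤n

    allVertices≡ : ∀ v → u ≡ v
    allVertices≡ v = trivial (IsHypertree.connected tree u v)
      where
      trivial : ∃[ l ] Path T u v l → u ≡ v
      trivial (zero  , q) = ≡.trans (≡.sym (Path.start q)) (Path.end q)
      trivial (suc l , q) = ⊥-elim (noEdge (Path.edgeAt q zero))

    -- For d = 0 there are no subscripts from 2 to d, so nothing is attached and both sides are a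
    -- single vertex.
    point-≅ : ∀ c → T ≅ pendantTree (suc (suc r′)) 0 c
    point-≅ c = record
      { vertices = mk↔ₛ′ (λ _ → zero) (λ _ → u) (λ { zero → ≡.refl }) allVertices≡
      ; edges = mk↔ₛ′ (⊥-elim ∘ noEdge) (λ ()) (λ ()) (⊥-elim ∘ noEdge)
      ; incident = λ v e → ⊥-elim (noEdge e)
      }

    -- Without edges all neighbour sums are 0, so the constant vector 1 is a strict test vector for
    -- every positive κ.
    point-bound : ∀ κ → 0# < κ → ∀ lam → IsLambda₁ ℝ (suc (suc r′)) T lam → lam < recip (suc r′) * κ
    point-bound κ κ>0 = spectralRadius-< R (λ _ → 1#) κ (λ _ → 0<1) (λ v → <⇒≤ (strict v)) u (strict u) (suc (suc r′)) r′ ≡.refl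
      where
      R : Rooted T
      R = proj₁ (hypertree-rooted tree u)
      strict : ∀ v → neighbourSum R (λ _ → 1#) v < κ * 1#
      strict v = <-resp (≈-sym (∑-0 (λ w → 0*-cong 1# (⟦⟧-no (adjacent? T v w) (λ (_ , e , _) → noEdge e))))) (≈-sym (*-identityʳ κ)) κ>0

theorem2p1p3 : ∀ {c ℓ₁ ℓ₂} (ℝ : RealNumbers c ℓ₁ ℓ₂) (let open RealNumbers ℝ) →
    (m : ℕ) .{{_ : NonTrivial m}} (T : Hypergraph) (k d p : ℕ) →
    Uniform m T → IsHypertree T → size T ≡ k → IsDiameter T d → d ≡ 2 ℕ.* p →
    sizeBound m d ℚᵘ.≤ + k / 1 →
    (λT : Carrier) → IsLambda₁ ℝ m T λT →
    ((λ* : Carrier) →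
    IsLambda₁ ℝ m (pendantTree m d (onlyAt (p ℕ.+ 1) (k ℕ.∸ d))) λ* →
    λT ≤ λ* ×
    (λT ≈ λ* → T ≅ pendantTree m d (onlyAt (p ℕ.+ 1) (k ℕ.∸ d)))) ×
    ((s : Carrier) →
    s IsSqrtOf fromℕ# ((m ℕ.∸ 1) ℕ.^ 2 ℕ.+ 4 ℕ.* (k ℕ.∸ d) ℕ.* (m ℕ.∸ 1)) →
    λT < (fromℕ# (m ℕ.∸ 1) + s) * recip (2 ℕ.* m ℕ.∸ 2))
theorem2p1p3 ℝ (suc (suc r′)) T k d zero uniform tree _ diameter ≡.refl _ λT isλT =
  ≅⇒extremal ℝ (suc (suc r′)) (point-≅ ℝ r′ T uniform tree diameter (onlyAt 1 k)) λT isλT ,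
  λ s isSqrt → RealNumbers.<-respʳ-≈ ℝ (κ₀-scaled ℝ r′ k s isSqrt)
    (point-bound ℝ r′ T uniform tree diameter (κ₀ ℝ r′ k s isSqrt) (κ₀>0 ℝ r′ k s isSqrt) λT isλT)
theorem2p1p3 ℝ (suc (suc r′)) T k d (suc p′) uniform tree size≡ diameter d≡ bound λT isλT =
  longer d (≡.trans d≡ (≡.cong suc (≡.trans (ℕ.+-suc p′ (p′ ℕ.+ 0)) (≡.cong (λ q → suc (p′ ℕ.+ q)) (ℕ.+-identityʳ p′))))) diameter bound
    (pendantTree (suc (suc r′)) d (onlyAt (suc p′ ℕ.+ 1) (k ℕ.∸ d))) ≡.refl
  where
  open RealNumbers ℝ using (Carrier; _≤_; _<_; _≈_; _+_; _*_; recip; fromℕ#; _IsSqrtOf_; <-respʳ-≈)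
  -- For p ≥ 1 the diameter is written as 2 plus an even number; the estimates take d - 2 as their
  -- parameter and thereby avoid truncated subtraction.
  longer : ∀ d → d ≡ 2 ℕ.+ (p′ ℕ.+ p′) → IsDiameter T d → sizeBound (suc (suc r′)) d ℚᵘ.≤ + k / 1 →
    ∀ H → pendantTree (suc (suc r′)) d (onlyAt (suc p′ ℕ.+ 1) (k ℕ.∸ d)) ≡ H →
    ((λ* : Carrier) → IsLambda₁ ℝ (suc (suc r′)) H λ* → λT ≤ λ* × (λT ≈ λ* → T ≅ H)) ×
    ((s : Carrier) → s IsSqrtOf fromℕ# (suc r′ ℕ.^ 2 ℕ.+ 4 ℕ.* (k ℕ.∸ d) ℕ.* suc r′) →
      λT < (fromℕ# (suc r′) + s) * recip (2 ℕ.* suc (suc r′) ℕ.∸ 2))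
  longer d ≡.refl ((u , v , path , _) , _) bound H T*≡H =
    extremal ℝ r′ (p′ ℕ.+ p′) p′ k ≡.refl large T uniform tree size≡ path λT isλT H T*≡H ,
    λ s isSqrt → <-respʳ-≈ (κ₀-scaled ℝ r′ (k ℕ.∸ d) s isSqrt)
      (quadratic-bound ℝ r′ (k ℕ.∸ d) s isSqrt (p′ ℕ.+ p′) k ≡.refl large uniform tree size≡ u λT isλT)
    where
    large : 4 ℕ.* (d ℕ.* d) ℕ.* suc r′ ℕ.+ 2 ℕ.≤ 4 ℕ.* k ℕ.+ suc r′
    large = sizeBound⇒large r′ d k bound
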